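{- Let $\Gamma=(X,\mathcal E)$ be the dodecahedron graph (the distance-regular graph with $20$ vertices and intersection array $\{3,2,1,1,1;1,1,1,2,3\}$); the spectrum of its adjacency matrix $A$ is $3^1(\sqrt5)^31^50^4(-2)^4(-\sqrt5)^3$. Let $x\in X$ and $T=T(x)$. Order the three vertices of $\Gamma_1(x)$ arbitrarily, and order $\Gamma_2(x)$ as $y_1,\dots,y_6$ so that each of the pairs $\{y_1,y_2\},\{y_3,y_4\},\{y_5,y_6\}$ has a common neighbor in $\Gamma_1(x)$, and every edge inside $\Gamma_2(x)$ joins a vertex of $\{y_1,y_3,y_6\}$ to a vertex of $\{y_2,y_4,y_5\}$. Then the standard module $V=\mathbb C^X$ is an orthogonal direct sum of irreducible $T$-modules $V=W_0\oplus W_{1,a}\oplus W_{1,b}\oplus W_2$, where two summands are isomorphic if and only if they have the same type in the following list, and the data are as listed. Each listed basis is a pure basis of the module. For each summand other than $W_0$, the seed vector $\nu$ spans $E_r^*W$ (so $\dim E_r^*W=1$), where $r$ is the endpoint of the summand $W$, and is given by its essential part. Type I ($W_0$): endpoint 0, multiplicity 1, dimension 6, diameter 5, shape $(1,1,1,1,1,1)$; basis $e_0^*,\dots,e_5^*$; matrix representing $A$: $\begin{pmatrix}0&3&0&0&0&0\\1&0&2&0&0&0\\0&1&1&1&0&0\\0&0&1&1&1&0\\0&0&0&2&0&1\\0&0&0&0&3&0\end{pmatrix}$, with eigenvalues $3,\sqrt5,1,0,-2,-\sqrt5$. Type II ($W_{1,a},W_{1,b}$): endpoint 1, multiplicity 2,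 dimension 6, diameter 3, shape $(1,2,2,1)$; basis $\nu,A\nu,E_2^*A^2\nu,E_3^*A^2\nu,E_3^*A^3\nu,E_4^*A^3\nu$ (with $A\nu=E_2^*A\nu$), where $\nu=[1,-1,0]$ for $W_{1,a}$ and $\nu=[1,1,-2]$ for $W_{1,b}$; matrix representing $A$: $\begin{pmatrix}0&2&-1&0&0&0\\1&0&1&1&1&0\\0&1&0&0&1&0\\0&1&-1&1&1&0\\0&0&1&0&-1&1\\0&0&0&1&2&0\end{pmatrix}$, with eigenvalues $\sqrt5,1,1,0,-2,-\sqrt5$. Type III ($W_2$): endpoint 2, multiplicity 1, dimension 2, diameter 1, shape $(1,1)$; basis $\nu,E_3^*A\nu$, where $\nu=[1,-1,1,-1,-1,1]$; matrix representing $A$: $\begin{pmatrix}-1&1\\1&-1\end{pmatrix}$, with eigenvalues $0,-2$. Moreover $\dim T=6^2+6^2+2^2=76$.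
   Context: Let $\Gamma=(X,\mathcal E)$ be a finite undirected connected graph without loops or multiple edges, with path-length distance $d$ and diameter $D\ge1$; put $\Gamma_i(x)=\{y\in X:d(x,y)=i\}$. $\Gamma$ is distance-regular if for all $0\le h,i,j\le D$ the number $p^h_{i,j}=|\Gamma_i(y)\cap\Gamma_j(z)|$ is the same for all $y,z\in X$ with $d(y,z)=h$. Its intersection array is $\{b_0,\dots,b_{D-1};c_1,\dots,c_D\}$ with $b_i=p^i_{1,i+1}$, $c_i=p^i_{1,i-1}$. $A\in\mathrm{Mat}_X(\mathbb C)$ is the adjacency matrix; in its spectrum, exponents denote multiplicities. The standard module $V=\mathbb C^X$ (column vectors) carries the Hermitian inner product $\langle u,v\rangle=u^t\bar v$. Fix a base vertex $x\in X$. For $0\le i\le D$, $E_i^*=E_i^*(x)$ is the diagonal matrix with $(y,y)$-entry $1$ if $d(x,y)=i$ and $0$ otherwise, and $e_i^*\in V$ is the vector with $y$-entry $1$ if $d(x,y)=i$ and $0$ otherwise. The Terwilliger algebra $T=T(x)$ is the subalgebra of $\mathrm{Mat}_X(\mathbb C)$ generated by $A$ and $E_0^*,\dots,E_D^*$. A $T$-module is a subspace $W\subseteq V$ with $BW\subseteq W$ for all $B\in T$; it is irreducible if $W\ne0$ and it properly contains no nonzero $T$-module. Isomorphisms of $T$-modules are vector space isomorphisms commuting with every $B\in T$. The endpoint of $W$ is $r=\min\{i:E_i^*W\ne0\}$; the diameter of an irreducible $W$ is $\delta=|\{i:E_i^*W\ne0\}|-1$, and its shape is $(\dim E_r^*W,\dots,\dim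 E_{r+\delta}^*W)$. The multiplicity of an irreducible module is the number of summands isomorphic to it in an orthogonal decomposition of $V$ into irreducible $T$-modules. A nonzero vector is pure with support $i$ if it lies in $E_i^*V$; its essential part is the row vector of its coordinates at the vertices of $\Gamma_i(x)$, in the chosen order (all its other coordinates are $0$). A pure basis of an irreducible $T$-module is an ordered basis of pure vectors with weakly increasing supports. The matrix $B$ representing $A$ with respect to a basis $v_1,\dots,v_\ell$ is given by $Av_j=\sum_iB_{ij}v_i$. -}

module Defs where

open import Level using (0ℓ)
open import Algebra.Apartness.Structures using (IsHeytingField)
open import Algebra.Bundles.Raw using (RawMonoid; RawRing)
import Algebra.Definitions.RawMonoid as RawMonoidDefs
open import Algebra.Module.Bundles.Raw using (RawLeftModule)
open import Data.Bool.Base using (if_then_else_)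
open import Data.Fin.Base as Fin using (Fin; toℕ)
open import Data.Fin using (#_)
open import Data.Fin.Properties as Fin using (any?)
open import Data.Fin.Subset as Subset using (Subset; ∣_∣)
open import Data.Integer.Base as ℤ using (ℤ; +_; -[1+_])
open import Data.List.Base as List using (List; []; _∷_; length; filter; allFin)
open import Data.List.Relation.Unary.All using (All)
open import Data.List.Relation.Unary.AllPairs using (AllPairs)
open import Data.List.Relation.Unary.Any using (Any)
open import Data.Nat.Base as ℕ using (ℕ; zero; suc)
import Data.Nat.Properties as ℕ
open import Data.Product.Base using (Σ; ∃; ∃-syntax; Σ-syntax; _×_; _,_; proj₁; proj₂)
open import Data.Sum.Base using (_⊎_)
open import Data.Vec.Base as Vec using (Vec; []; _∷_; lookup)
open import Data.Vec.Functional as Vector using (Vector)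
open import Function.Bundles using (_⇔_)
open import Function.Base using (_on_)
open import Function.Definitions using (Congruent; Injective; Surjective)
open import Relation.Binary.Core using (Rel)
open import Relation.Binary.Definitions using (Symmetric; Irreflexive; Decidable; Cotransitive)
open import Relation.Binary.PropositionalEquality.Core using (_≡_; refl)
open import Relation.Binary.Structures using (IsStrictPartialOrder)
open import Relation.Nullary.Decidable using (Dec; does; yes; no; map′; _×-dec_; ¬?)
open import Relation.Nullary.Negation using (¬_)
open import Relation.Unary using (Pred; U; _∈_; _⊆_)

-- The real line, given by Bridges' constructive axioms: an Archimedean
-- ordered Heyting field with the least-upper-bound principle for located
-- sets.  Read classically, `#` is ≠, every set is located, and these are
-- the axioms of a complete ordered field, so ℝ is the only model up to
-- isomorphism; the Bishop reals are a model in Agda itself.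
record RealNumbers : Set₁ where
  infix  8 -_
  infixl 7 _*_
  infixl 6 _+_
  infix  4 _≈_ _<_ _≤_ _#_
  field
    ℝ           : Set
    _≈_ _<_     : Rel ℝ 0ℓ
    _+_ _*_     : ℝ → ℝ → ℝ
    -_          : ℝ → ℝ
    0# 1#       : ℝ

  _#_ : Rel ℝ 0ℓ
  x # y = x < y ⊎ y < x

  _≤_ : Rel ℝ 0ℓ
  x ≤ y = ¬ (y < x)

  +-rawMonoid : RawMonoid 0ℓ 0ℓ
  +-rawMonoid = record { _≈_ = _≈_ ; _∙_ = _+_ ; ε = 0# }

  fromℕ : ℕ → ℝ
  fromℕ k = RawMonoidDefs._×_ +-rawMonoid k 1#

  IsSqrt : ℝ → ℝ → Set
  IsSqrt a s = 0# ≤ s × s * s ≈ a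

  IsUpperBound : Pred ℝ 0ℓ → ℝ → Set
  IsUpperBound S b = ∀ s → s ∈ S → s ≤ b

  IsSupremum : Pred ℝ 0ℓ → ℝ → Set
  IsSupremum S σ = IsUpperBound S σ × (∀ a → a < σ → ∃[ s ] s ∈ S × a < s)

  Located : Pred ℝ 0ℓ → Set
  Located S = ∀ a b → a < b → (∃[ s ] s ∈ S × a < s) ⊎ IsUpperBound S b

  field
    isHeytingField       : IsHeytingField _≈_ _#_ _+_ _*_ -_ 0# 1#
    isStrictPartialOrder : IsStrictPartialOrder _≈_ _<_
    <-cotrans            : Cotransitive _<_
    +-monoˡ-<            : ∀ {x y} z → x < y → x + z < y + z
    *-pos                : ∀ {x y} → 0# < x → 0# < y → 0# < x * y
    archimedean          : ∀ x → ∃[ k ] x < fromℕ k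
    supremum             : ∀ S → ∃ S → ∃ (IsUpperBound S) → Located S →
                           ∃ (IsSupremum S)

module Complex (ℜ : RealNumbers) where

  private module ℝ = RealNumbers ℜ
  open ℝ using (ℝ) public

  record ℂ : Set where
    constructor _+i_
    field
      re im : ℝ
  open ℂ public

  ofℝ : ℝ → ℂ
  ofℝ a = a +i ℝ.0#

  ℂ-rawRing : RawRing 0ℓ 0ℓ
  ℂ-rawRing = record
    { Carrier = ℂ
    ; _≈_     = λ z w → re z ℝ.≈ re w × im z ℝ.≈ im w
    ; _+_     = λ z w → (re z ℝ.+ re w) +i (im z ℝ.+ im w)
    ; _*_     = λ z w → (re z ℝ.* re w ℝ.+ ℝ.- (im z ℝ.* im w))
                          +i (re z ℝ.* im w ℝ.+ im z ℝ.* re w)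
    ; -_      = λ z → (ℝ.- re z) +i (ℝ.- im z)
    ; 0#      = ofℝ ℝ.0#
    ; 1#      = ofℝ ℝ.1#
    }

  open RawRing ℂ-rawRing public using (_≈_; _+_; _*_; -_; 0#; 1#; +-rawMonoid)
  open RawMonoidDefs +-rawMonoid public using (sum)

  infix 4 _#_
  _#_ : Rel ℂ 0ℓ
  z # w = (re z ℝ.# re w) ⊎ (im z ℝ.# im w)

  conj : ℂ → ℂ
  conj z = re z +i (ℝ.- im z)

  ofℤ : ℤ → ℂ
  ofℤ (+ k)    = ofℝ (ℝ.fromℕ k)
  ofℤ -[1+ k ] = - ofℝ (ℝ.fromℕ (suc k))

  indicator : {P : Set} → Dec P → ℂ
  indicator P? = if does P? then 1# else 0#

module LinearAlgebra (ℜ : RealNumbers) where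

  open Complex ℜ public

  functionSpace : Set → RawLeftModule ℂ 0ℓ 0ℓ
  functionSpace I = record
    { Carrierᴹ = I → ℂ
    ; _≈ᴹ_     = λ u v → ∀ i → u i ≈ v i
    ; _+ᴹ_     = λ u v i → u i + v i
    ; _*ₗ_     = λ a v i → a * v i
    ; 0ᴹ       = λ _ → 0#
    ; -ᴹ_      = λ v i → - v i
    }

  -- Subspaces are predicates, with I = Fin n for ℂⁿ and I = Fin n × Fin n
  -- for the n × n matrices.
  module _ {I : Set} where

    open RawLeftModule (functionSpace I) public
      using (_≈ᴹ_; _+ᴹ_; _*ₗ_; 0ᴹ; +ᴹ-rawMonoid)

    sumᴹ : ∀ {k} → Vector (I → ℂ) k → I → ℂ
    sumᴹ = RawMonoidDefs.sum +ᴹ-rawMonoid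

    combination : ∀ {k} → Vector ℂ k → Vector (I → ℂ) k → I → ℂ
    combination a v = sumᴹ (λ j → a j *ₗ v j)

    -- v ≠ 0, in the positive form: some coordinate is apart from 0.
    IsNonzero : (I → ℂ) → Set
    IsNonzero v = ∃[ i ] v i # 0#

    Nonzero : Pred (I → ℂ) 0ℓ → Set
    Nonzero W = ∃[ w ] w ∈ W × IsNonzero w

    record IsSubspace (W : Pred (I → ℂ) 0ℓ) : Set where
      field
        resp-≈   : ∀ {u v} → u ≈ᴹ v → u ∈ W → v ∈ W
        0-closed : 0ᴹ ∈ W
        +-closed : ∀ {u v} → u ∈ W → v ∈ W → u +ᴹ v ∈ W
        *-closed : ∀ a {v} → v ∈ W → a *ₗ v ∈ W

    record IsBasis (W : Pred (I → ℂ) 0ℓ) {k} (v : Vector (I → ℂ) k) : Set where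
      field
        inside      : ∀ j → v j ∈ W
        spanning    : ∀ w → w ∈ W → ∃[ a ] w ≈ᴹ combination a v
        independent : ∀ a → combination a v ≈ᴹ 0ᴹ → ∀ j → a j ≈ 0#

    HasDim : Pred (I → ℂ) 0ℓ → ℕ → Set
    HasDim W k = Σ[ v ∈ Vector (I → ℂ) k ] IsBasis W v

  Matrix : ℕ → Set
  Matrix n = Fin n × Fin n → ℂ

  infixr 8 _·_
  _·_ : ∀ {n} → Matrix n → Vector ℂ n → Vector ℂ n
  (M · v) y = sum (λ z → M (y , z) * v z)

  infixr 8 _⊗_
  _⊗_ : ∀ {n} → Matrix n → Matrix n → Matrix n
  (M ⊗ N) (y , z) = sum (λ w → M (y , w) * N (w , z))

  identity : ∀ {n} → Matrix n
  identity (y , z) = indicator (y Fin.≟ z)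

  ofℤ-matrix : ∀ {n} → Vec (Vec ℤ n) n → Matrix n
  ofℤ-matrix rows (i , j) = ofℤ (lookup (lookup rows i) j)

  ⟨_,_⟩ : ∀ {n} → Vector ℂ n → Vector ℂ n → ℂ
  ⟨ u , v ⟩ = sum (λ y → u y * conj (v y))

  Eigenspace : ∀ {n} → Matrix n → ℂ → Pred (Vector ℂ n) 0ℓ
  Eigenspace M θ v = M · v ≈ᴹ θ *ₗ v

  -- The list consists of the distinct eigenvalues with their multiplicities.
  -- As the dimensions of the eigenspaces add up to n, the matrix is
  -- diagonalizable and these are also the algebraic multiplicities.
  record HasSpectrum {n} (M : Matrix n) (σ : List (ℂ × ℕ)) : Set where
    field
      distinct       : AllPairs (_#_ on proj₁) σ
      multiplicities : All (λ (θ , m) → HasDim (Eigenspace M θ) m) σ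
      exhaustive     : ∀ θ → Nonzero (Eigenspace M θ) → Any (λ (η , _) → θ ≈ η) σ
      total          : List.sum (List.map proj₂ σ) ≡ n

  record IsOrthogonalDirectSum {n k} (W : Vector (Pred (Vector ℂ n) 0ℓ) k) : Set where
    field
      decompose  : ∀ v → ∃[ w ] (∀ i → w i ∈ W i) × v ≈ᴹ sumᴹ w
      unique     : ∀ w → (∀ i → w i ∈ W i) → sumᴹ w ≈ᴹ 0ᴹ → ∀ i → w i ≈ᴹ 0ᴹ
      orthogonal : ∀ {i j} → ¬ i ≡ j → ∀ u v → u ∈ W i → v ∈ W j → ⟨ u , v ⟩ ≈ 0#

record Graph (n : ℕ) : Set₁ where
  field
    Adj    : Rel (Fin n) 0ℓ
    adj?   : Decidable Adj
    sym    : Symmetric Adj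
    irrefl : Irreflexive _≡_ Adj

module _ {n} (Γ : Graph n) where

  open Graph Γ

  data Walk : ℕ → Fin n → Fin n → Set where
    []  : ∀ {y} → Walk 0 y y
    _∷_ : ∀ {k y w z} → Adj y w → Walk k w z → Walk (suc k) y z

  walk? : ∀ k y z → Dec (Walk k y z)
  walk? zero    y z = map′ (λ { refl → [] }) (λ { [] → refl }) (y Fin.≟ z)
  walk? (suc k) y z =
    map′ (λ (_ , a , p) → a ∷ p) (λ { (a ∷ p) → _ , a , p })
         (any? λ w → adj? y w ×-dec walk? k w z)

  -- Distance y z i  means  d(y,z) = i.
  Distance : Fin n → Fin n → ℕ → Set
  Distance y z i = Walk i y z × (∀ {k} → k ℕ.< i → ¬ Walk k y z)

  distance? : ∀ y z i → Dec (Distance y z i)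
  distance? y z i = walk? i y z ×-dec ℕ.allUpTo? (λ k → ¬? (walk? k y z)) i

  -- |Γᵢ(y) ∩ Γⱼ(z)|
  intersectionSize : (i j : ℕ) (y z : Fin n) → ℕ
  intersectionSize i j y z =
    length (filter (λ w → distance? y w i ×-dec distance? z w j) (allFin n))

  Connected : Set
  Connected = ∀ y z → ∃[ k ] Walk k y z

  IsDiameter : ℕ → Set
  IsDiameter D = (∀ y z i → Distance y z i → i ℕ.≤ D) × (∃[ y ] ∃[ z ] Distance y z D)

  record IsDistanceRegular (D : ℕ) : Set where
    field
      connected : Connected
      diameter  : IsDiameter D
      D≥1       : 1 ℕ.≤ D
      p         : (h i j : ℕ) → ℕ
      regular   : ∀ {h i j} → h ℕ.≤ D → i ℕ.≤ D → j ℕ.≤ D →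
                  ∀ y z → Distance y z h → intersectionSize i j y z ≡ p h i j

    b c : Vec ℕ D
    b = Vec.tabulate (λ i → p (toℕ i) 1 (suc (toℕ i)))
    c = Vec.tabulate (λ i → p (suc (toℕ i)) 1 (toℕ i))

  HasIntersectionArray : ∀ {D} → Vec ℕ D → Vec ℕ D → Set
  HasIntersectionArray {D} bs cs = Σ[ Γ-dr ∈ IsDistanceRegular D ]
    IsDistanceRegular.b Γ-dr ≡ bs × IsDistanceRegular.c Γ-dr ≡ cs

  record IsOrdering (x : Fin n) (i : ℕ) {k} (ys : Vector (Fin n) k) : Set where
    field
      distinct : Injective _≡_ _≡_ ys
      complete : ∀ y → Distance x y i ⇔ (∃[ j ] ys j ≡ y)

IsDodecahedron : Graph 20 → Set
IsDodecahedron Γ =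
  HasIntersectionArray Γ (3 ∷ 2 ∷ 1 ∷ 1 ∷ 1 ∷ []) (1 ∷ 1 ∷ 1 ∷ 2 ∷ 3 ∷ [])

module _ {n} (Γ : Graph n) (x : Fin n) where

  open Graph Γ

  CommonNeighbour : Fin n → Fin n → Set
  CommonNeighbour u v = ∃[ w ] Distance Γ x w 1 × Adj w u × Adj w v

  InY₁₃₆ InY₂₄₅ : Fin 6 → Set
  InY₁₃₆ k = k ≡ # 0 ⊎ k ≡ # 2 ⊎ k ≡ # 5
  InY₂₄₅ k = k ≡ # 1 ⊎ k ≡ # 3 ⊎ k ≡ # 4

  -- The required ordering y₁,…,y₆ of Γ₂(x); the index of yᵢ is i - 1.
  record IsAdmissible (y : Vector (Fin n) 6) : Set where
    field
      ordering : IsOrdering Γ x 2 y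
      pair₁₂   : CommonNeighbour (y (# 0)) (y (# 1))
      pair₃₄   : CommonNeighbour (y (# 2)) (y (# 3))
      pair₅₆   : CommonNeighbour (y (# 4)) (y (# 5))
      edges    : ∀ k l → Adj (y k) (y l) →
                 (InY₁₃₆ k × InY₂₄₅ l) ⊎ (InY₂₄₅ k × InY₁₃₆ l)

module AdjacencyMatrix (ℜ : RealNumbers) {n} (Γ : Graph n) where

  open LinearAlgebra ℜ
  open Graph Γ

  A : Matrix n
  A (y , z) = indicator (adj? y z)

module Terwilliger (ℜ : RealNumbers) {n} (Γ : Graph n) (D : ℕ) (x : Fin n) where

  open LinearAlgebra ℜ
  open AdjacencyMatrix ℜ Γ public

  V : Set
  V = Vector ℂ n

  e* : ℕ → V
  e* i y = indicator (distance? Γ x y i)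

  E* : ℕ → Matrix n
  E* i (y , z) = indicator ((y Fin.≟ z) ×-dec distance? Γ x y i)

  data T : Pred (Matrix n) 0ℓ where
    A∈T      : T A
    E*∈T     : ∀ {i} → i ℕ.≤ D → T (E* i)
    1-closed : T identity
    0-closed : T 0ᴹ
    +-closed : ∀ {B C} → T B → T C → T (B +ᴹ C)
    *-closed : ∀ a {B} → T B → T (a *ₗ B)
    ⊗-closed : ∀ {B C} → T B → T C → T (B ⊗ C)
    resp-≈   : ∀ {B C} → B ≈ᴹ C → T B → T C

  E*⟨_⟩ : ℕ → Pred V 0ℓ → Pred V 0ℓ
  E*⟨ i ⟩ W v = ∃[ w ] w ∈ W × v ≈ᴹ E* i · w

  record IsModule (W : Pred V 0ℓ) : Set where
    field
      isSubspace : IsSubspace W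
      closed     : ∀ {B w} → B ∈ T → w ∈ W → B · w ∈ W

  record IsIrreducible (W : Pred V 0ℓ) : Set₁ where
    field
      isModule : IsModule W
      nonzero  : Nonzero W
      minimal  : ∀ W′ → IsModule W′ → Nonzero W′ → W′ ⊆ W → W ⊆ W′

  infix 4 _≅_
  record _≅_ (W W′ : Pred V 0ℓ) : Set where
    _≈ˢ_ : ∀ {W : Pred V 0ℓ} → Rel (∃ W) 0ℓ
    u ≈ˢ v = proj₁ u ≈ᴹ proj₁ v
    field
      to         : ∃ W → ∃ W′
      cong       : Congruent _≈ˢ_ _≈ˢ_ to
      injective  : Injective _≈ˢ_ _≈ˢ_ to
      surjective : Surjective _≈ˢ_ _≈ˢ_ to
      +-homo     : ∀ u v w → proj₁ w ≈ᴹ proj₁ u +ᴹ proj₁ v →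
                   proj₁ (to w) ≈ᴹ proj₁ (to u) +ᴹ proj₁ (to v)
      *-homo     : ∀ a v w → proj₁ w ≈ᴹ a *ₗ proj₁ v →
                   proj₁ (to w) ≈ᴹ a *ₗ proj₁ (to v)
      commutes   : ∀ B → B ∈ T → ∀ v w → proj₁ w ≈ᴹ B · proj₁ v →
                   proj₁ (to w) ≈ᴹ B · proj₁ (to v)

  HasEndpoint : Pred V 0ℓ → ℕ → Set
  HasEndpoint W r =
    r ℕ.≤ D × Nonzero (E*⟨ r ⟩ W) × (∀ i → i ℕ.< r → ¬ Nonzero (E*⟨ i ⟩ W))

  HasDiameter : Pred V 0ℓ → ℕ → Set
  HasDiameter W δ = Σ[ S ∈ Subset (suc D) ]
    (∀ i → (i Subset.∈ S) ⇔ Nonzero (E*⟨ toℕ i ⟩ W)) × ∣ S ∣ ≡ suc δ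

  HasShape : Pred V 0ℓ → ∀ {δ} → Vec ℕ (suc δ) → Set
  HasShape W {δ} s = ∃[ r ] HasEndpoint W r × HasDiameter W δ ×
    (∀ k → HasDim (E*⟨ r ℕ.+ toℕ k ⟩ W) (lookup s k))

  -- Here W is an orthogonal decomposition of V into irreducible modules.
  HasMultiplicity : ∀ {k} → Vector (Pred V 0ℓ) k → Fin k → ℕ → Set
  HasMultiplicity {k} W i m = Σ[ S ∈ Subset k ]
    (∀ j → (j Subset.∈ S) ⇔ (W j ≅ W i)) × ∣ S ∣ ≡ m

  IsPure : V → ℕ → Set
  IsPure v i = i ℕ.≤ D × IsNonzero v × v ∈ E*⟨ i ⟩ U

  record IsPureBasis (W : Pred V 0ℓ) {k} (v : Vector V k) : Set where
    field
      isBasis    : IsBasis W v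
      support    : Fin k → ℕ
      pure       : ∀ j → IsPure (v j) (support j)
      increasing : ∀ {i j} → i Fin.≤ j → support i ℕ.≤ support j

  Represents : ∀ {k} → Matrix k → Vector V k → Set
  Represents B v = ∀ j → A · v j ≈ᴹ combination (λ i → B (i , j)) v

  -- The vector whose essential part is c: c j at the vertex ys j, 0 elsewhere.
  fromEssential : ∀ {k} → Vector (Fin n) k → Vec ℤ k → V
  fromEssential ys c y = sum (λ j → ofℤ (lookup c j) * indicator (ys j Fin.≟ y))

  record HasData (W : Pred V 0ℓ) (r k δ : ℕ) (shape : Vec ℕ (suc δ))
                 (basis : Vector V k) (B : Vec (Vec ℤ k) k)
                 (eigenvalues : List (ℂ × ℕ)) : Set₁ where
    field
      isIrreducible : IsIrreducible W
      endpoint      : HasEndpoint W r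
      dimension     : HasDim W k
      diameter      : HasDiameter W δ
      hasShape      : HasShape W shape
      isPureBasis   : IsPureBasis W basis
      represents    : Represents (ofℤ-matrix B) basis
      spectrum      : HasSpectrum (ofℤ-matrix B) eigenvalues

  IsSeed : Pred V 0ℓ → ℕ → V → Set
  IsSeed W r ν = HasEndpoint W r × IsBasis (E*⟨ r ⟩ W) {1} (λ _ → ν)

  basis-I : Vector V 6
  basis-I i = e* (toℕ i)

  basis-II : V → Vector V 6
  basis-II ν = Vector.fromList
    ( ν
    ∷ A · ν
    ∷ E* 2 · A · A · ν
    ∷ E* 3 · A · A · ν
    ∷ E* 3 · A · A · A · ν
    ∷ E* 4 · A · A · A · ν
    ∷ [])

  basis-III : V → Vector V 2
  basis-III ν = Vector.fromList (ν ∷ E* 3 · A · ν ∷ [])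

data ModuleType : Set where
  I II III : ModuleType

module _ where
  open import Agda.Builtin.FromNat using (Number; fromNat)
  open import Agda.Builtin.FromNeg using (Negative; fromNeg)
  open import Data.Unit.Base using (⊤; tt)
  import Data.Integer.Literals as ℤ-literals
  import Data.Nat.Literals as ℕ-literals

  private instance
    ℕ-number : Number ℕ
    ℕ-number = ℕ-literals.number

    ℤ-number : Number ℤ
    ℤ-number = ℤ-literals.number

    ℤ-negative : Negative ℤ
    ℤ-negative = ℤ-literals.negative

  seed-IIa seed-IIb : Vec ℤ 3
  seed-IIa = 1 ∷ -1 ∷ 0 ∷ []
  seed-IIb = 1 ∷ 1 ∷ -2 ∷ []

  seed-III : Vec ℤ 6
  seed-III = 1 ∷ -1 ∷ 1 ∷ -1 ∷ -1 ∷ 1 ∷ []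

  matrix-I matrix-II : Vec (Vec ℤ 6) 6
  matrix-I =
    (0 ∷ 3 ∷ 0 ∷ 0 ∷ 0 ∷ 0 ∷ []) ∷
    (1 ∷ 0 ∷ 2 ∷ 0 ∷ 0 ∷ 0 ∷ []) ∷
    (0 ∷ 1 ∷ 1 ∷ 1 ∷ 0 ∷ 0 ∷ []) ∷
    (0 ∷ 0 ∷ 1 ∷ 1 ∷ 1 ∷ 0 ∷ []) ∷
    (0 ∷ 0 ∷ 0 ∷ 2 ∷ 0 ∷ 1 ∷ []) ∷
    (0 ∷ 0 ∷ 0 ∷ 0 ∷ 3 ∷ 0 ∷ []) ∷ []
  matrix-II =
    (0 ∷ 2 ∷ -1 ∷ 0 ∷  0 ∷ 0 ∷ []) ∷
    (1 ∷ 0 ∷  1 ∷ 1 ∷  1 ∷ 0 ∷ []) ∷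
    (0 ∷ 1 ∷  0 ∷ 0 ∷  1 ∷ 0 ∷ []) ∷
    (0 ∷ 1 ∷ -1 ∷ 1 ∷  1 ∷ 0 ∷ []) ∷
    (0 ∷ 0 ∷  1 ∷ 0 ∷ -1 ∷ 1 ∷ []) ∷
    (0 ∷ 0 ∷  0 ∷ 1 ∷  2 ∷ 0 ∷ []) ∷ []

  matrix-III : Vec (Vec ℤ 2) 2
  matrix-III =
    (-1 ∷  1 ∷ []) ∷
    ( 1 ∷ -1 ∷ []) ∷ []

  module Eigenvalues (ℜ : RealNumbers) (√5 : RealNumbers.ℝ ℜ) where

    open Complex ℜ

    spectrum-Γ spectrum-I spectrum-II spectrum-III : List (ℂ × ℕ)
    spectrum-Γ =
      (ofℤ 3 , 1) ∷ (ofℝ √5 , 3) ∷ (ofℤ 1 , 5) ∷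
      (ofℤ 0 , 4) ∷ (ofℤ -2 , 4) ∷ (- ofℝ √5 , 3) ∷ []
    spectrum-I =
      (ofℤ 3 , 1) ∷ (ofℝ √5 , 1) ∷ (ofℤ 1 , 1) ∷
      (ofℤ 0 , 1) ∷ (ofℤ -2 , 1) ∷ (- ofℝ √5 , 1) ∷ []
    spectrum-II =
      (ofℝ √5 , 1) ∷ (ofℤ 1 , 2) ∷
      (ofℤ 0 , 1) ∷ (ofℤ -2 , 1) ∷ (- ofℝ √5 , 1) ∷ []
    spectrum-III =
      (ofℤ 0 , 1) ∷ (ofℤ -2 , 1) ∷ []

{-# OPTIONS --safe #-}

-- The intersection numbers say that Γ is cubic without triangles and squares
-- and that every path of length 2 lies on exactly one pentagon.  Unfolding
-- pentagons from the face through v₀ , x , v₁ labels the vertices of Γ by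
-- those of a standard dodecahedron; the labelling is locally bijective, Γ is
-- connected and both have 20 vertices, so it is an isomorphism.  In the labels
-- all vectors of the theorem have integer coordinates; an admissible ordering
-- of Γ₂(x) only affects the sign of ν₂, whose values alternate around a
-- hexagon.  So the actions of A and of the E*ᵢ on the bases, the dual bases and
-- the eigenvectors come down to finite computations over ℤ and ℤ[√5], carried
-- over to ℂ by ring homomorphisms.  Every element of T acts by equal matrices on
-- W₁ₐ and W₁b, so that dim T ≤ 6² + 6² + 2²; conversely, explicit words in A
-- and the E*ᵢ act as nonzero multiples of the 76 matrix units.  The matrix
-- units also yield irreducibility, and modules of different types differ in
-- the indices i with E*ᵢ W ≠ 0.

module Submission where

open import Defs
open import Level using (0ℓ)
open import Algebra.Apartness.Structures using (IsHeytingField)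
open import Algebra.Bundles using (CommutativeRing)
open import Algebra.Bundles.Raw using (RawRing)
import Algebra.Definitions.RawMonoid as RawMonoidDefs
import Algebra.Properties.AbelianGroup as AbelianGroupProperties
import Algebra.Properties.Ring as RingProperties
import Algebra.Properties.Semiring.Mult as Multiples
import Algebra.Properties.Semiring.Sum
import Algebra.Solver.Ring
open import Algebra.Solver.Ring.AlmostCommutativeRing using (fromCommutativeRing; _-Raw-AlmostCommutative⟶_)
open import Algebra.Structures using (IsCommutativeRing)
open import Data.Bool.Base using (true; if_then_else_)
open import Data.Empty using (⊥; ⊥-elim)
open import Data.Fin using (Fin; #_)
open import Data.Fin.Base as Fin using (zero; suc; toℕ; _↑ˡ_; _↑ʳ_; splitAt; combine; remQuot; punchOut)
open import Data.Fin.Patterns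
import Data.Fin.Permutation as Permutation
import Data.Fin.Properties as Fin
open import Data.Fin.Subset as Subset using (Subset; ∣_∣)
open import Data.Integer.Base as ℤ using (ℤ; +_; -[1+_])
import Data.Integer.Properties as ℤ
open import Data.List.Base as List using (List; []; _∷_; length; filter; allFin)
import Data.List.Membership.Propositional.Properties as Membership
open import Data.List.Relation.Unary.All as All using (All; []; _∷_)
import Data.List.Relation.Unary.All.Properties as AllProperties
open import Data.List.Relation.Unary.AllPairs using ([]; _∷_)
import Data.List.Relation.Unary.AllPairs.Properties as AllPairs
import Data.List.Relation.Unary.Any as Any
import Data.List.Relation.Unary.Any.Properties as AnyProperties
open import Data.List.Relation.Unary.Unique.Propositional using (Unique)
import Data.List.Relation.Unary.Unique.Propositional.Properties as Unique
open import Data.Maybe.Base using (Maybe; just; nothing)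
open import Data.Nat.Base as ℕ using (ℕ; zero; suc; z≤n; s≤s)
open import Data.Nat.ListAction renaming (sum to sum-ℕ)
import Data.Nat.Properties as ℕ
open import Data.Product.Base using (Σ; ∃; ∃-syntax; Σ-syntax; _×_; _,_; proj₁; proj₂)
import Data.Product.Properties as Product
open import Data.Sum.Base using (_⊎_; inj₁; inj₂; [_,_]′; map)
open import Data.Unit.Base using (⊤; tt)
open import Data.Vec.Base as Vec using (Vec; []; _∷_; lookup; tabulate)
open import Data.Vec.Functional using (Vector)
import Data.Vec.Properties as Vec
open import Function.Base using (_∘_; id; case_of_)
open import Function.Bundles using (_⇔_; mk⇔; Equivalence)
open import Function.Definitions using (Injective)
open import Relation.Binary.Definitions using (DecidableEquality; tri<; tri≈; tri>)
open import Relation.Binary.PropositionalEquality.Core as ≡ using (_≡_; _≢_; ≢-sym)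
import Relation.Binary.Reasoning.Setoid
open import Relation.Binary.Structures using (IsStrictPartialOrder)
open import Relation.Nullary.Decidable
  using (Dec; does; yes; no; map′; dec-true; _×-dec_; _⊎-dec_; _→-dec_; ¬?)
open import Relation.Nullary.Negation using (¬_; contradiction)
open import Relation.Unary using (Pred; Decidable; _∈_; _⊆_)

-- Real and complex numbers

-- Constructively, nonzero means apart from 0, and ranks cannot be found by elimination over ℂ.
-- Independence, spanning and multiplicities therefore come from explicit dual bases, scaled by
-- integers so as to have coordinates in ℤ or ℤ[√5]. All matrix units outside type I grow from two
-- words. On Γ₁(x), `E*₁ A E*₀ A E*₁` is the all-ones matrix, with eigenvalue 3 on type I and 0 on
-- type II; so `3 E*₁` minus it sees only type II. On Γ₂(x), `E*₂ A E*₁ A E*₂` is the identity plus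
-- the exchange of the two vertices of each pair; subtracting `2 E*₂` leaves `Z`, which is -2 times
-- the projection onto the vectors that change sign under the exchange. These are spanned by ν₂ and
-- one vector from each summand of type II. Compressed to them, `A` is -1 on type III and 1/2 on
-- type II. So `Z A Z + Z` acts there as 4 · (-1) - 2 = -6 and as 4 · (1/2) - 2 = 0, and sees only
-- type III.

module Integers (R : CommutativeRing 0ℓ 0ℓ) where

  open CommutativeRing R
  open Multiples semiring using (×-homo-+; ×1-homo-*) renaming (_×_ to _·1_)
  open RingProperties ring using (-0#≈0#; -‿involutive; -‿distribˡ-*; -‿distribʳ-*)
  open AbelianGroupProperties +-abelianGroup using (⁻¹-∙-comm)
  open Relation.Binary.Reasoning.Setoid setoid

  ⟦_⟧ : ℤ → Carrier
  ⟦ + n ⟧      = n ·1 1#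
  ⟦ -[1+ n ] ⟧ = - (suc n ·1 1#)

  ⟦⊖⟧ : ∀ m n → ⟦ m ℤ.⊖ n ⟧ ≈ m ·1 1# - n ·1 1#
  ⟦⊖⟧ zero    zero    = sym (-‿inverseʳ 0#)
  ⟦⊖⟧ zero    (suc n) = sym (+-identityˡ _)
  ⟦⊖⟧ (suc m) zero    = sym (trans (+-congˡ -0#≈0#) (+-identityʳ _))
  ⟦⊖⟧ (suc m) (suc n) = begin
    ⟦ suc m ℤ.⊖ suc n ⟧              ≡⟨ ≡.cong ⟦_⟧ (ℤ.[1+m]⊖[1+n]≡m⊖n m n) ⟩
    ⟦ m ℤ.⊖ n ⟧                      ≈⟨ ⟦⊖⟧ m n ⟩
    M - N                            ≈⟨ +-congʳ (trans (+-congʳ (-‿inverseʳ 1#)) (+-identityˡ M)) ⟨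
    (1# - 1# + M) - N                ≈⟨ +-congʳ (trans (+-assoc _ _ _) (trans (+-congˡ (+-comm _ _)) (sym (+-assoc _ _ _)))) ⟩
    (1# + M - 1#) - N                ≈⟨ +-assoc _ _ _ ⟩
    1# + M + (- 1# - N)              ≈⟨ +-congˡ (⁻¹-∙-comm 1# N) ⟩
    1# + M - (1# + N)                ∎
    where M = m ·1 1#
          N = n ·1 1#

  ⟦⟧-homo-neg : ∀ i → ⟦ ℤ.- i ⟧ ≈ - ⟦ i ⟧
  ⟦⟧-homo-neg (+ zero)    = sym -0#≈0#
  ⟦⟧-homo-neg (+ (suc n)) = refl
  ⟦⟧-homo-neg -[1+ n ]    = sym (-‿involutive _)

  ⟦⟧-homo-+ : ∀ i j → ⟦ i ℤ.+ j ⟧ ≈ ⟦ i ⟧ + ⟦ j ⟧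
  ⟦⟧-homo-+ (+ m)    (+ n)    = ×-homo-+ 1# m n
  ⟦⟧-homo-+ (+ m)    -[1+ n ] = ⟦⊖⟧ m (suc n)
  ⟦⟧-homo-+ -[1+ m ] (+ n)    = trans (⟦⊖⟧ n (suc m)) (+-comm _ _)
  ⟦⟧-homo-+ -[1+ m ] -[1+ n ] = begin
    - (suc (suc (m ℕ.+ n)) ·1 1#)          ≡⟨ ≡.cong (λ k → - (k ·1 1#)) (ℕ.+-suc (suc m) n) ⟨
    - ((suc m ℕ.+ suc n) ·1 1#)            ≈⟨ -‿cong (×-homo-+ 1# (suc m) (suc n)) ⟩
    - (suc m ·1 1# + suc n ·1 1#)          ≈⟨ ⁻¹-∙-comm _ _ ⟨
    - (suc m ·1 1#) - (suc n ·1 1#)        ∎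

  private
    ⟦⟧-homo-+* : ∀ m j → ⟦ + m ℤ.* j ⟧ ≈ ⟦ + m ⟧ * ⟦ j ⟧
    ⟦⟧-homo-+* m (+ n) = begin
      ⟦ + m ℤ.* + n ⟧      ≡⟨ ≡.cong ⟦_⟧ (ℤ.pos-* m n) ⟨
      (m ℕ.* n) ·1 1#      ≈⟨ ×1-homo-* m n ⟩
      m ·1 1# * n ·1 1#    ∎
    ⟦⟧-homo-+* m -[1+ n ] = begin
      ⟦ + m ℤ.* ℤ.- (+ suc n) ⟧    ≡⟨ ≡.cong ⟦_⟧ (ℤ.neg-distribʳ-* (+ m) (+ suc n)) ⟨
      ⟦ ℤ.- (+ m ℤ.* + suc n) ⟧    ≈⟨ ⟦⟧-homo-neg (+ m ℤ.* + suc n) ⟩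
      - ⟦ + m ℤ.* + suc n ⟧        ≈⟨ -‿cong (⟦⟧-homo-+* m (+ suc n)) ⟩
      - (m ·1 1# * suc n ·1 1#)    ≈⟨ -‿distribʳ-* _ _ ⟩
      m ·1 1# * - (suc n ·1 1#)    ∎

  ⟦⟧-homo-* : ∀ i j → ⟦ i ℤ.* j ⟧ ≈ ⟦ i ⟧ * ⟦ j ⟧
  ⟦⟧-homo-* (+ m)    j = ⟦⟧-homo-+* m j
  ⟦⟧-homo-* -[1+ m ] j = begin
    ⟦ ℤ.- (+ suc m) ℤ.* j ⟧    ≡⟨ ≡.cong ⟦_⟧ (ℤ.neg-distribˡ-* (+ suc m) j) ⟨
    ⟦ ℤ.- (+ suc m ℤ.* j) ⟧    ≈⟨ ⟦⟧-homo-neg (+ suc m ℤ.* j) ⟩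
    - ⟦ + suc m ℤ.* j ⟧        ≈⟨ -‿cong (⟦⟧-homo-+* (suc m) j) ⟩
    - (suc m ·1 1# * ⟦ j ⟧)    ≈⟨ -‿distribˡ-* _ _ ⟩
    - (suc m ·1 1#) * ⟦ j ⟧    ∎

  ⟦1⟧ : ⟦ + 1 ⟧ ≈ 1#
  ⟦1⟧ = +-identityʳ 1#

  -- Integer coefficients have decidable equality, unlike ℝ and ℂ, so the ring solver can compare
  -- and cancel numerals in any commutative ring.
  ⟦⟧-morphism : ℤ.+-*-rawRing -Raw-AlmostCommutative⟶ fromCommutativeRing R
  ⟦⟧-morphism = record
    { ⟦_⟧ = ⟦_⟧ ; +-homo = ⟦⟧-homo-+ ; *-homo = ⟦⟧-homo-* ; -‿homo = ⟦⟧-homo-neg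
    ; 0-homo = refl ; 1-homo = ⟦1⟧ }

  private
    decide : ∀ i j → Maybe (⟦ i ⟧ ≈ ⟦ j ⟧)
    decide i j with i ℤ.≟ j
    ... | yes ≡.refl = just refl
    ... | no  _      = nothing

  module Solver = Algebra.Solver.Ring ℤ.+-*-rawRing (fromCommutativeRing R) ⟦⟧-morphism decide

module Reals (ℜ : RealNumbers) where

  open RealNumbers ℜ public
  open IsHeytingField isHeytingField public
    using (isCommutativeRing; #⇒invertible; invertible⇒#; tight; #-cotrans)
  open IsStrictPartialOrder isStrictPartialOrder public
    using () renaming (irrefl to <-irrefl; trans to <-trans; <-resp-≈ to <-resp-≈; asym to <-asym)

  commutativeRing : CommutativeRing 0ℓ 0ℓ
  commutativeRing = record { isCommutativeRing = isCommutativeRing }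

  open CommutativeRing commutativeRing public
    using (refl; sym; trans; setoid; ring; semiring; +-cong; +-congˡ; +-congʳ; *-cong; *-congˡ; *-congʳ
          ; -‿cong; +-identityˡ; +-identityʳ; *-identityˡ; *-identityʳ; zeroˡ; zeroʳ; *-comm; +-comm
          ; *-assoc; +-assoc; -‿inverseˡ; -‿inverseʳ; _-_)
  open Integers commutativeRing public
  open Solver public using (solve; _:+_; _:*_; :-_; _:-_; _:=_; con)

  <-respʳ : ∀ {x y z} → y ≈ z → x < y → x < z
  <-respʳ = proj₁ <-resp-≈

  <-respˡ : ∀ {x y z} → y ≈ z → y < x → z < x
  <-respˡ = proj₂ <-resp-≈

  x-0≈x : ∀ x → x - 0# ≈ x
  x-0≈x = solve 1 (λ x → x :- con (+ 0) := x) refl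

  invertible⇒#0 : ∀ {x} y → x * y ≈ 1# → x # 0#
  invertible⇒#0 {x} y xy≈1 = invertible⇒#
    (y , trans (*-congˡ (x-0≈x x)) (trans (*-comm y x) xy≈1) , trans (*-congʳ (x-0≈x x)) xy≈1)

  inverse : ∀ {x} → x # 0# → ∃[ y ] x * y ≈ 1#
  inverse x#0 with y , _ , p ← #⇒invertible x#0 = y , trans (*-congʳ (sym (x-0≈x _))) p

  #0-resp : ∀ {x y} → x ≈ y → x # 0# → y # 0#
  #0-resp x≈y x#0 with z , xz≈1 ← inverse x#0 = invertible⇒#0 z (trans (*-congʳ (sym x≈y)) xz≈1)

  1#0 : 1# # 0#
  1#0 = invertible⇒#0 1# (*-identityˡ 1#)

  0#0-absurd : ¬ 0# # 0#
  0#0-absurd = proj₂ (tight 0# 0#) refl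

  -- If `z` inverts `x * y`, then `y * z` inverts `x`.
  *#0ˡ : ∀ x y → x * y # 0# → x # 0#
  *#0ˡ x y xy#0 with z , p ← inverse xy#0 = invertible⇒#0 (y * z) (trans (sym (*-assoc x y z)) p)

  -#0⇒# : ∀ x y → x - y # 0# → x # y
  -#0⇒# x y p with z , q ← inverse p = invertible⇒# (z , trans (*-comm _ _) q , q)

  -- Cotransitivity at the point `y` gives `y # 0#` or `x + y # y`; in the second case the
  -- invertible difference is `x`.
  +#0 : ∀ x y → x + y # 0# → x # 0# ⊎ y # 0#
  +#0 x y p with #-cotrans p y
  ... | inj₂ y#0 = inj₂ y#0
  ... | inj₁ q with z , _ , r ← #⇒invertible q =
    inj₁ (invertible⇒#0 z (trans (*-congʳ (solve 2 (λ x y → x := x :+ y :- y) refl x y)) r))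

  neg-pos : ∀ {x} → x < 0# → 0# < - x
  neg-pos {x} x<0 = <-respˡ (-‿inverseʳ x) (<-respʳ (+-identityˡ (- x)) (+-monoˡ-< (- x) x<0))

  -- `≤` is only a negated `<`. Cotransitivity leaves `0# < x + y` or `x + y < x`, and the second
  -- would make `y` negative.
  +-pos : ∀ {x y} → 0# < x → 0# ≤ y → 0# < x + y
  +-pos {x} {y} 0<x 0≤y with <-cotrans 0<x (x + y)
  ... | inj₁ p = p
  ... | inj₂ p = contradiction
    (<-respˡ (solve 2 (λ x y → x :+ y :- x := y) refl x y) (<-respʳ (-‿inverseʳ x) (+-monoˡ-< (- x) p)))
    0≤y

  square-pos : ∀ {x} → x # 0# → 0# < x * x
  square-pos {x} (inj₁ x<0) =
    <-respʳ (solve 1 (λ x → (:- x) :* (:- x) := x :* x) refl x) (*-pos (neg-pos x<0) (neg-pos x<0))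
  square-pos (inj₂ 0<x) = *-pos 0<x 0<x

  -- A negative square would be apart from 0, hence so would `x`, and then its square would be
  -- positive.
  square-nonneg : ∀ x → 0# ≤ x * x
  square-nonneg x p = <-irrefl refl (<-trans p (square-pos (*#0ˡ x x (inj₁ p))))

  sum-of-squares#0 : ∀ x y → x # 0# ⊎ y # 0# → x * x + y * y # 0#
  sum-of-squares#0 x y (inj₁ x#0) = inj₂ (+-pos (square-pos x#0) (square-nonneg y))
  sum-of-squares#0 x y (inj₂ y#0) = inj₂ (<-respʳ (+-comm _ _) (+-pos (square-pos y#0) (square-nonneg x)))

  fromℕ-pos : ∀ n → 0# < fromℕ (suc n)
  fromℕ-pos n = +-pos (<-respʳ (*-identityˡ 1#) (square-pos 1#0)) (nonneg n)
    where
    nonneg : ∀ n → 0# ≤ fromℕ n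
    nonneg zero    = <-irrefl refl
    nonneg (suc n) = <-asym (fromℕ-pos n)

  ⟦⟧#0 : ∀ {i} → i ≢ + 0 → ⟦ i ⟧ # 0#
  ⟦⟧#0 {+ zero}    i≢0 = contradiction ≡.refl i≢0
  ⟦⟧#0 {+ (suc n)} _   = inj₂ (fromℕ-pos n)
  ⟦⟧#0 { -[1+ n ]} _   = inj₁
    (<-respˡ (+-identityˡ _) (<-respʳ (-‿inverseʳ _) (+-monoˡ-< (- fromℕ (suc n)) (fromℕ-pos n))))

module Complexes (ℜ : RealNumbers) where

  private module ℝ = Reals ℜ
  open ℝ using (solve; _:+_; _:*_; :-_; _:-_; _:=_; con)
  open Complex ℜ

  isCommutativeRing : IsCommutativeRing _≈_ _+_ _*_ -_ 0# 1#
  isCommutativeRing = record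
    { isRing = record
      { +-isAbelianGroup = record
        { isGroup = record
          { isMonoid = record
            { isSemigroup = record
              { isMagma = record
                { isEquivalence = record
                  { refl  = ℝ.refl , ℝ.refl
                  ; sym   = λ (p , q) → ℝ.sym p , ℝ.sym q
                  ; trans = λ (p , q) (r , s) → ℝ.trans p r , ℝ.trans q s
                  }
                ; ∙-cong = λ (p , q) (r , s) → ℝ.+-cong p r , ℝ.+-cong q s
                }
              ; assoc = λ _ _ _ → ℝ.+-assoc _ _ _ , ℝ.+-assoc _ _ _
              }
            ; identity = (λ _ → ℝ.+-identityˡ _ , ℝ.+-identityˡ _)
                       , (λ _ → ℝ.+-identityʳ _ , ℝ.+-identityʳ _)
            }
          ; inverse = (λ _ → ℝ.-‿inverseˡ _ , ℝ.-‿inverseˡ _)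
                    , (λ _ → ℝ.-‿inverseʳ _ , ℝ.-‿inverseʳ _)
          ; ⁻¹-cong = λ (p , q) → ℝ.-‿cong p , ℝ.-‿cong q
          }
        ; comm = λ _ _ → ℝ.+-comm _ _ , ℝ.+-comm _ _
        }
      ; *-cong = λ (p , q) (r , s) →
          ℝ.+-cong (ℝ.*-cong p r) (ℝ.-‿cong (ℝ.*-cong q s)) , ℝ.+-cong (ℝ.*-cong p s) (ℝ.*-cong q r)
      ; *-assoc = λ (a +i b) (c +i d) (e +i f) →
          solve 6 (λ a b c d e f → (a :* c :+ :- (b :* d)) :* e :+ :- ((a :* d :+ b :* c) :* f)
            := a :* (c :* e :+ :- (d :* f)) :+ :- (b :* (c :* f :+ d :* e))) ℝ.refl a b c d e f ,
          solve 6 (λ a b c d e f → (a :* c :+ :- (b :* d)) :* f :+ (a :* d :+ b :* c) :* e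
            := a :* (c :* f :+ d :* e) :+ b :* (c :* e :+ :- (d :* f))) ℝ.refl a b c d e f
      ; *-identity = *-identityˡ , λ z → trans (*-comm z 1#) (*-identityˡ z)
      ; distrib = distribˡ , λ z x y →
          trans (*-comm _ z) (trans (distribˡ z x y) (+-cong (*-comm z x) (*-comm z y)))
      }
    ; *-comm = *-comm
    }
    where
    trans : ∀ {x y z} → x ≈ y → y ≈ z → x ≈ z
    trans (p , q) (r , s) = ℝ.trans p r , ℝ.trans q s

    +-cong : ∀ {x y u v} → x ≈ y → u ≈ v → x + u ≈ y + v
    +-cong (p , q) (r , s) = ℝ.+-cong p r , ℝ.+-cong q s

    *-comm : ∀ x y → x * y ≈ y * x
    *-comm (a +i b) (c +i d) =
      solve 4 (λ a b c d → a :* c :+ :- (b :* d) := c :* a :+ :- (d :* b)) ℝ.refl a b c d ,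
      solve 4 (λ a b c d → a :* d :+ b :* c := c :* b :+ d :* a) ℝ.refl a b c d

    *-identityˡ : ∀ x → 1# * x ≈ x
    *-identityˡ (a +i b) =
      ℝ.trans (ℝ.+-cong (ℝ.*-identityˡ a) (ℝ.-‿cong (ℝ.zeroˡ b))) (ℝ.x-0≈x a) ,
      ℝ.trans (ℝ.+-cong (ℝ.*-identityˡ b) (ℝ.zeroˡ a)) (ℝ.+-identityʳ b)

    distribˡ : ∀ x y z → x * (y + z) ≈ x * y + x * z
    distribˡ (a +i b) (c +i d) (e +i f) =
      solve 6 (λ a b c d e f → a :* (c :+ e) :+ :- (b :* (d :+ f))
        := a :* c :+ :- (b :* d) :+ (a :* e :+ :- (b :* f))) ℝ.refl a b c d e f ,
      solve 6 (λ a b c d e f → a :* (d :+ f) :+ b :* (c :+ e)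
        := a :* d :+ b :* c :+ (a :* f :+ b :* e)) ℝ.refl a b c d e f

  commutativeRing : CommutativeRing 0ℓ 0ℓ
  commutativeRing = record { isCommutativeRing = isCommutativeRing }

  open CommutativeRing commutativeRing public
    using (refl; sym; trans; setoid; ring; semiring; +-cong; +-congˡ; +-congʳ; *-cong; *-congˡ; *-congʳ
          ; -‿cong; +-identityˡ; +-identityʳ; *-identityˡ; *-identityʳ; zeroˡ; zeroʳ; *-comm; +-comm
          ; *-assoc; +-assoc; -‿inverseˡ; -‿inverseʳ; distribˡ; distribʳ; _-_; reflexive)

  ofℝ-homo-* : ∀ a b → ofℝ (a ℝ.* b) ≈ ofℝ a * ofℝ b
  ofℝ-homo-* a b =
    ℝ.sym (ℝ.trans (ℝ.+-congˡ (ℝ.-‿cong (ℝ.zeroˡ _))) (ℝ.x-0≈x _)) ,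
    ℝ.sym (ℝ.trans (ℝ.+-cong (ℝ.zeroʳ _) (ℝ.zeroˡ _)) (ℝ.+-identityʳ _))

  ofℝ-homo-+ : ∀ a b → ofℝ (a ℝ.+ b) ≈ ofℝ a + ofℝ b
  ofℝ-homo-+ a b = ℝ.refl , ℝ.sym (ℝ.+-identityʳ _)

  ofℝ-cong : ∀ {a b} → a ℝ.≈ b → ofℝ a ≈ ofℝ b
  ofℝ-cong p = p , ℝ.refl

  -0≈0 : ℝ.- ℝ.0# ℝ.≈ ℝ.0#
  -0≈0 = ℝ.trans (ℝ.sym (ℝ.+-identityˡ _)) (ℝ.-‿inverseʳ ℝ.0#)

  ofℤ≈ofℝ : ∀ i → ofℤ i ≈ ofℝ ℝ.⟦ i ⟧
  ofℤ≈ofℝ (+ n)    = refl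
  ofℤ≈ofℝ -[1+ n ] = ℝ.refl , -0≈0

  ofℤ-homo-+ : ∀ i j → ofℤ (i ℤ.+ j) ≈ ofℤ i + ofℤ j
  ofℤ-homo-+ i j = trans (ofℤ≈ofℝ (i ℤ.+ j)) (trans (ofℝ-cong (ℝ.⟦⟧-homo-+ i j))
    (trans (ofℝ-homo-+ _ _) (sym (+-cong (ofℤ≈ofℝ i) (ofℤ≈ofℝ j)))))

  ofℤ-homo-* : ∀ i j → ofℤ (i ℤ.* j) ≈ ofℤ i * ofℤ j
  ofℤ-homo-* i j = trans (ofℤ≈ofℝ (i ℤ.* j)) (trans (ofℝ-cong (ℝ.⟦⟧-homo-* i j))
    (trans (ofℝ-homo-* _ _) (sym (*-cong (ofℤ≈ofℝ i) (ofℤ≈ofℝ j)))))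

  ofℤ-1 : ofℤ (+ 1) ≈ 1#
  ofℤ-1 = ℝ.⟦1⟧ , ℝ.refl

  #0-resp : ∀ {z w} → z ≈ w → z # 0# → w # 0#
  #0-resp (p , q) = map (ℝ.#0-resp p) (ℝ.#0-resp q)

  ≈0⇒¬#0 : ∀ {z} → z ≈ 0# → ¬ z # 0#
  ≈0⇒¬#0 z≈0 z#0 = [ ℝ.0#0-absurd , ℝ.0#0-absurd ]′ (#0-resp z≈0 z#0)

  1#0 : 1# # 0#
  1#0 = inj₁ ℝ.1#0

  +#0 : ∀ z w → z + w # 0# → z # 0# ⊎ w # 0#
  +#0 z w (inj₁ p) = map inj₁ inj₁ (ℝ.+#0 _ _ p)
  +#0 z w (inj₂ p) = map inj₂ inj₂ (ℝ.+#0 _ _ p)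

  *#0ˡ : ∀ z w → z * w # 0# → z # 0#
  *#0ˡ (a +i b) (c +i d) (inj₁ p) = map (ℝ.*#0ˡ a c)
    (ℝ.*#0ˡ b (ℝ.- d) ∘ ℝ.#0-resp (solve 2 (λ b d → :- (b :* d) := b :* :- d) ℝ.refl b d)) (ℝ.+#0 _ _ p)
  *#0ˡ (a +i b) (c +i d) (inj₂ p) = map (ℝ.*#0ˡ a d) (ℝ.*#0ˡ b c) (ℝ.+#0 _ _ p)

  *#0ʳ : ∀ z w → z * w # 0# → w # 0#
  *#0ʳ z w = *#0ˡ w z ∘ #0-resp (*-comm z w)

  invertible⇒#0 : ∀ {z} w → z * w ≈ 1# → z # 0#
  invertible⇒#0 w zw≈1 = *#0ˡ _ w (#0-resp (sym zw≈1) 1#0)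

  -#0⇒# : ∀ z w → z - w # 0# → z # w
  -#0⇒# z w = map (ℝ.-#0⇒# _ _) (ℝ.-#0⇒# _ _)

  -- The inverse is `conj z` over the squared modulus, which is positive because the real or the
  -- imaginary part is apart from 0.
  inverse : ∀ {z} → z # 0# → ∃[ w ] z * w ≈ 1#
  inverse {z@(a +i b)} z#0 with r , p ← ℝ.inverse (ℝ.sum-of-squares#0 a b z#0) =
    conj z * ofℝ r , (begin
      z * (conj z * ofℝ r)                  ≈⟨ *-assoc z (conj z) (ofℝ r) ⟨
      z * conj z * ofℝ r                    ≈⟨ *-congʳ
        ( solve 2 (λ a b → a :* a :+ :- (b :* :- b) := a :* a :+ b :* b) ℝ.refl a b
        , ℝ.trans (solve 2 (λ a b → a :* :- b :+ b :* a := con (+ 0)) ℝ.refl a b) ℝ.refl) ⟩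
      ofℝ (a ℝ.* a ℝ.+ b ℝ.* b) * ofℝ r     ≈⟨ ofℝ-homo-* _ _ ⟨
      ofℝ ((a ℝ.* a ℝ.+ b ℝ.* b) ℝ.* r)     ≈⟨ ofℝ-cong p ⟩
      1#                                    ∎)
    where open Relation.Binary.Reasoning.Setoid setoid

  ofℤ#0 : ∀ {i} → i ≢ + 0 → ofℤ i # 0#
  ofℤ#0 {i} i≢0 = #0-resp (sym (ofℤ≈ofℝ i)) (inj₁ (ℝ.⟦⟧#0 i≢0))

  conj-homo-+ : ∀ z w → conj (z + w) ≈ conj z + conj w
  conj-homo-+ (a +i b) (c +i d) = ℝ.refl , solve 2 (λ b d → :- (b :+ d) := :- b :+ :- d) ℝ.refl b d

  conj-homo-* : ∀ z w → conj (z * w) ≈ conj z * conj w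
  conj-homo-* (a +i b) (c +i d) =
    solve 4 (λ a b c d → a :* c :+ :- (b :* d) := a :* c :+ :- (:- b :* :- d)) ℝ.refl a b c d ,
    solve 4 (λ a b c d → :- (a :* d :+ b :* c) := a :* :- d :+ :- b :* c) ℝ.refl a b c d

  conj-cong : ∀ {z w} → z ≈ w → conj z ≈ conj w
  conj-cong (p , q) = p , ℝ.-‿cong q

  conj-ofℝ : ∀ a → conj (ofℝ a) ≈ ofℝ a
  conj-ofℝ a = ℝ.refl , -0≈0

  conj-ofℤ : ∀ i → conj (ofℤ i) ≈ ofℤ i
  conj-ofℤ i = trans (conj-cong (ofℤ≈ofℝ i)) (trans (conj-ofℝ _) (sym (ofℤ≈ofℝ i)))

-- Recovering the dodecahedron from its intersection array

decided : ∀ {P : Set} (P? : Dec P) → does P? ≡ true → P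
decided (yes p) _ = p

record Enumeration {n} (P : Pred (Fin n) 0ℓ) (k : ℕ) : Set where
  field
    at        : Fin k → Fin n
    injective : Injective _≡_ _≡_ at
    sound     : ∀ j → P (at j)
    index     : ∀ {y} → P y → ∃[ j ] at j ≡ y

lookup-unique : ∀ {A : Set} {xs : List A} → Unique xs → ∀ i j → List.lookup xs i ≡ List.lookup xs j → i ≡ j
lookup-unique (_ ∷ _)  zero    zero    _  = ≡.refl
lookup-unique (p ∷ _)  zero    (suc j) eq = contradiction eq (All.lookup p (Membership.∈-lookup j))
lookup-unique (p ∷ _)  (suc i) zero    eq = contradiction (≡.sym eq) (All.lookup p (Membership.∈-lookup i))
lookup-unique (_ ∷ ps) (suc i) (suc j) eq = ≡.cong suc (lookup-unique ps i j eq)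

enumerate : ∀ {n} {P : Pred (Fin n) 0ℓ} (P? : Decidable P) {k} →
            length (filter P? (allFin n)) ≡ k → Enumeration P k
enumerate {n} {P} P? ≡.refl = record
  { at        = List.lookup xs
  ; injective = lookup-unique (Unique.filter⁺ P? (Unique.allFin⁺ n)) _ _
  ; sound     = λ j → proj₂ (Membership.∈-filter⁻ P? {xs = allFin n} (Membership.∈-lookup j))
  ; index     = λ {y} Py → let y∈xs = Membership.∈-filter⁺ P? (Membership.∈-allFin y) Py in
                           Any.index y∈xs , ≡.sym (AnyProperties.lookup-index y∈xs)
  }
  where xs = filter P? (allFin n)

module _ {n} {P : Pred (Fin n) 0ℓ} {k} (E : Enumeration P k) where

  open Enumeration E

  pigeonhole : ∀ {m} (f : Fin m → Fin n) → Injective _≡_ _≡_ f → (∀ j → P (f j)) → m ℕ.≤ k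
  pigeonhole f inj Pf = Fin.injective⇒≤ {f = λ j → proj₁ (index (Pf j))} λ {i} {j} eq →
    inj (≡.trans (≡.sym (proj₂ (index (Pf i)))) (≡.trans (≡.cong at eq) (proj₂ (index (Pf j)))))

  unique-length : ∀ (xs : List (Fin n)) → Unique xs → All P xs → length xs ℕ.≤ k
  unique-length xs u Ps = pigeonhole (List.lookup xs) (lookup-unique u _ _) λ j →
    All.lookup Ps (Membership.∈-lookup j)

singleton : ∀ {n} {P : Pred (Fin n) 0ℓ} → Enumeration P 1 → ∀ {u v} → P u → P v → u ≡ v
singleton E Pu Pv with Enumeration.index E Pu | Enumeration.index E Pv
... | zero , ≡.refl | zero , ≡.refl = ≡.refl

-- Sending an element to the side of the split it falls in would inject three elements into `Fin 2`.
singletons : ∀ {n} {P Q R : Pred (Fin n) 0ℓ} → Enumeration P 3 → (∀ {w} → P w → Q w ⊎ R w) →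
             (∀ {u v} → Q u → Q v → u ≡ v) → (∀ {u v} → R u → R v → u ≡ v) → ⊥
singletons {Q = Q} {R} E split Q! R! =
  contradiction (Fin.injective⇒≤ {f = λ j → side (split (sound j))} (λ {i} {j} eq →
    injective (side-injective (split (sound i)) (split (sound j)) eq))) λ { (s≤s (s≤s ())) }
  where
  open Enumeration E
  side : ∀ {w} → Q w ⊎ R w → Fin 2
  side (inj₁ _) = zero
  side (inj₂ _) = suc zero
  side-injective : ∀ {u v} (a : Q u ⊎ R u) (b : Q v ⊎ R v) → side a ≡ side b → u ≡ v
  side-injective (inj₁ p) (inj₁ q) _ = Q! p q
  side-injective (inj₂ p) (inj₂ q) _ = R! p q

-- A missed value can be removed from the codomain by `punchOut`, which would inject `Fin (suc n)`
-- into `Fin n`.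
injective⇒surjective : ∀ {n} (f : Fin n → Fin n) → Injective _≡_ _≡_ f → ∀ y → ∃[ i ] f i ≡ y
injective⇒surjective {suc n} f inj y with Fin.any? (λ i → f i Fin.≟ y)
... | yes p = p
... | no ¬p = contradiction
  (Fin.injective⇒≤ {f = λ i → punchOut (missed i)}
    (λ {i} {j} eq → inj (Fin.punchOut-injective (missed i) (missed j) eq)))
  ℕ.1+n≰n
  where
  missed : ∀ i → y ≢ f i
  missed i eq = ¬p (i , ≡.sym eq)

-- A section of `f` is injective, hence surjective on a finite set, hence a two-sided inverse. This
-- is where the equal numbers of vertices enter: local bijectivity and connectedness alone give only
-- a covering.
surjective⇒injective : ∀ {n} (f : Fin n → Fin n) (g : Fin n → Fin n) → (∀ y → f (g y) ≡ y) → ∀ i → g (f i) ≡ i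
surjective⇒injective f g fg i with j , ≡.refl ← injective⇒surjective g
  (λ {u} {v} eq → ≡.trans (≡.sym (fg u)) (≡.trans (≡.cong f eq) (fg v))) i = ≡.cong g (fg j)

distance-unique : ∀ {n} {Γ : Graph n} {y z i j} → Distance Γ y z i → Distance Γ y z j → i ≡ j
distance-unique {i = i} {j} (w , ¬w) (w′ , ¬w′) with ℕ.<-cmp i j
... | tri< i<j _ _ = contradiction w (¬w′ i<j)
... | tri≈ _ eq _  = eq
... | tri> _ _ j<i = contradiction w′ (¬w j<i)

module LocalStructure {n} {Γ : Graph n}
  (array : HasIntersectionArray Γ (3 ∷ 2 ∷ 1 ∷ 1 ∷ 1 ∷ []) (1 ∷ 1 ∷ 1 ∷ 2 ∷ 3 ∷ [])) where

  open Graph Γ renaming (sym to adj-sym)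

  private
    Γ-dr = proj₁ array

  open IsDistanceRegular Γ-dr using (connected; regular; p)

  private
    b≡ = proj₁ (proj₂ array)
    c≡ = proj₂ (proj₂ array)

    abstract
      counted : ∀ {h i j k y z} → h ℕ.≤ 5 → i ℕ.≤ 5 → j ℕ.≤ 5 → p h i j ≡ k → Distance Γ y z h →
                Enumeration (λ w → Distance Γ y w i × Distance Γ z w j) k
      counted {i = i} {j} {y = y} {z} h≤5 i≤5 j≤5 phij≡k d =
        enumerate (λ w → distance? Γ y w i ×-dec distance? Γ z w j)
          (≡.trans (regular h≤5 i≤5 j≤5 y z d) phij≡k)

  ≢-of-adj : ∀ {y z} → Adj y z → y ≢ z
  ≢-of-adj a ≡.refl = irrefl ≡.refl a

  distance-0 : ∀ {y} → Distance Γ y y 0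
  distance-0 = [] , λ ()

  distance-1 : ∀ {y z} → Adj y z → Distance Γ y z 1
  distance-1 a = a ∷ [] , λ { (s≤s z≤n) [] → irrefl ≡.refl a }

  distance-1⇒adj : ∀ {y z} → Distance Γ y z 1 → Adj y z
  distance-1⇒adj (a ∷ [] , _) = a

  distance-2 : ∀ {y c z} → y ≢ z → ¬ Adj y z → Adj y c → Adj c z → Distance Γ y z 2
  distance-2 y≢z ¬a a b = a ∷ b ∷ [] , λ
    { (s≤s z≤n)       []       → y≢z ≡.refl
    ; (s≤s (s≤s z≤n)) (c ∷ []) → ¬a c }

  distance-2⇒¬adj : ∀ {y z} → Distance Γ y z 2 → ¬ Adj y z
  distance-2⇒¬adj (_ , shorter) a = shorter (s≤s (s≤s z≤n)) (a ∷ [])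

  neighbours : ∀ y → Enumeration (Adj y) 3
  neighbours y = record
    { at = at ; injective = injective
    ; sound = λ j → distance-1⇒adj (proj₁ (sound j))
    ; index = λ a → index (distance-1 a , distance-1 a) }
    where open Enumeration (counted z≤n (s≤s z≤n) (s≤s z≤n) (≡.cong (λ v → lookup v (# 0)) b≡) (distance-0 {y}))

  no-four : ∀ {y a b c d} → Adj y a → Adj y b → Adj y c → Adj y d →
            a ≢ b → a ≢ c → a ≢ d → b ≢ c → b ≢ d → c ≢ d → ⊥
  no-four {y} a b c d ab ac ad bc bd cd = ℕ.1+n≰n (unique-length (neighbours y) (_ ∷ _ ∷ _ ∷ _ ∷ [])
    ((ab ∷ ac ∷ ad ∷ []) ∷ (bc ∷ bd ∷ []) ∷ (cd ∷ []) ∷ [] ∷ []) (a ∷ b ∷ c ∷ d ∷ []))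

  -- b₁ = 2 neighbours of b are at distance 2 from a, and a is the third.
  no-triangle : ∀ {a b c} → Adj a b → Adj b c → ¬ Adj a c
  no-triangle {a} {b} {c} ab bc ac = no-four (adj-sym ab) bc
    (far zero) (far (suc zero)) (≢-of-adj ac)
    (a≢at zero) (a≢at (suc zero)) (c≢at zero) (c≢at (suc zero))
    (λ eq → case injective eq of λ ())
    where
    open Enumeration (counted (s≤s z≤n) (s≤s z≤n) (s≤s (s≤s z≤n))
      (≡.cong (λ v → lookup v (# 1)) b≡) (distance-1 (adj-sym ab)))
    far : ∀ j → Adj b (at j)
    far j = distance-1⇒adj (proj₁ (sound j))
    a≢at : ∀ j → a ≢ at j
    a≢at j eq = proj₂ (proj₂ (sound j)) (s≤s z≤n) (≡.subst (Walk Γ 0 a) eq [])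
    c≢at : ∀ j → c ≢ at j
    c≢at j eq = distance-2⇒¬adj (proj₂ (sound j)) (≡.subst (Adj a) eq ac)

  -- Without triangles, `a` and `c` are at distance 2, and `c₂ = 1` leaves them a single common
  -- neighbour.
  no-square : ∀ {a b c d} → a ≢ c → Adj a b → Adj b c → Adj a d → Adj d c → b ≡ d
  no-square a≢c ab bc ad dc = singleton
    (counted (s≤s (s≤s z≤n)) (s≤s z≤n) (s≤s z≤n) (≡.cong (λ v → lookup v (# 1)) c≡)
      (distance-2 a≢c (no-triangle ab bc) ab bc))
    (distance-1 ab , distance-1 (adj-sym bc)) (distance-1 ad , distance-1 (adj-sym dc))

  midpoint : ∀ {z y} → Distance Γ z y 2 → ∃[ c ] Adj z c × Adj c y
  midpoint (a ∷ b ∷ [] , _) = _ , a , b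

  module _ {z y} (d : Distance Γ z y 2) where

    private
      yz : Distance Γ y z 2
      yz = distance-2 (λ { ≡.refl → proj₂ d (s≤s z≤n) [] })
        (λ a → distance-2⇒¬adj d (adj-sym a))
        (adj-sym (proj₂ (proj₂ (midpoint d)))) (adj-sym (proj₁ (proj₂ (midpoint d))))

      closer : Enumeration (λ w → Distance Γ y w 1 × Distance Γ z w 1) 1
      closer = counted (s≤s (s≤s z≤n)) (s≤s z≤n) (s≤s z≤n) (≡.cong (λ v → lookup v (# 1)) c≡) yz

      farther : Enumeration (λ w → Distance Γ y w 1 × Distance Γ z w 3) 1
      farther = counted (s≤s (s≤s z≤n)) (s≤s z≤n) (s≤s (s≤s (s≤s z≤n))) (≡.cong (λ v → lookup v (# 2)) b≡) yz

    -- c₂ = b₂ = 1, hence a₂ = 1.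
    level-neighbour-unique : ∀ {u v} → Adj y u → Distance Γ z u 2 → Adj y v → Distance Γ z v 2 → u ≡ v
    level-neighbour-unique {u} {v} yu zu yv zv with u Fin.≟ v
    ... | yes u≡v = u≡v
    ... | no  u≢v = ⊥-elim (no-four (distance-1⇒adj (proj₁ near)) (distance-1⇒adj (proj₁ far)) yu yv
      (apart (proj₂ near) (proj₂ far) λ ()) (apart (proj₂ near) zu λ ()) (apart (proj₂ near) zv λ ())
      (apart (proj₂ far) zu λ ()) (apart (proj₂ far) zv λ ()) u≢v)
      where
      near = Enumeration.sound closer zero
      far  = Enumeration.sound farther zero
      apart : ∀ {s t i j} → Distance Γ z s i → Distance Γ z t j → i ≢ j → s ≢ t
      apart p q i≢j ≡.refl = i≢j (distance-unique p q)

    -- Otherwise every neighbour of `y` is at distance 1 or 3 from `z`; as `c₂ = b₂ = 1` there is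
    -- only one of each, against degree 3.
    level-neighbour : ∃[ w ] Adj y w × Distance Γ z w 2
    level-neighbour with Fin.any? (λ w → adj? y w ×-dec distance? Γ z w 2)
    ... | yes p = p
    ... | no ¬p = ⊥-elim (singletons (neighbours y) split (singleton closer) (singleton farther))
      where
      distance-3 : ∀ {w} → Adj y w → ¬ Adj z w → Distance Γ z w 3
      distance-3 {w} yw ¬zw with _ , a , b ← midpoint d = a ∷ b ∷ yw ∷ [] , λ
        { (s≤s z≤n)             []            → distance-2⇒¬adj d (adj-sym yw)
        ; (s≤s (s≤s z≤n))       (c ∷ [])      → ¬zw c
        ; (s≤s (s≤s (s≤s z≤n))) (c ∷ e ∷ [])  → ¬p (w , yw , distance-2
            (λ { ≡.refl → distance-2⇒¬adj d (adj-sym yw) }) ¬zw c e) }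

      split : ∀ {w} → Adj y w →
              (Distance Γ y w 1 × Distance Γ z w 1) ⊎ (Distance Γ y w 1 × Distance Γ z w 3)
      split {w} yw with adj? z w
      ... | yes zw = inj₁ (distance-1 yw , distance-1 zw)
      ... | no ¬zw = inj₂ (distance-1 yw , distance-3 yw ¬zw)

  record Pentagon (a b c d e : Fin n) : Set where
    constructor pentagon
    field
      ab : Adj a b
      bc : Adj b c
      cd : Adj c d
      de : Adj d e
      ea : Adj e a

    -- If `a` and `c` coincided, `c`, `d`, `e` would form a triangle.
    skip : a ≢ c
    skip ≡.refl = no-triangle cd de (adj-sym ea)

  open Pentagon

  rotate : ∀ {a b c d e} → Pentagon a b c d e → Pentagon b c d e a
  rotate (pentagon ab bc cd de ea) = pentagon bc cd de ea ab

  reflect : ∀ {a b c d e} → Pentagon a b c d e → Pentagon e d c b a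
  reflect (pentagon ab bc cd de ea) =
    pentagon (adj-sym de) (adj-sym cd) (adj-sym bc) (adj-sym ab) (adj-sym ea)

  abstract
    -- The path is closed by the neighbour `d` of `c` that is at distance 2 from `a`, and by a
    -- midpoint `e` of `a` and `d`.
    pentagon-exists : ∀ {a b c} → Adj a b → Adj b c → a ≢ c → ∃[ d ] ∃[ e ] Pentagon a b c d e
    pentagon-exists {a} {b} {c} ab bc a≢c = close (level-neighbour (distance-2 a≢c (no-triangle ab bc) ab bc))
      where
      close : (∃[ d ] Adj c d × Distance Γ a d 2) → ∃[ d ] ∃[ e ] Pentagon a b c d e
      close (d , cd , d₂) = let e , ae , ed = midpoint d₂ in
        d , e , pentagon ab bc cd (adj-sym ed) (adj-sym ae)

  abstract
    -- The path `b`, `c`, `d` determines the rest: `e` and `e′` are neighbours of `d` at distance 2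
    -- from `b`, hence equal by `a₂ = 1`, and then `a` and `a′` are both the common neighbour of `b`
    -- and `e`.
    pentagon-unique : ∀ {a a′ b c d e e′} → Pentagon a b c d e → Pentagon a′ b c d e′ → a ≡ a′ × e ≡ e′
    pentagon-unique P Q = close P Q (level-neighbour-unique
      (distance-2 (skip (rotate P)) (no-triangle (bc P) (cd P)) (bc P) (cd P))
      (de P) (two P) (de Q) (two Q))
      where
      two : ∀ {a b c d e} → Pentagon a b c d e → Distance Γ b e 2
      two P = distance-2 (≢-sym (skip (rotate (rotate (rotate (rotate P))))))
        (no-triangle (adj-sym (ab P)) (adj-sym (ea P))) (adj-sym (ab P)) (adj-sym (ea P))

      close : ∀ {a a′ b c d e e′} → Pentagon a b c d e → Pentagon a′ b c d e′ → e ≡ e′ → a ≡ a′ × e ≡ e′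
      close P Q ≡.refl = no-square (skip (rotate (rotate (rotate (rotate P))))) (ea P) (ab P) (ea Q) (ab Q) , ≡.refl

  -- Were `s′` equal to `s`, both pentagons would contain the path `q`, `r`, `s` and so agree at
  -- `p`. The unfolding uses this to tell the unknown fourth vertex of a new pentagon from that of a
  -- known face on the same edge.
  next-≢ : ∀ {p p′ q r s s′ t t′} → Pentagon p q r s t → Pentagon p′ q r s′ t′ → p′ ≢ p → s′ ≢ s
  next-≢ P Q p′≢p ≡.refl = p′≢p (≡.sym (proj₁ (pentagon-unique P Q)))

  record Neighbours (y a b c : Fin n) : Set where
    constructor three
    field
      ya  : Adj y a
      yb  : Adj y b
      yc  : Adj y c
      a≢b : a ≢ b
      a≢c : a ≢ c
      b≢c : b ≢ c

  cover : ∀ {y a b c u} → Neighbours y a b c → Adj y u → u ≡ a ⊎ u ≡ b ⊎ u ≡ c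
  cover {a = a} {b} {c} {u} (three ya yb yc ab ac bc) yu with u Fin.≟ a | u Fin.≟ b | u Fin.≟ c
  ... | yes p | _     | _     = inj₁ p
  ... | no _  | yes p | _     = inj₂ (inj₁ p)
  ... | no _  | no _  | yes p = inj₂ (inj₂ p)
  ... | no p  | no q  | no r  = ⊥-elim (no-four yu ya yb yc p q r ab ac bc)

  abstract
    third : ∀ {y a b c u} → Neighbours y a b c → Adj y u → u ≢ a → u ≢ b → u ≡ c
    third N yu u≢a u≢b with cover N yu
    ... | inj₁ p        = contradiction p u≢a
    ... | inj₂ (inj₁ p) = contradiction p u≢b
    ... | inj₂ (inj₂ p) = p

  abstract
    -- Otherwise each of the three neighbours of `y` would be `a` or `b`.
    complete-neighbours : ∀ {y a b} → Adj y a → Adj y b → a ≢ b → ∃[ c ] Neighbours y a b c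
    complete-neighbours {y} {a} {b} ya yb a≢b
      with Fin.any? (λ c → adj? y c ×-dec ¬? (a Fin.≟ c) ×-dec ¬? (b Fin.≟ c))
    ... | yes (c , yc , a≢c , b≢c) = c , three ya yb yc a≢b a≢c b≢c
    ... | no ¬p = ⊥-elim (singletons (neighbours y) split (λ p q → ≡.trans (≡.sym p) q) (λ p q → ≡.trans (≡.sym p) q))
      where
      split : ∀ {w} → Adj y w → a ≡ w ⊎ b ≡ w
      split {w} yw with a Fin.≟ w | b Fin.≟ w
      ... | yes p | _     = inj₁ p
      ... | no _  | yes q = inj₂ q
      ... | no p  | no q  = contradiction (w , yw , p , q) ¬p

-- The standard dodecahedron and the unfolding of pentagons

next prev : Fin 5 → Fin 5
next 0F = 1F
next 1F = 2F
next 2F = 3F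
next 3F = 4F
next 4F = 0F
prev 0F = 4F
prev 1F = 0F
prev 2F = 1F
prev 3F = 2F
prev 4F = 3F

next-prev : ∀ i → next (prev i) ≡ i
next-prev 0F = ≡.refl
next-prev 1F = ≡.refl
next-prev 2F = ≡.refl
next-prev 3F = ≡.refl
next-prev 4F = ≡.refl

prev-next : ∀ i → prev (next i) ≡ i
prev-next 0F = ≡.refl
prev-next 1F = ≡.refl
prev-next 2F = ≡.refl
prev-next 3F = ≡.refl
prev-next 4F = ≡.refl

-- The dodecahedron between two opposite faces: layer 0 is a face, layer 1
-- its outer neighbours, layer 3 the opposite face and layer 2 the outer
-- neighbours of that face.
layered : Fin 4 → Fin 5 → Fin 3 → Fin 4 × Fin 5
layered 0F i 0F = 0F , prev i
layered 0F i 1F = 0F , next i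
layered 0F i 2F = 1F , i
layered 1F i 0F = 0F , i
layered 1F i 1F = 2F , i
layered 1F i 2F = 2F , prev i
layered 2F i 0F = 1F , i
layered 2F i 1F = 1F , next i
layered 2F i 2F = 3F , i
layered 3F i 0F = 2F , i
layered 3F i 1F = 3F , prev i
layered 3F i 2F = 3F , next i

label : Fin 4 × Fin 5 → Fin 20
label (l , i) = combine l i

nb : Fin 20 → Fin 3 → Fin 20
nb u j = let l , i = remQuot {4} 5 u in label (layered l i j)

-- An isomorphism with the standard dodecahedron, expressed through the neighbour function `nb`, so
-- that sums over the neighbours of a vertex become sums over `Fin 3`.
record Labelling {n} (Γ : Graph n) (φ : Fin 20 → Fin n) : Set where
  open Graph Γ
  field
    ψ         : Fin n → Fin 20
    φψ        : ∀ y → φ (ψ y) ≡ y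
    ψφ        : ∀ u → ψ (φ u) ≡ u
    adj-nb    : ∀ u j → Adj (φ u) (φ (nb u j))
    nb-all    : ∀ u {y} → Adj (φ u) y → ∃[ j ] φ (nb u j) ≡ y

  φ-injective : ∀ {u v} → φ u ≡ φ v → u ≡ v
  φ-injective {u} {v} eq = ≡.trans (≡.sym (ψφ u)) (≡.trans (≡.cong ψ eq) (ψφ v))

module Unfold {n} {Γ : Graph n}
  (array : HasIntersectionArray Γ (3 ∷ 2 ∷ 1 ∷ 1 ∷ 1 ∷ []) (1 ∷ 1 ∷ 1 ∷ 2 ∷ 3 ∷ [])) where

  open Graph Γ renaming (sym to adj-sym)
  open LocalStructure array
  open Pentagon

  module _ (a b : Fin 5 → Fin n)
    (face : ∀ i → Pentagon (a (prev i)) (a i) (a (next i)) (a (next (next i))) (a (prev (prev i))))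
    (Na : ∀ i → Neighbours (a i) (a (prev i)) (a (next i)) (b i)) where

    open Neighbours

    -- The pentagon on `b i`, `a i`, `a (next i)` continues to `b (next i)`, the only neighbour
    -- left: it cannot turn back to `a i`, and it cannot follow the face `a`, which meets this edge
    -- coming from `a (prev i)` and not from `b i`.
    side : ∀ i → ∃[ y ] Pentagon (b i) (a i) (a (next i)) (b (next i)) y
    side i with d , e , P ← pentagon-exists (adj-sym (yc (Na i))) (yb (Na i)) (≢-sym (b≢c (Na i))) =
      e , ≡.subst (λ d → Pentagon _ _ _ d e)
        (third (Na (next i)) (cd P)
          (λ d≡ → skip (rotate P) (≡.sym (≡.trans d≡ (≡.cong a (prev-next i)))))
          (next-≢ (face i) P (≢-sym (a≢c (Na i)))))
        P

    module _ (c : Fin 5 → Fin n)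
      (F : ∀ i → Pentagon (b i) (a i) (a (next i)) (b (next i)) (c i)) where

      F′ : ∀ i → Pentagon (b (prev i)) (a (prev i)) (a i) (b i) (c (prev i))
      F′ i = ≡.subst (λ k → Pentagon (b (prev i)) (a (prev i)) (a k) (b k) (c (prev i))) (next-prev i) (F (prev i))

      -- If `c i` and `c (prev i)` coincided, the two side faces at `b i` would share the path
      -- `a i`, `b i`, `c i`, and uniqueness would identify `a (next i)` with `a (prev i)`.
      Nb : ∀ i → Neighbours (b i) (a i) (c i) (c (prev i))
      Nb i = three (ab (F i)) (adj-sym (ea (F i))) (de (F′ i))
        (≢-sym (skip (rotate (rotate (rotate (rotate (F i)))))))
        (skip (rotate (rotate (F′ i))))
        λ c≡ → a≢b (Na i) (≡.sym (proj₁ (pentagon-unique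
          (≡.subst (λ k → Pentagon (a (next i)) (a i) (b i) k (b (next i))) c≡
            (reflect (rotate (rotate (rotate (F i))))))
          (rotate (F′ i)))))

      module _ (d : Fin 5 → Fin n) (Nc : ∀ i → Neighbours (c i) (b i) (b (next i)) (d i)) where

        Nc′ : ∀ i → Neighbours (c (prev i)) (b (prev i)) (b i) (d (prev i))
        Nc′ i = ≡.subst (λ k → Neighbours (c (prev i)) (b (prev i)) (b k) (d (prev i))) (next-prev i) (Nc (prev i))

        -- The new pentagon cannot go on to `b (next i)` or `b (prev i)`: the faces `F i` and `F′ i`
        -- do so, but they reach `b i` from `a i`. Hence its last two vertices are the third
        -- neighbours `d i` and `d (prev i)`.
        H : ∀ i → Pentagon (c (prev i)) (b i) (c i) (d i) (d (prev i))
        H i with s , t , P ← pentagon-exists (adj-sym (yc (Nb i))) (yb (Nb i)) (≢-sym (b≢c (Nb i))) =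
          ≡.subst₂ (Pentagon _ _ _)
            (third (Nc i) (cd P) (≢-sym (skip (rotate P)))
              (next-≢ (rotate (rotate (rotate (reflect (F i))))) P (≢-sym (a≢c (Nb i)))))
            (third (Nc′ i) (adj-sym (ea P))
              (next-≢ (rotate (rotate (F′ i))) (rotate (rotate (reflect P))) (≢-sym (a≢b (Nb i))))
              (skip (rotate (rotate (rotate (rotate P))))))
            P

        H′ : ∀ i → Pentagon (c i) (b (next i)) (c (next i)) (d (next i)) (d i)
        H′ i = ≡.subst (λ k → Pentagon (c k) (b (next i)) (c (next i)) (d (next i)) (d k)) (prev-next i) (H (next i))

        -- If `d (prev i)` and `d (next i)` coincided, `H i` and `H′ i` would share a path through
        -- `c i` and `d i`, and uniqueness would identify `b i` with `b (next i)`.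
        Nd : ∀ i → Neighbours (d i) (c i) (d (prev i)) (d (next i))
        Nd i = three (adj-sym (cd (H i))) (de (H i)) (adj-sym (de (H′ i)))
          (skip (rotate (rotate (H i))))
          (λ eq → skip (rotate (rotate (rotate (H′ i)))) (≡.sym eq))
          λ d≡ → a≢b (Nc i) (proj₁ (pentagon-unique
            (rotate (H i))
            (≡.subst (λ k → Pentagon (b (next i)) (c i) (d i) k (c (next i))) (≡.sym d≡)
              (rotate (rotate (rotate (reflect (H′ i))))))))


  module _ {x v₀ v₁ v₂ : Fin n} (N : Neighbours x v₀ v₁ v₂) where

    open Neighbours

    Layers : (a b c d : Fin 5 → Fin n) → Set
    Layers a b c d =
      (∀ i → Neighbours (a i) (a (prev i)) (a (next i)) (b i)) ×
      (∀ i → Neighbours (b i) (a i) (c i) (c (prev i))) ×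
      (∀ i → Neighbours (c i) (b i) (b (next i)) (d i)) ×
      (∀ i → Neighbours (d i) (c i) (d (prev i)) (d (next i)))

    Based : (a b : Fin 5 → Fin n) → Set
    Based a b = a 0F ≡ x × a 4F ≡ v₀ × a 1F ≡ v₁ × b 0F ≡ v₂

    Face : (Fin 5 → Fin n) → Set
    Face a = ∀ i → Pentagon (a (prev i)) (a i) (a (next i)) (a (next (next i))) (a (prev (prev i)))

    first-face : ∃[ a ] Face a × a 0F ≡ x × a 4F ≡ v₀ × a 1F ≡ v₁
    first-face with s , t , P ← pentagon-exists (adj-sym (ya N)) (yb N) (a≢b N) =
      a s t , face P , ≡.refl , ≡.refl , ≡.refl
      where
      a : Fin n → Fin n → Fin 5 → Fin n
      a s t 0F = x
      a s t 1F = v₁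
      a s t 2F = s
      a s t 3F = t
      a s t 4F = v₀

      face : ∀ {s t} → Pentagon v₀ x v₁ s t → Face (a s t)
      face P 0F = P
      face P 1F = rotate P
      face P 2F = rotate (rotate P)
      face P 3F = rotate (rotate (rotate P))
      face P 4F = rotate (rotate (rotate (rotate P)))

    build : ∃[ a ] ∃[ b ] ∃[ c ] ∃[ d ] Layers a b c d × Based a b
    build =
      let a , face , a0≡x , a4≡v₀ , a1≡v₁ = first-face
          Na = λ i → complete-neighbours (adj-sym (ab (face i))) (bc (face i)) (skip (face i))
          b  = λ i → proj₁ (Na i)
          Na = λ i → proj₂ (Na i)
          F  = side a b face Na
          c  = λ i → proj₁ (F i)
          F  = λ i → proj₂ (F i)
          Nc = λ i → complete-neighbours (ea (F i)) (adj-sym (de (F i)))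
                 (≢-sym (skip (rotate (rotate (rotate (F i))))))
          d  = λ i → proj₁ (Nc i)
          Nc = λ i → proj₂ (Nc i)
          N₀ = ≡.subst₂ (λ y v → Neighbours y v (a 1F) (b 0F)) a0≡x a4≡v₀ (Na 0F)
      in a , b , c , d ,
         (Na , Nb a b face Na c F , Nc , Nd a b face Na c F d Nc) ,
         a0≡x , a4≡v₀ , a1≡v₁ ,
         -- `b 0F` is the neighbour of `x` off the first face; the other two are `v₀` and `v₁`, so
         -- it is `v₂`.
         ≡.sym (third (≡.subst (λ v → Neighbours x v₀ v (b 0F)) a1≡v₁ N₀) (yc N) (≢-sym (a≢c N)) (≢-sym (b≢c N)))

    module _ {a b c d : Fin 5 → Fin n} (layers : Layers a b c d) (based : Based a b) where

      private
        φ′ : Fin 4 × Fin 5 → Fin n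
        φ′ (0F , i) = a i
        φ′ (1F , i) = b i
        φ′ (2F , i) = c i
        φ′ (3F , i) = d i

        around : ∀ l i → Neighbours (φ′ (l , i)) (φ′ (layered l i 0F)) (φ′ (layered l i 1F)) (φ′ (layered l i 2F))
        around 0F = proj₁ layers
        around 1F = proj₁ (proj₂ layers)
        around 2F = proj₁ (proj₂ (proj₂ layers))
        around 3F = proj₂ (proj₂ (proj₂ layers))

      φ : Fin 20 → Fin n
      φ u = φ′ (remQuot {4} 5 u)

      φ-label : ∀ u → φ (label u) ≡ φ′ u
      φ-label (l , i) = ≡.cong φ′ (Fin.remQuot-combine {4} {5} l i)

      adjacent : ∀ u j → Adj (φ u) (φ (nb u j))
      adjacent u j = let l , i = remQuot {4} 5 u in
        ≡.subst (Adj (φ′ (l , i))) (≡.sym (φ-label (layered l i j))) (adj l i j)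
        where
        adj : ∀ l i j → Adj (φ′ (l , i)) (φ′ (layered l i j))
        adj l i 0F = ya (around l i)
        adj l i 1F = yb (around l i)
        adj l i 2F = yc (around l i)

      all-adjacent : ∀ u {y} → Adj (φ u) y → ∃[ j ] φ (nb u j) ≡ y
      all-adjacent u {y} uy = let l , i = remQuot {4} 5 u in find l i (cover (around l i) uy)
        where
        find : ∀ l i → y ≡ φ′ (layered l i 0F) ⊎ y ≡ φ′ (layered l i 1F) ⊎ y ≡ φ′ (layered l i 2F) →
               ∃[ j ] φ (label (layered l i j)) ≡ y
        find l i (inj₁ ≡.refl)        = 0F , φ-label (layered l i 0F)
        find l i (inj₂ (inj₁ ≡.refl)) = 1F , φ-label (layered l i 1F)
        find l i (inj₂ (inj₂ ≡.refl)) = 2F , φ-label (layered l i 2F)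

      -- The image is closed under adjacency and Γ is connected.
      reached : ∀ y → ∃[ u ] φ u ≡ y
      reached y = along {u = 0F} (proj₂ (IsDistanceRegular.connected (proj₁ array) (φ 0F) y))
        where
        along : ∀ {k u} → Walk Γ k (φ u) y → ∃[ u′ ] φ u′ ≡ y
        along {u = u} []       = u , ≡.refl
        along {u = u} (s ∷ ss) with j , ≡.refl ← all-adjacent u s = along {u = nb u j} ss

module _ {Γ : Graph 20} (Γ-dodecahedron : IsDodecahedron Γ) where

  open LocalStructure Γ-dodecahedron using (Neighbours)
  open Unfold Γ-dodecahedron

  labelling : ∀ {x v₀ v₁ v₂} → Neighbours x v₀ v₁ v₂ →
              ∃[ φ ] Labelling Γ φ × φ (# 0) ≡ x × φ (# 4) ≡ v₀ × φ (# 1) ≡ v₁ × φ (# 5) ≡ v₂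
  labelling N =
    let a , b , c , d , layers , based = build N
        section = λ y → proj₁ (reached N layers based y)
        φ-section = λ y → proj₂ (reached N layers based y)
    in φ N layers based , record
    { ψ      = section
    ; φψ     = φ-section
    ; ψφ     = surjective⇒injective (φ N layers based) section φ-section
    ; adj-nb = adjacent N layers based
    ; nb-all = all-adjacent N layers based
    } , based

-- Distances from the base vertex and admissible orderings

level : Fin 20 → ℕ
level = lookup (0 ∷ 1 ∷ 2 ∷ 2 ∷ 1 ∷ 1 ∷ 2 ∷ 3 ∷ 3 ∷ 2 ∷ 2 ∷ 3 ∷ 4 ∷ 3 ∷ 2 ∷ 3 ∷ 4 ∷ 5 ∷ 4 ∷ 3 ∷ [])

abstract
  -- Together with `level-zero` and `level-descent` this makes `level` the distance from vertex 0: a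
  -- walk gains at most one level per step, and descending one level at a time yields a walk of
  -- exactly that length.
  level-lipschitz : ∀ u j → level (nb u j) ℕ.≤ suc (level u)
  level-lipschitz = decided (Fin.all? λ u → Fin.all? λ j → level (nb u j) ℕ.≤? suc (level u)) ≡.refl

abstract
  level-zero : ∀ u → level u ≡ 0 → u ≡ # 0
  level-zero = decided (Fin.all? λ u → (level u ℕ.≟ 0) →-dec (u Fin.≟ # 0)) ≡.refl

abstract
  level-descent : ∀ u → level u ≡ 0 ⊎ ∃[ j ] level u ≡ suc (level (nb u j))
  level-descent = decided (Fin.all? λ u → (level u ℕ.≟ 0) ⊎-dec Fin.any? λ j → level u ℕ.≟ suc (level (nb u j))) ≡.refl

-- The labels of `v₀`, `v₁`, `v₂` in this order: the first face runs through `v₀`, `x`, `v₁`, and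
-- `v₂` is the outer neighbour of `x`.
inner : Fin 3 → Fin 20
inner = lookup (# 4 ∷ # 1 ∷ # 5 ∷ [])

-- The reference ordering: its pairs are the level-2 neighbours of the vertices 4, 5 and 1.
middle : Fin 6 → Fin 20
middle = lookup (# 3 ∷ # 9 ∷ # 14 ∷ # 10 ∷ # 2 ∷ # 6 ∷ [])

abstract
  middle-complete : ∀ u → level u ≡ 2 → ∃[ p ] middle p ≡ u
  middle-complete = decided (Fin.all? λ u → (level u ℕ.≟ 2) →-dec Fin.any? λ p → middle p Fin.≟ u) ≡.refl

abstract
  middle-level : ∀ p → level (middle p) ≡ 2
  middle-level = decided (Fin.all? λ p → level (middle p) ℕ.≟ 2) ≡.refl

abstract
  middle-injective : ∀ p q → middle p ≡ middle q → p ≡ q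
  middle-injective = decided (Fin.all? λ p → Fin.all? λ q → (middle p Fin.≟ middle q) →-dec (p Fin.≟ q)) ≡.refl

-- The vertices of level 2 form a hexagon whose edges alternate between
-- siblings (a common neighbour in level 1) and adjacent pairs.
sibling : Fin 6 → Fin 6
sibling = lookup (1F ∷ 0F ∷ 3F ∷ 2F ∷ 5F ∷ 4F ∷ [])

abstract
  siblings : ∀ p q → p ≢ q → ∀ w → level w ≡ 1 → (∃[ j ] nb w j ≡ middle p) → (∃[ j ] nb w j ≡ middle q) →
             q ≡ sibling p
  siblings = decided (Fin.all? λ p → Fin.all? λ q → ¬? (p Fin.≟ q) →-dec Fin.all? λ w →
    (level w ℕ.≟ 1) →-dec ((Fin.any? λ j → nb w j Fin.≟ middle p) →-dec
    ((Fin.any? λ j → nb w j Fin.≟ middle q) →-dec (q Fin.≟ sibling p)))) ≡.refl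

Alternating : Fin 6 → Fin 6 → Set
Alternating k l = ((k ≡ # 0 ⊎ k ≡ # 2 ⊎ k ≡ # 5) × (l ≡ # 1 ⊎ l ≡ # 3 ⊎ l ≡ # 4)) ⊎
                  ((k ≡ # 1 ⊎ k ≡ # 3 ⊎ k ≡ # 4) × (l ≡ # 0 ⊎ l ≡ # 2 ⊎ l ≡ # 5))

alternating? : ∀ k l → Dec (Alternating k l)
alternating? k l = (even k ×-dec odd l) ⊎-dec (odd k ×-dec even l)
  where
  even : ∀ k → Dec (k ≡ # 0 ⊎ k ≡ # 2 ⊎ k ≡ # 5)
  even k = (k Fin.≟ # 0) ⊎-dec (k Fin.≟ # 2) ⊎-dec (k Fin.≟ # 5)
  odd : ∀ k → Dec (k ≡ # 1 ⊎ k ≡ # 3 ⊎ k ≡ # 4)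
  odd k = (k Fin.≟ # 1) ⊎-dec (k Fin.≟ # 3) ⊎-dec (k Fin.≟ # 4)

∑ℤ : ∀ {n} → Vector ℤ n → ℤ
∑ℤ = RawMonoidDefs.sum ℤ.+-0-rawMonoid

essential : ∀ {k} → Vec ℤ k → (Fin k → Fin 20) → Fin 20 → ℤ
essential c t u = ∑ℤ (λ j → lookup c j ℤ.* (if does (t j Fin.≟ u) then + 1 else + 0))

essential-cong : ∀ {k} (c : Vec ℤ k) {t t′ : Fin k → Fin 20} → (∀ j → t j ≡ t′ j) → ∀ u →
                 essential c t u ≡ essential c t′ u
essential-cong []      eq u = ≡.refl
essential-cong (x ∷ c) eq u = ≡.cong₂ (λ v z → x ℤ.* (if does (v Fin.≟ u) then + 1 else + 0) ℤ.+ z)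
  (eq zero) (essential-cong c (eq ∘ suc) u)

data Sign : Set where
  ⊕ ⊖ : Sign

signed : Sign → ℤ → ℤ
signed ⊕ i = i
signed ⊖ i = ℤ.- i

SeedIsSigned : (Fin 6 → Fin 20) → Set
SeedIsSigned t = ∃[ s ] ∀ u → essential seed-III t u ≡ signed s (essential seed-III middle u)

-- The second vertex of each pair is the sibling of the first, so an admissible ordering is
-- determined by the places of y₁, y₃ and y₅. This leaves 6³ candidates.
paired : Fin 6 → Fin 6 → Fin 6 → Fin 6 → Fin 6
paired p q r = lookup (p ∷ sibling p ∷ q ∷ sibling q ∷ r ∷ sibling r ∷ [])

abstract
  -- Every edge of the hexagon, of either kind, joins one of y₁, y₃, y₆ to one of y₂, y₄, y₅. The
  -- seed is 1 on the former and -1 on the latter, thus a proper 2-colouring of the hexagon, and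
  -- there are only two of these.
  paired-seed : ∀ p q r → let τ = paired p q r in
    (∀ k l → τ k ≡ τ l → k ≡ l) →
    (∀ k l → (∃[ j ] nb (middle (τ k)) j ≡ middle (τ l)) → Alternating k l) →
    SeedIsSigned (middle ∘ τ)
  paired-seed = decided (Fin.all? λ p → Fin.all? λ q → Fin.all? λ r → let τ = paired p q r in
    (Fin.all? λ k → Fin.all? λ l → (τ k Fin.≟ τ l) →-dec (k Fin.≟ l)) →-dec
    ((Fin.all? λ k → Fin.all? λ l → (Fin.any? λ j → nb (middle (τ k)) j Fin.≟ middle (τ l)) →-dec alternating? k l) →-dec
    sign? (middle ∘ τ))) ≡.refl
    where
    sign? : ∀ t → Dec (SeedIsSigned t)
    sign? t = map′ [ (⊕ ,_) , (⊖ ,_) ]′ (λ { (⊕ , p) → inj₁ p ; (⊖ , p) → inj₂ p })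
      ((Fin.all? λ u → essential seed-III t u ℤ.≟ essential seed-III middle u) ⊎-dec
       (Fin.all? λ u → essential seed-III t u ℤ.≟ ℤ.- essential seed-III middle u))

module Labelled {n} {Γ : Graph n} {φ : Fin 20 → Fin n} (L : Labelling Γ φ) where

  open Graph Γ renaming (sym to adj-sym)
  open Labelling L

  adj-φ : ∀ {u v} → (∃[ j ] nb u j ≡ v) → Adj (φ u) (φ v)
  adj-φ (j , ≡.refl) = adj-nb _ j

  φ-adj : ∀ {u v} → Adj (φ u) (φ v) → ∃[ j ] nb u j ≡ v
  φ-adj {u} a with j , eq ← nb-all u a = j , φ-injective eq

  walk-level : ∀ {k v} w → Walk Γ k (φ w) (φ v) → level v ℕ.≤ level w ℕ.+ k
  walk-level w = go w ≡.refl ≡.refl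
    where
    go : ∀ {k y z v} w → φ w ≡ y → φ v ≡ z → Walk Γ k y z → level v ℕ.≤ level w ℕ.+ k
    go w ≡.refl eq [] = ℕ.≤-trans (ℕ.≤-reflexive (≡.cong level (φ-injective eq))) (ℕ.m≤m+n _ _)
    go {suc k} w ≡.refl eq (a ∷ as) with j , ≡.refl ← nb-all w a =
      ℕ.≤-trans (go (nb w j) ≡.refl eq as)
        (ℕ.≤-trans (ℕ.+-monoˡ-≤ k (level-lipschitz w j)) (ℕ.≤-reflexive (≡.sym (ℕ.+-suc (level w) k))))

  snoc : ∀ {k y w z} → Walk Γ k y w → Adj w z → Walk Γ (suc k) y z
  snoc []       b = b ∷ []
  snoc (a ∷ as) b = a ∷ snoc as b

  level-walk : ∀ k u → level u ≡ k → Walk Γ k (φ 0F) (φ u)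
  level-walk zero    u eq with ≡.refl ← level-zero u eq = []
  level-walk (suc k) u eq with level-descent u
  ... | inj₁ eq′       = contradiction (≡.trans (≡.sym eq) eq′) λ ()
  ... | inj₂ (j , eq′) = snoc
    (level-walk k (nb u j) (ℕ.suc-injective (≡.trans (≡.sym eq′) eq))) (adj-sym (adj-nb u j))

  distance-level : ∀ u → Distance Γ (φ 0F) (φ u) (level u)
  distance-level u = level-walk (level u) u ≡.refl , λ k< w → ℕ.<⇒≱ k< (walk-level 0F w)

  level-distance : ∀ {u i} → Distance Γ (φ 0F) (φ u) i → level u ≡ i
  level-distance {u} = distance-unique (distance-level u)

  distance-ψ : ∀ {y i} → Distance Γ (φ 0F) y i → level (ψ y) ≡ i
  distance-ψ {y} d = level-distance (≡.subst (λ y → Distance Γ (φ 0F) y _) (≡.sym (φψ y)) d)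

  ordering : ∀ {k} i (t : Fin k → Fin 20) → (∀ p → level (t p) ≡ i) → (∀ p q → t p ≡ t q → p ≡ q) →
             (∀ u → level u ≡ i → ∃[ p ] t p ≡ u) → IsOrdering Γ (φ 0F) i (φ ∘ t)
  ordering i t t-level t-injective t-complete = record
    { distinct = λ eq → t-injective _ _ (φ-injective eq)
    ; complete = λ y → mk⇔
        (λ d → let p , eq = t-complete (ψ y) (distance-ψ d) in p , ≡.trans (≡.cong φ eq) (φψ y))
        (λ { (p , ≡.refl) → ≡.subst (Distance Γ (φ 0F) (φ (t p))) (t-level p) (distance-level (t p)) }) }

  -- The statements about all admissible orderings are thereby not vacuous.
  middle-admissible : IsAdmissible Γ (φ 0F) (φ ∘ middle)
  middle-admissible = record
    { ordering = ordering 2 middle middle-level middle-injective middle-complete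
    ; pair₁₂   = common (# 4) ≡.refl (0F , ≡.refl) (2F , ≡.refl)
    ; pair₃₄   = common (# 5) ≡.refl (2F , ≡.refl) (1F , ≡.refl)
    ; pair₅₆   = common (# 1) ≡.refl (1F , ≡.refl) (2F , ≡.refl)
    ; edges    = λ k l a → decided (Fin.all? λ k → Fin.all? λ l →
        (Fin.any? λ j → nb (middle k) j Fin.≟ middle l) →-dec alternating? k l) ≡.refl k l (φ-adj a)
    }
    where
    common : ∀ {u v} w → level w ≡ 1 → (∃[ j ] nb w j ≡ u) → (∃[ j ] nb w j ≡ v) →
             CommonNeighbour Γ (φ 0F) (φ u) (φ v)
    common w lw≡1 wu wv =
      φ w , ≡.subst (Distance Γ (φ 0F) (φ w)) lw≡1 (distance-level w) , adj-φ wu , adj-φ wv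

  module _ {y : Vector (Fin n) 6} (Y : IsAdmissible Γ (φ 0F) y) where

    open IsAdmissible Y renaming (ordering to y-ordering)
    open IsOrdering y-ordering using (distinct; complete)

    private
      place : ∀ k → ∃[ p ] middle p ≡ ψ (y k)
      place k = middle-complete (ψ (y k)) (distance-ψ (Equivalence.from (complete (y k)) (k , ≡.refl)))

      τ : Fin 6 → Fin 6
      τ k = proj₁ (place k)

      y≡ : ∀ k → φ (middle (τ k)) ≡ y k
      y≡ k = ≡.trans (≡.cong φ (proj₂ (place k))) (φψ (y k))

      τ-injective : ∀ k l → τ k ≡ τ l → k ≡ l
      τ-injective k l eq = distinct
        (≡.trans (≡.sym (y≡ k)) (≡.trans (≡.cong (φ ∘ middle) eq) (y≡ l)))

      τ-sibling : ∀ {k l} → k ≢ l → CommonNeighbour Γ (φ 0F) (y k) (y l) → τ l ≡ sibling (τ k)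
      τ-sibling {k} {l} k≢l (w , d , wk , wl) = siblings (τ k) (τ l) (λ eq → k≢l (τ-injective k l eq))
        (ψ w) (distance-ψ d) (φ-adj (reach wk)) (φ-adj (reach wl))
        where
        reach : ∀ {k} → Adj w (y k) → Adj (φ (ψ w)) (φ (middle (τ k)))
        reach {k} = ≡.subst₂ Adj (≡.sym (φψ w)) (≡.sym (y≡ k))

      τ-paired : ∀ k → τ k ≡ paired (τ 0F) (τ 2F) (τ 4F) k
      τ-paired 0F = ≡.refl
      τ-paired 1F = τ-sibling (λ ()) pair₁₂
      τ-paired 2F = ≡.refl
      τ-paired 3F = τ-sibling (λ ()) pair₃₄
      τ-paired 4F = ≡.refl
      τ-paired 5F = τ-sibling (λ ()) pair₅₆

    seed-signed : SeedIsSigned (ψ ∘ y)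
    seed-signed =
      let s , eq = paired-seed (τ 0F) (τ 2F) (τ 4F)
            (λ k l eq → τ-injective k l (≡.trans (τ-paired k) (≡.trans eq (≡.sym (τ-paired l)))))
            (λ k l n → edges k l (≡.subst₂ Adj
              (≡.trans (≡.cong (φ ∘ middle) (≡.sym (τ-paired k))) (y≡ k))
              (≡.trans (≡.cong (φ ∘ middle) (≡.sym (τ-paired l))) (y≡ l)) (adj-φ n)))
      in s , λ u → ≡.trans (essential-cong seed-III
           (λ k → ≡.trans (≡.sym (proj₂ (place k))) (≡.cong middle (τ-paired k))) u) (eq u)

module _ {Γ : Graph 20} (Γ-dodecahedron : IsDodecahedron Γ) where

  open LocalStructure Γ-dodecahedron
  open Graph Γ using (Adj)

  abstract
    ordered-labelling : ∀ {x} (v : Vector (Fin 20) 3) → IsOrdering Γ x 1 v →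
      ∃[ φ ] Labelling Γ φ × φ (# 0) ≡ x × φ (# 4) ≡ v 0F × φ (# 1) ≡ v 1F × φ (# 5) ≡ v 2F
    ordered-labelling {x} v O = labelling Γ-dodecahedron
      (three (x~ 0F) (x~ 1F) (x~ 2F) (λ eq → case distinct eq of λ ()) (λ eq → case distinct eq of λ ())
        (λ eq → case distinct eq of λ ()))
      where
      open IsOrdering O
      x~ : ∀ k → Adj x (v k)
      x~ k = distance-1⇒adj (Equivalence.from (complete (v k)) (k , ≡.refl))

    some-labelling : ∀ x → ∃[ φ ] Labelling Γ φ × φ (# 0) ≡ x
    some-labelling x =
      let φ , L , φ0≡x , _ = labelling Γ-dodecahedron
            (three (sound 0F) (sound 1F) (sound 2F) (λ eq → case injective eq of λ ())
              (λ eq → case injective eq of λ ()) (λ eq → case injective eq of λ ()))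
      in φ , L , φ0≡x
      where open Enumeration (neighbours x)

-- Linear algebra over ℂ

module Sums (ℜ : RealNumbers) where

  open LinearAlgebra ℜ public
  open Complexes ℜ public
  open Algebra.Properties.Semiring.Sum semiring public
    using (*-distribˡ-sum; *-distribʳ-sum; ∑-distrib-+; ∑-comm; sum-cong-≋; sum-replicate-zero)
  open Relation.Binary.Reasoning.Setoid setoid public

  sum-cong : ∀ {n} {f g : Vector ℂ n} → (∀ j → f j ≈ g j) → sum f ≈ sum g
  sum-cong {n} {f} {g} = sum-cong-≋ {n} {f} {g}

  sum-zero : ∀ {n} {f : Vector ℂ n} → (∀ j → f j ≈ 0#) → sum f ≈ 0#
  sum-zero {n} eq = trans (sum-cong eq) (sum-replicate-zero n)

  indicator-yes : ∀ {P : Set} (P? : Dec P) → P → indicator P? ≈ 1#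
  indicator-yes (yes _) _ = refl
  indicator-yes (no ¬p) p = contradiction p ¬p

  indicator-no : ∀ {P : Set} (P? : Dec P) → ¬ P → indicator P? ≈ 0#
  indicator-no (yes p) ¬p = contradiction p ¬p
  indicator-no (no _)  _  = refl

  indicator-⇔ : ∀ {P Q : Set} (P? : Dec P) (Q? : Dec Q) → (P → Q) → (Q → P) → indicator P? ≈ indicator Q?
  indicator-⇔ (yes p) Q? f _ = sym (indicator-yes Q? (f p))
  indicator-⇔ (no ¬p) Q? _ g = sym (indicator-no Q? (¬p ∘ g))

  indicator-× : ∀ {P Q : Set} (P? : Dec P) (Q? : Dec Q) → indicator (P? ×-dec Q?) ≈ indicator P? * indicator Q?
  indicator-× (yes _) (yes _) = sym (*-identityˡ 1#)
  indicator-× (yes _) (no _)  = sym (zeroʳ 1#)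
  indicator-× (no _)  Q?      = sym (zeroˡ (indicator Q?))

  sum-only : ∀ {n} {f : Vector ℂ n} i → (∀ j → j ≢ i → f j ≈ 0#) → sum f ≈ f i
  sum-only {suc n} {f} zero    others = trans (+-congˡ (sum-zero λ j → others (suc j) λ ())) (+-identityʳ (f zero))
  sum-only {suc n} {f} (suc i) others = trans (+-cong (others zero λ ()) (sum-only i λ j j≢i →
    others (suc j) (j≢i ∘ Fin.suc-injective))) (+-identityˡ (f (suc i)))

  sum-indicator : ∀ {n} {P : Fin n → Set} (P? : ∀ j → Dec (P j)) (f : Vector ℂ n) i → P i →
                  (∀ j → P j → j ≡ i) → sum (λ j → indicator (P? j) * f j) ≈ f i
  sum-indicator P? f i Pi only = begin
    sum (λ j → indicator (P? j) * f j)    ≈⟨ sum-only i (λ j j≢i →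
      trans (*-congʳ (indicator-no (P? j) (j≢i ∘ only j))) (zeroˡ (f j))) ⟩
    indicator (P? i) * f i                ≈⟨ *-congʳ (indicator-yes (P? i) Pi) ⟩
    1# * f i                              ≈⟨ *-identityˡ (f i) ⟩
    f i                                   ∎

  -- Iterated cotransitivity of apartness. It is the constructive way to pick an invertible
  -- coefficient of a nonzero vector.
  sum-#0 : ∀ {n} {f : Vector ℂ n} → sum f # 0# → ∃[ j ] f j # 0#
  sum-#0 {zero}      p = contradiction p (≈0⇒¬#0 refl)
  sum-#0 {suc n} {f} p with +#0 (f zero) _ p
  ... | inj₁ q = zero , q
  ... | inj₂ q with j , r ← sum-#0 {n} q = suc j , r

  dot : ∀ {n} → Vector ℂ n → Vector ℂ n → ℂ
  dot u v = sum (λ y → u y * v y)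

  dot-cong : ∀ {n} (u : Vector ℂ n) {v w : Vector ℂ n} → v ≈ᴹ w → dot u v ≈ dot u w
  dot-cong u v≈w = sum-cong λ y → *-congˡ (v≈w y)

  sumᴹ-at : ∀ {I : Set} {k} (v : Vector (I → ℂ) k) i → sumᴹ v i ≡ sum (λ j → v j i)
  sumᴹ-at {k = zero}  v i = ≡.refl
  sumᴹ-at {k = suc k} v i = ≡.cong (λ z → v zero i + z) (sumᴹ-at (v ∘ suc) i)

  combination-at : ∀ {I : Set} {k} (a : Vector ℂ k) (v : Vector (I → ℂ) k) i →
                   combination a v i ≡ sum (λ j → a j * v j i)
  combination-at a v = sumᴹ-at (λ j → a j *ₗ v j)

  combination-cong : ∀ {I : Set} {k} {a b : Vector ℂ k} (v : Vector (I → ℂ) k) →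
                     (∀ j → a j ≈ b j) → combination a v ≈ᴹ combination b v
  combination-cong {a = a} {b} v a≈b i = begin
    combination a v i                  ≡⟨ combination-at a v i ⟩
    sum (λ j → a j * v j i)            ≈⟨ sum-cong (λ j → *-congʳ (a≈b j)) ⟩
    sum (λ j → b j * v j i)            ≡⟨ combination-at b v i ⟨
    combination b v i                  ∎

  combination-congʳ : ∀ {I : Set} {k} (a : Vector ℂ k) {v w : Vector (I → ℂ) k} →
                      (∀ j → v j ≈ᴹ w j) → combination a v ≈ᴹ combination a w
  combination-congʳ a {v} {w} v≈w i = begin
    combination a v i                  ≡⟨ combination-at a v i ⟩
    sum (λ j → a j * v j i)            ≈⟨ sum-cong (λ j → *-congˡ (v≈w j i)) ⟩
    sum (λ j → a j * w j i)            ≡⟨ combination-at a w i ⟨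
    combination a w i                  ∎

  combination-zero : ∀ {I : Set} {k} {a : Vector ℂ k} (v : Vector (I → ℂ) k) →
                     (∀ j → a j ≈ 0#) → combination a v ≈ᴹ 0ᴹ
  combination-zero {a = a} v a≈0 i = trans (reflexive (combination-at a v i))
    (sum-zero λ j → trans (*-congʳ (a≈0 j)) (zeroˡ (v j i)))

  combination-+ : ∀ {I : Set} {k} (a b : Vector ℂ k) (v : Vector (I → ℂ) k) →
                  combination (λ j → a j + b j) v ≈ᴹ combination a v +ᴹ combination b v
  combination-+ a b v i = begin
    combination (λ j → a j + b j) v i                          ≡⟨ combination-at _ v i ⟩
    sum (λ j → (a j + b j) * v j i)                            ≈⟨ sum-cong (λ j → distribʳ (v j i) (a j) (b j)) ⟩
    sum (λ j → a j * v j i + b j * v j i)                      ≈⟨ ∑-distrib-+ (λ j → a j * v j i) (λ j → b j * v j i) ⟩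
    sum (λ j → a j * v j i) + sum (λ j → b j * v j i)          ≡⟨ ≡.cong₂ _+_ (combination-at a v i) (combination-at b v i) ⟨
    combination a v i + combination b v i                      ∎

  combination-* : ∀ {I : Set} {k} c (a : Vector ℂ k) (v : Vector (I → ℂ) k) →
                  combination (λ j → c * a j) v ≈ᴹ c *ₗ combination a v
  combination-* c a v i = begin
    combination (λ j → c * a j) v i        ≡⟨ combination-at _ v i ⟩
    sum (λ j → c * a j * v j i)            ≈⟨ sum-cong (λ j → *-assoc c (a j) (v j i)) ⟩
    sum (λ j → c * (a j * v j i))          ≈⟨ *-distribˡ-sum c (λ j → a j * v j i) ⟨
    c * sum (λ j → a j * v j i)            ≡⟨ ≡.cong (c *_) (combination-at a v i) ⟨
    c * combination a v i                  ∎

  combination-unit : ∀ {I : Set} {k} (v : Vector (I → ℂ) k) i →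
                     combination (λ j → indicator (j Fin.≟ i)) v ≈ᴹ v i
  combination-unit v i y = trans (reflexive (combination-at _ v y))
    (sum-indicator (Fin._≟ i) (λ j → v j y) i ≡.refl (λ _ eq → eq))

  dot-combination : ∀ {n k} (u : Vector ℂ n) (a : Vector ℂ k) (v : Vector (Vector ℂ n) k) →
                    dot u (combination a v) ≈ sum (λ j → a j * dot u (v j))
  dot-combination u a v = begin
    sum (λ y → u y * combination a v y)                  ≈⟨ sum-cong (λ y → *-congˡ (reflexive (combination-at a v y))) ⟩
    sum (λ y → u y * sum (λ j → a j * v j y))            ≈⟨ sum-cong (λ y → *-distribˡ-sum (u y) (λ j → a j * v j y)) ⟩
    sum (λ y → sum (λ j → u y * (a j * v j y)))          ≈⟨ ∑-comm (λ y j → u y * (a j * v j y)) ⟩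
    sum (λ j → sum (λ y → u y * (a j * v j y)))          ≈⟨ sum-cong (λ j → sum-cong λ y → swap (u y) (a j) (v j y)) ⟩
    sum (λ j → sum (λ y → a j * (u y * v j y)))          ≈⟨ sum-cong (λ j → *-distribˡ-sum (a j) (λ y → u y * v j y)) ⟨
    sum (λ j → a j * dot u (v j))                        ∎
    where
    swap : ∀ x y z → x * (y * z) ≈ y * (x * z)
    swap x y z = trans (sym (*-assoc x y z)) (trans (*-congʳ (*-comm x y)) (*-assoc y x z))

  dot-sumᴹ : ∀ {n k} (u : Vector ℂ n) (v : Vector (Vector ℂ n) k) →
             dot u (sumᴹ v) ≈ sum (λ j → dot u (v j))
  dot-sumᴹ u v = begin
    sum (λ y → u y * sumᴹ v y)                     ≈⟨ sum-cong (λ y → *-congˡ (reflexive (sumᴹ-at v y))) ⟩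
    sum (λ y → u y * sum (λ j → v j y))            ≈⟨ sum-cong (λ y → *-distribˡ-sum (u y) (λ j → v j y)) ⟩
    sum (λ y → sum (λ j → u y * v j y))            ≈⟨ ∑-comm (λ y j → u y * v j y) ⟩
    sum (λ j → dot u (v j))                        ∎

  dot-*ₗ : ∀ {n} (u : Vector ℂ n) c v → dot u (c *ₗ v) ≈ c * dot u v
  dot-*ₗ u c v = trans (sum-cong λ y → trans (sym (*-assoc (u y) c (v y))) (trans (*-congʳ (*-comm (u y) c))
    (*-assoc c (u y) (v y)))) (sym (*-distribˡ-sum c (λ y → u y * v y)))

  dot-0ᴹ : ∀ {n} (u : Vector ℂ n) → dot u 0ᴹ ≈ 0#
  dot-0ᴹ u = sum-zero λ y → zeroʳ (u y)

  module _ {n} (M : Matrix n) where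

    ·-cong : ∀ {v w} → v ≈ᴹ w → M · v ≈ᴹ M · w
    ·-cong v≈w y = dot-cong (λ z → M (y , z)) v≈w

    ·-combination : ∀ {k} (a : Vector ℂ k) v → M · combination a v ≈ᴹ combination a (λ j → M · v j)
    ·-combination a v y = trans (dot-combination (λ z → M (y , z)) a v)
      (reflexive (≡.sym (combination-at a (λ j → M · v j) y)))

    ·-sumᴹ : ∀ {k} (v : Vector (Vector ℂ n) k) → M · sumᴹ v ≈ᴹ sumᴹ (λ j → M · v j)
    ·-sumᴹ v y = trans (dot-sumᴹ (λ z → M (y , z)) v) (reflexive (≡.sym (sumᴹ-at (λ j → M · v j) y)))

  identity-· : ∀ {n} (v : Vector ℂ n) → identity · v ≈ᴹ v
  identity-· v y = sum-indicator (y Fin.≟_) v y ≡.refl λ _ eq → ≡.sym eq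

  +ᴹ-· : ∀ {n} (M N : Matrix n) v → (M +ᴹ N) · v ≈ᴹ M · v +ᴹ N · v
  +ᴹ-· M N v y = trans (sum-cong λ z → distribʳ (v z) (M (y , z)) (N (y , z)))
    (∑-distrib-+ (λ z → M (y , z) * v z) (λ z → N (y , z) * v z))

  *ₗ-· : ∀ {n} c (M : Matrix n) v → (c *ₗ M) · v ≈ᴹ c *ₗ (M · v)
  *ₗ-· c M v y = trans (sum-cong λ z → *-assoc c (M (y , z)) (v z))
    (sym (*-distribˡ-sum c (λ z → M (y , z) * v z)))

  0ᴹ-· : ∀ {n} (v : Vector ℂ n) → (0ᴹ {Fin n × Fin n}) · v ≈ᴹ 0ᴹ
  0ᴹ-· v y = sum-zero λ z → zeroˡ (v z)

  ⊗-· : ∀ {n} (M N : Matrix n) v → (M ⊗ N) · v ≈ᴹ M · (N · v)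
  ⊗-· M N v y = begin
    sum (λ z → sum (λ w → M (y , w) * N (w , z)) * v z)        ≈⟨ sum-cong (λ z → *-distribʳ-sum (v z) (λ w → M (y , w) * N (w , z))) ⟩
    sum (λ z → sum (λ w → M (y , w) * N (w , z) * v z))        ≈⟨ ∑-comm (λ z w → M (y , w) * N (w , z) * v z) ⟩
    sum (λ w → sum (λ z → M (y , w) * N (w , z) * v z))        ≈⟨ sum-cong (λ w → sum-cong λ z → *-assoc (M (y , w)) (N (w , z)) (v z)) ⟩
    sum (λ w → sum (λ z → M (y , w) * (N (w , z) * v z)))      ≈⟨ sum-cong (λ w → *-distribˡ-sum (M (y , w)) (λ z → N (w , z) * v z)) ⟨
    sum (λ w → M (y , w) * (N · v) w)                          ∎

  ≈ᴹ-· : ∀ {n} {M N : Matrix n} → M ≈ᴹ N → ∀ v → M · v ≈ᴹ N · v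
  ≈ᴹ-· M≈N v y = sum-cong λ z → *-congʳ (M≈N (y , z))

  Span : ∀ {I : Set} {k} → Vector (I → ℂ) k → Pred (I → ℂ) 0ℓ
  Span v w = ∃[ a ] w ≈ᴹ combination a v

  span-isSubspace : ∀ {I : Set} {k} (v : Vector (I → ℂ) k) → IsSubspace (Span v)
  span-isSubspace v = record
    { resp-≈   = λ u≈w (a , u≈) → a , λ i → trans (sym (u≈w i)) (u≈ i)
    ; 0-closed = (λ _ → 0#) , λ i → sym (combination-zero v (λ _ → refl) i)
    ; +-closed = λ (a , u≈) (b , w≈) → (λ j → a j + b j) , λ i →
        trans (+-cong (u≈ i) (w≈ i)) (sym (combination-+ a b v i))
    ; *-closed = λ c (a , u≈) → (λ j → c * a j) , λ i → trans (*-congˡ (u≈ i)) (sym (combination-* c a v i))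
    }

  -- A basis of ℂⁿ split into blocks, together with its dual basis for the bilinear `dot`. Duality
  -- gives independence and `resolution` gives spanning, so that coordinates are dot products and
  -- dimensions are never counted.
  record Frame (n : ℕ) {s} (dim : Fin s → ℕ) : Set where
    field
      vec dual : ∀ k → Fin (dim k) → Vector ℂ n
      dual-same : ∀ k i j → dot (dual k i) (vec k j) ≈ indicator (j Fin.≟ i)
      dual-diff : ∀ {k l} → k ≢ l → ∀ i j → dot (dual k i) (vec l j) ≈ 0#
      resolution : ∀ y z → sum (λ k → sum (λ i → vec k i y * dual k i z)) ≈ indicator (y Fin.≟ z)

    coord : ∀ k → Vector ℂ n → Vector ℂ (dim k)
    coord k v i = dot (dual k i) v

    component : ∀ k → Vector ℂ n → Vector ℂ n
    component k v = combination (coord k v) (vec k)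

    coord-same : ∀ k a → ∀ i → coord k (combination a (vec k)) i ≈ a i
    coord-same k a i = begin
      dot (dual k i) (combination a (vec k))             ≈⟨ dot-combination (dual k i) a (vec k) ⟩
      sum (λ j → a j * dot (dual k i) (vec k j))         ≈⟨ sum-cong (λ j → trans (*-congˡ (dual-same k i j)) (*-comm (a j) _)) ⟩
      sum (λ j → indicator (j Fin.≟ i) * a j)            ≈⟨ sum-indicator (Fin._≟ i) a i ≡.refl (λ _ eq → eq) ⟩
      a i                                                ∎

    coord-diff : ∀ {k l} → k ≢ l → ∀ a i → coord k (combination a (vec l)) i ≈ 0#
    coord-diff {k} {l} k≢l a i = trans (dot-combination (dual k i) a (vec l))
      (sum-zero λ j → trans (*-congˡ (dual-diff k≢l i j)) (zeroʳ (a j)))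

    coord-sumᴹ : (w : ∀ k → Vector ℂ n) → (∀ k → Span (vec k) (w k)) → ∀ k i →
                 coord k (sumᴹ w) i ≈ coord k (w k) i
    coord-sumᴹ w w∈ k i = trans (dot-sumᴹ (dual k i) w) (sum-only k λ l l≢k →
      trans (dot-cong (dual k i) (proj₂ (w∈ l))) (coord-diff (≢-sym l≢k) (proj₁ (w∈ l)) i))

    expand : ∀ v → v ≈ᴹ sumᴹ (λ k → component k v)
    expand v y = begin
      v y                                                             ≈⟨ sum-indicator (y Fin.≟_) v y ≡.refl (λ _ eq → ≡.sym eq) ⟨
      sum (λ z → indicator (y Fin.≟ z) * v z)                         ≈⟨ sum-cong (λ z → *-congʳ (resolution y z)) ⟨
      sum (λ z → sum (λ k → sum (λ i → vec k i y * dual k i z)) * v z)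
        ≈⟨ sum-cong (λ z → trans (*-distribʳ-sum (v z) (λ k → sum (λ i → vec k i y * dual k i z)))
             (sum-cong λ k → *-distribʳ-sum (v z) (λ i → vec k i y * dual k i z))) ⟩
      sum (λ z → sum (λ k → sum (λ i → vec k i y * dual k i z * v z)))
        ≈⟨ ∑-comm (λ z k → sum (λ i → vec k i y * dual k i z * v z)) ⟩
      sum (λ k → sum (λ z → sum (λ i → vec k i y * dual k i z * v z)))
        ≈⟨ sum-cong (λ k → ∑-comm (λ z i → vec k i y * dual k i z * v z)) ⟩
      sum (λ k → sum (λ i → sum (λ z → vec k i y * dual k i z * v z)))
        ≈⟨ sum-cong (λ k → sum-cong λ i → collect k i) ⟩
      sum (λ k → sum (λ i → coord k v i * vec k i y))
        ≈⟨ sum-cong (λ k → reflexive (combination-at (coord k v) (vec k) y)) ⟨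
      sum (λ k → component k v y)                                     ≡⟨ sumᴹ-at (λ k → component k v) y ⟨
      sumᴹ (λ k → component k v) y                                    ∎
      where
      collect : ∀ k i → sum (λ z → vec k i y * dual k i z * v z) ≈ coord k v i * vec k i y
      collect k i = begin
        sum (λ z → vec k i y * dual k i z * v z)     ≈⟨ sum-cong (λ z → *-assoc (vec k i y) (dual k i z) (v z)) ⟩
        sum (λ z → vec k i y * (dual k i z * v z))   ≈⟨ *-distribˡ-sum (vec k i y) (λ z → dual k i z * v z) ⟨
        vec k i y * coord k v i                      ≈⟨ *-comm (vec k i y) (coord k v i) ⟩
        coord k v i * vec k i y                      ∎

    only-component : ∀ k v → (∀ l → l ≢ k → ∀ i → coord l v i ≈ 0#) → v ≈ᴹ component k v
    only-component k v others y = begin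
      v y                                 ≈⟨ expand v y ⟩
      sumᴹ (λ l → component l v) y        ≡⟨ sumᴹ-at (λ l → component l v) y ⟩
      sum (λ l → component l v y)         ≈⟨ sum-only k (λ l l≢k → combination-zero (vec l) (others l l≢k) y) ⟩
      component k v y                     ∎

    independent : ∀ k a → combination a (vec k) ≈ᴹ 0ᴹ → ∀ i → a i ≈ 0#
    independent k a eq i = trans (sym (coord-same k a i)) (trans (dot-cong (dual k i) eq) (dot-0ᴹ (dual k i)))

    coord-#0 : ∀ {v} → IsNonzero v → ∃[ k ] ∃[ i ] coord k v i # 0#
    coord-#0 {v} (y , vy#0)
      with k , p ← sum-#0 (#0-resp (trans (expand v y) (reflexive (sumᴹ-at (λ k → component k v) y))) vy#0)
      with i , q ← sum-#0 (#0-resp (reflexive (combination-at (coord k v) (vec k) y)) p) =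
      k , i , *#0ˡ _ _ q

    vec-nonzero : ∀ k i → IsNonzero (vec k i)
    vec-nonzero k i with y , p ← sum-#0 (#0-resp (sym (trans (dual-same k i i)
      (indicator-yes (i Fin.≟ i) ≡.refl))) 1#0) = y , *#0ʳ _ _ p

    span-basis : ∀ k → IsBasis (Span (vec k)) (vec k)
    span-basis k = record
      { inside      = λ j → _ , λ y → sym (combination-unit (vec k) j y)
      ; spanning    = λ w w∈ → w∈
      ; independent = independent k
      }

    Action : Matrix n → (∀ k → Matrix (dim k)) → Set
    Action M B = ∀ k j → M · vec k j ≈ᴹ combination (λ i → B k (i , j)) (vec k)

    module _ {M : Matrix n} {B : ∀ k → Matrix (dim k)} (M∼B : Action M B) where

      action-combination : ∀ k a → M · combination a (vec k) ≈ᴹ combination (B k · a) (vec k)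
      action-combination k a y = begin
        (M · combination a (vec k)) y
          ≈⟨ ·-combination M a (vec k) y ⟩
        combination a (λ j → M · vec k j) y
          ≈⟨ combination-congʳ a (M∼B k) y ⟩
        combination a (λ j → combination (λ i → B k (i , j)) (vec k)) y
          ≡⟨ combination-at a (λ j → combination (λ i → B k (i , j)) (vec k)) y ⟩
        sum (λ j → a j * combination (λ i → B k (i , j)) (vec k) y)
          ≈⟨ sum-cong (λ j → *-congˡ (reflexive (combination-at (λ i → B k (i , j)) (vec k) y))) ⟩
        sum (λ j → a j * sum (λ i → B k (i , j) * vec k i y))
          ≈⟨ sum-cong (λ j → *-distribˡ-sum (a j) (λ i → B k (i , j) * vec k i y)) ⟩
        sum (λ j → sum (λ i → a j * (B k (i , j) * vec k i y)))
          ≈⟨ ∑-comm (λ j i → a j * (B k (i , j) * vec k i y)) ⟩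
        sum (λ i → sum (λ j → a j * (B k (i , j) * vec k i y)))
          ≈⟨ sum-cong (λ i → trans (sum-cong λ j → trans (sym (*-assoc (a j) _ _)) (*-congʳ (*-comm (a j) _)))
               (sym (*-distribʳ-sum (vec k i y) (λ j → B k (i , j) * a j)))) ⟩
        sum (λ i → (B k · a) i * vec k i y)
          ≡⟨ combination-at (B k · a) (vec k) y ⟨
        combination (B k · a) (vec k) y ∎

      -- `M` preserves each block, so only the component of `v` in block `k` contributes.
      coord-action : ∀ k v i → coord k (M · v) i ≈ (B k · coord k v) i
      coord-action k v i = begin
        coord k (M · v) i
          ≈⟨ dot-cong (dual k i) (λ y → trans (·-cong M (expand v) y) (·-sumᴹ M (λ l → component l v) y)) ⟩
        coord k (sumᴹ (λ l → M · component l v)) i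
          ≈⟨ coord-sumᴹ (λ l → M · component l v) (λ l → _ , action-combination l (coord l v)) k i ⟩
        coord k (M · component k v) i
          ≈⟨ dot-cong (dual k i) (action-combination k (coord k v)) ⟩
        coord k (combination (B k · coord k v) (vec k)) i
          ≈⟨ coord-same k (B k · coord k v) i ⟩
        (B k · coord k v) i ∎

-- Spectra from frames of eigenvectors

module Spectra (ℜ : RealNumbers) where

  open Sums ℜ

  *-cancel-#0 : ∀ {z} w → z # 0# → z * w ≈ 0# → w ≈ 0#
  *-cancel-#0 {z} w z#0 zw≈0 = let u , zu≈1 = inverse z#0 in begin
    w              ≈⟨ *-identityˡ w ⟨
    1# * w         ≈⟨ *-congʳ (trans (sym zu≈1) (*-comm z u)) ⟩
    u * z * w      ≈⟨ *-assoc u z w ⟩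
    u * (z * w)    ≈⟨ *-congˡ zw≈0 ⟩
    u * 0#         ≈⟨ zeroʳ u ⟩
    0#             ∎

  -≈0⇒≈ : ∀ z w → z - w ≈ 0# → z ≈ w
  -≈0⇒≈ z w eq = begin
    z              ≈⟨ +-identityʳ z ⟨
    z + 0#         ≈⟨ +-congˡ (-‿inverseˡ w) ⟨
    z + (- w + w)  ≈⟨ +-assoc z (- w) w ⟨
    z - w + w      ≈⟨ +-congʳ eq ⟩
    0# + w         ≈⟨ +-identityˡ w ⟩
    w              ∎

  -‿*-cancel : ∀ z w c → z * c ≈ w * c → (z - w) * c ≈ 0#
  -‿*-cancel z w c eq = begin
    (z - w) * c          ≈⟨ distribʳ c z (- w) ⟩
    z * c + - w * c      ≈⟨ +-congʳ eq ⟩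
    w * c + - w * c      ≈⟨ distribʳ c w (- w) ⟨
    (w - w) * c          ≈⟨ *-congʳ (-‿inverseʳ w) ⟩
    0# * c               ≈⟨ zeroˡ c ⟩
    0#                   ∎

  module _ {n s} (M : Matrix n) (θ : Vector ℂ s) (m : Fin s → ℕ) where

    module _ (F : Frame n m) where

      open Frame F

      Eigenframe : Set
      Eigenframe = ∀ k i → M · vec k i ≈ᴹ θ k *ₗ vec k i

      module _ (eigen : Eigenframe) (apart : ∀ k l → k ≢ l → θ k - θ l # 0#)
               (total : sum-ℕ (List.map proj₂ (List.tabulate λ k → θ k , m k)) ≡ n) where

        private
          action : Action M (λ k (i , j) → θ k * indicator (i Fin.≟ j))
          action k j y = begin
            (M · vec k j) y                                               ≈⟨ eigen k j y ⟩
            θ k * vec k j y                                               ≈⟨ *-congˡ (combination-unit (vec k) j y) ⟨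
            θ k * combination (λ i → indicator (i Fin.≟ j)) (vec k) y
              ≈⟨ combination-* (θ k) (λ i → indicator (i Fin.≟ j)) (vec k) y ⟨
            combination (λ i → θ k * indicator (i Fin.≟ j)) (vec k) y     ∎

          scaled : ∀ k v i → coord k (M · v) i ≈ θ k * coord k v i
          scaled k v i = begin
            coord k (M · v) i                                                 ≈⟨ coord-action action k v i ⟩
            sum (λ j → θ k * indicator (i Fin.≟ j) * coord k v j)             ≈⟨ sum-cong (λ j → *-assoc (θ k) _ (coord k v j)) ⟩
            sum (λ j → θ k * (indicator (i Fin.≟ j) * coord k v j))           ≈⟨ *-distribˡ-sum (θ k) (λ j → indicator (i Fin.≟ j) * coord k v j) ⟨
            θ k * sum (λ j → indicator (i Fin.≟ j) * coord k v j)
              ≈⟨ *-congˡ (sum-indicator (i Fin.≟_) (coord k v) i ≡.refl (λ _ eq → ≡.sym eq)) ⟩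
            θ k * coord k v i                                                 ∎

          -- For `η` equal to some `θ l` this kills all coordinates outside block `l`, so that block
          -- spans the eigenspace. For a nonzero eigenvector it forces `η ≈ θ k` at a coordinate
          -- apart from 0.
          eigencoord : ∀ {η v} → v ∈ Eigenspace M η → ∀ k i → (η - θ k) * coord k v i ≈ 0#
          eigencoord {η} {v} Mv≈ηv k i = -‿*-cancel η (θ k) (coord k v i) (begin
            η * coord k v i      ≈⟨ dot-*ₗ (dual k i) η v ⟨
            coord k (η *ₗ v) i   ≈⟨ dot-cong (dual k i) Mv≈ηv ⟨
            coord k (M · v) i    ≈⟨ scaled k v i ⟩
            θ k * coord k v i    ∎)

        hasSpectrum : HasSpectrum M (List.tabulate λ k → θ k , m k)
        hasSpectrum = record
          { distinct       = AllPairs.tabulate⁺ λ {k} {l} k≢l → -#0⇒# (θ k) (θ l) (apart k l k≢l)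
          ; multiplicities = AllProperties.tabulate⁺ λ k → vec k , record
            { inside      = eigen k
            ; spanning    = λ v v∈ → coord k v , only-component k v λ l l≢k i →
                *-cancel-#0 (coord l v i) (apart k l (≢-sym l≢k)) (eigencoord v∈ l i)
            ; independent = independent k
            }
          ; exhaustive     = λ { η (v , v∈ , v#0) → let k , i , c#0 = coord-#0 v#0 in
              AnyProperties.tabulate⁺ k (-≈0⇒≈ η (θ k) (*-cancel-#0 (η - θ k) c#0
                (trans (*-comm (coord k v i) (η - θ k)) (eigencoord v∈ k i)))) }
          ; total          = total
          }

-- Modules on which T acts through matrix units

subset : ∀ {n} {P : Pred (Fin n) 0ℓ} → (∀ i → Dec (P i)) → Subset n
subset P? = tabulate (λ i → does (P? i))

∈-subset : ∀ {n} {P : Pred (Fin n) 0ℓ} (P? : ∀ i → Dec (P i)) i → (i Subset.∈ subset P?) ⇔ P i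
∈-subset P? i = mk⇔
  (λ i∈ → holds (P? i) (≡.trans (≡.sym (Vec.lookup∘tabulate (does ∘ P?) i)) (Vec.[]=⇒lookup i∈)))
  (λ Pi → Vec.lookup⇒[]= i _ (≡.trans (Vec.lookup∘tabulate (does ∘ P?) i) (dec-true (P? i) Pi)))
  where
  holds : ∀ {P : Set} (P? : Dec P) → does P? ≡ true → P
  holds (yes p) _ = p

module IsotypicDecomposition (ℜ : RealNumbers) {n} (Γ : Graph n) (D : ℕ) (x : Fin n) where

  open Sums ℜ
  open Spectra ℜ using (*-cancel-#0)
  open Terwilliger ℜ Γ D x hiding (A∈T; E*∈T; 1-closed; 0-closed; +-closed; *-closed; ⊗-closed; resp-≈)

  -- The indicator of `P` is the sum of the indicators of the enumerated points; after the two sums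
  -- are exchanged, each inner one has a single term.
  sum-enumeration : ∀ {m k} {P : Pred (Fin m) 0ℓ} (P? : ∀ j → Dec (P j)) (e : Enumeration P k) (f : Vector ℂ m) →
                    let open Enumeration e in
                    sum (λ j → indicator (P? j) * f j) ≈ sum (λ p → f (at p))
  sum-enumeration {m} {k} {P} P? e f = begin
    sum (λ j → indicator (P? j) * f j)
      ≈⟨ sum-cong (λ j → *-congʳ (counted j)) ⟩
    sum (λ j → sum (λ p → indicator (at p Fin.≟ j)) * f j)
      ≈⟨ sum-cong (λ j → *-distribʳ-sum (f j) (λ p → indicator (at p Fin.≟ j))) ⟩
    sum (λ j → sum (λ p → indicator (at p Fin.≟ j) * f j))
      ≈⟨ ∑-comm (λ j p → indicator (at p Fin.≟ j) * f j) ⟩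
    sum (λ p → sum (λ j → indicator (at p Fin.≟ j) * f j))
      ≈⟨ sum-cong (λ p → sum-indicator (at p Fin.≟_) f (at p) ≡.refl λ _ eq → ≡.sym eq) ⟩
    sum (λ p → f (at p)) ∎
    where
    open Enumeration e
    counted : ∀ j → indicator (P? j) ≈ sum (λ p → indicator (at p Fin.≟ j))
    counted j with P? j
    ... | no ¬Pj = sym (sum-zero λ p → indicator-no (at p Fin.≟ j) λ { ≡.refl → ¬Pj (sound p) })
    ... | yes Pj with p , ≡.refl ← index Pj = sym (trans
      (sum-only p λ q q≢p → indicator-no (at q Fin.≟ at p) (q≢p ∘ injective))
      (indicator-yes (at p Fin.≟ at p) ≡.refl))

  span-⊆ : ∀ {k} {W : Pred V 0ℓ} (v : Vector V k) → IsSubspace W → (∀ j → v j ∈ W) → Span v ⊆ W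
  span-⊆ {W = W} v S v∈ (a , w≈) = S.resp-≈ (λ i → sym (w≈ i)) (go a v v∈)
    where
    module S = IsSubspace S
    go : ∀ {k} (a : Vector ℂ k) v → (∀ j → v j ∈ W) → combination a v ∈ W
    go {zero}  a v v∈ = S.0-closed
    go {suc k} a v v∈ = S.+-closed (S.*-closed (a zero) (v∈ zero)) (go (a ∘ suc) (v ∘ suc) (v∈ ∘ suc))

  -- The isomorphism keeps the coefficients. Their uniqueness makes it well defined and injective,
  -- and the common matrix `β` makes it commute with `T`.
  span-≅ : ∀ {m} (u w : Vector V m) →
           (∀ a b → combination a u ≈ᴹ combination b u → ∀ j → a j ≈ b j) →
           (∀ a b → combination a w ≈ᴹ combination b w → ∀ j → a j ≈ b j) →
           (∀ {B} → B ∈ T → Σ[ β ∈ Matrix m ]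
             (∀ a → B · combination a u ≈ᴹ combination (β · a) u) ×
             (∀ a → B · combination a w ≈ᴹ combination (β · a) w)) →
           Span u ≅ Span w
  span-≅ u w u-unique w-unique shared = record
    { to         = λ (_ , a , _) → combination a w , a , λ _ → refl
    ; cong       = λ { {_ , a , v≈} {_ , a′ , v′≈} eq → combination-cong w (u-unique a a′ λ y →
        trans (sym (v≈ y)) (trans (eq y) (v′≈ y))) }
    ; injective  = λ { {_ , a , v≈} {_ , a′ , v′≈} eq y → trans (v≈ y) (trans
        (combination-cong u (w-unique a a′ eq) y) (sym (v′≈ y))) }
    ; surjective = λ (v , b , v≈) → (combination b u , b , λ _ → refl) , λ { {_ , a , z≈} eq y →
        trans (combination-cong w (u-unique a b λ y → trans (sym (z≈ y)) (eq y)) y) (sym (v≈ y)) }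
    ; +-homo     = λ (_ , a , u≈) (_ , b , v≈) (_ , c , w≈) eq y → trans
        (combination-cong w (u-unique c (λ j → a j + b j) λ y → trans (sym (w≈ y)) (trans (eq y)
          (trans (+-cong (u≈ y) (v≈ y)) (sym (combination-+ a b u y))))) y)
        (combination-+ a b w y)
    ; *-homo     = λ z (_ , a , u≈) (_ , c , w≈) eq y → trans
        (combination-cong w (u-unique c (λ j → z * a j) λ y → trans (sym (w≈ y)) (trans (eq y)
          (trans (*-congˡ (u≈ y)) (sym (combination-* z a u y))))) y)
        (combination-* z a w y)
    ; commutes   = λ B B∈T (_ , a , v≈) (_ , c , w≈) eq y → let β , on-u , on-w = shared B∈T in trans
        (combination-cong w (u-unique c (β · a) λ y → trans (sym (w≈ y)) (trans (eq y)
          (trans (·-cong B v≈ y) (on-u a y)))) y)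
        (sym (on-w a y))
    }

  -- The isomorphism commutes with `E* i`, so it would send `E* i · w` to 0, and by injectivity
  -- `E* i · w` would vanish.
  ≅-transfers-support : ∀ {W W′} → IsModule W → W ≅ W′ → ∀ {i} → i ℕ.≤ D →
                        Nonzero (E*⟨ i ⟩ W) → ¬ (∀ w → w ∈ W′ → E* i · w ≈ᴹ 0ᴹ)
  ≅-transfers-support {W} {W′} M iso {i} i≤D (v , (w , w∈W , v≈) , y , vy#0) killed =
    ≈0⇒¬#0 (trans (v≈ y) (injective {Ew} {𝟎} (λ y → trans (to-Ew y) (sym (to-𝟎 y))) y)) vy#0
    where
    open _≅_ iso
    open IsModule M
    open IsSubspace isSubspace using () renaming (0-closed to 0∈W)
    Ew 𝟎 : ∃ W
    Ew = E* i · w , closed (T.E*∈T i≤D) w∈W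
    𝟎  = 0ᴹ , 0∈W

    to-Ew : proj₁ (to Ew) ≈ᴹ 0ᴹ
    to-Ew y = trans (commutes (E* i) (T.E*∈T i≤D) (w , w∈W) Ew (λ _ → refl) y)
      (killed (proj₁ (to (w , w∈W))) (proj₂ (to (w , w∈W))) y)

    to-𝟎 : proj₁ (to 𝟎) ≈ᴹ 0ᴹ
    -- The zero vector is 0 times itself, so its image is 0 times something.
    to-𝟎 y = trans (*-homo 0# 𝟎 𝟎 (λ _ → sym (zeroˡ 0#)) y) (zeroˡ _)

  -- The dual argument, through surjectivity. With `≅-transfers-support` it handles a level missing
  -- on either side without inverting the isomorphism.
  ≅-reflects-zero : ∀ {W W′} → IsModule W → W ≅ W′ → ∀ {i} → i ℕ.≤ D →
                    (∀ w → w ∈ W → E* i · w ≈ᴹ 0ᴹ) → ∀ w → w ∈ W′ → E* i · w ≈ᴹ 0ᴹ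
  ≅-reflects-zero {W} {W′} M iso {i} i≤D killed w w∈ y = begin
    (E* i · w) y                          ≈⟨ ·-cong (E* i) (λ y → tov≈w {v} (λ _ → refl) y) y ⟨
    (E* i · proj₁ (to v)) y               ≈⟨ commutes (E* i) (T.E*∈T i≤D) v Ev (λ _ → refl) y ⟨
    proj₁ (to Ev) y                       ≈⟨ *-homo 0# Ev Ev (λ y → trans (Ev≈0 y)
      (sym (trans (*-congˡ (Ev≈0 y)) (zeroʳ 0#)))) y ⟩
    0# * proj₁ (to Ev) y                  ≈⟨ zeroˡ _ ⟩
    0#                                    ∎
    where
    open _≅_ iso
    v : ∃ W
    v = proj₁ (surjective (w , w∈))
    tov≈w : ∀ {z : ∃ W} → proj₁ z ≈ᴹ proj₁ v → proj₁ (to z) ≈ᴹ w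
    tov≈w {z} = proj₂ (surjective (w , w∈)) {z}
    Ev : ∃ W
    Ev = E* i · proj₁ v , IsModule.closed M (T.E*∈T i≤D) (proj₂ v)
    Ev≈0 : proj₁ Ev ≈ᴹ 0ᴹ
    Ev≈0 = killed (proj₁ v) (proj₂ v)

  -- The point of `type`: elements of T will act by the same matrix on the
  -- bases of summands of the same type.
  module _ {s} {τ : Set} (_≟_ : DecidableEquality τ) (type : Fin s → τ) (size : τ → ℕ)
           (F : Frame n (size ∘ type)) where

    open Frame F

    -- The product of full matrix algebras, one factor per type, with which `T` will be identified.
    Rep : Set
    Rep = ∀ t → Matrix (size t)

    Acts : Matrix n → Rep → Set
    Acts B ρ = Action B (ρ ∘ type)

    IsUnit : ∀ t (i j : Fin (size t)) → Rep → Set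
    IsUnit t i j ρ = (∀ i′ j′ → ρ t (i′ , j′) ≈ indicator ((i′ Fin.≟ i) ×-dec (j′ Fin.≟ j))) ×
                     (∀ t′ → t′ ≢ t → ∀ p → ρ t′ p ≈ 0#)

    record Certificate : Set where
      field
        summand   : ∀ t → ∃[ k ] type k ≡ t
        adjacency : Rep
        A-acts    : Acts A adjacency
        lev       : ∀ t → Fin (size t) → ℕ
        E*-acts   : ∀ i k j → E* i · vec k j ≈ᴹ indicator (lev (type k) j ℕ.≟ i) *ₗ vec k j
        unit      : ∀ t i j → ∃[ B ] B ∈ T × ∃[ ρ ] Acts B ρ × IsUnit t i j ρ
        orthogonal : ∀ {k l} → k ≢ l → ∀ i j → ⟨ vec k i , vec l j ⟩ ≈ 0#

    Acts-resp : ∀ {B C ρ} → B ≈ᴹ C → Acts B ρ → Acts C ρ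
    Acts-resp B≈C B∼ρ k j y = trans (sym (≈ᴹ-· B≈C (vec k j) y)) (B∼ρ k j y)

    Acts-cong : ∀ {B ρ ρ′} → (∀ t → ρ t ≈ᴹ ρ′ t) → Acts B ρ → Acts B ρ′
    Acts-cong ρ≈ρ′ B∼ρ k j y = trans (B∼ρ k j y) (combination-cong (vec k) (λ i → ρ≈ρ′ (type k) (i , j)) y)

    Acts-identity : Acts identity (λ t → identity)
    Acts-identity k j y = trans (identity-· (vec k j) y) (sym (combination-unit (vec k) j y))

    Acts-0 : Acts 0ᴹ (λ t → 0ᴹ)
    Acts-0 k j y = trans (0ᴹ-· (vec k j) y) (sym (combination-zero (vec k) (λ _ → refl) y))

    Acts-+ : ∀ {B C ρ ρ′} → Acts B ρ → Acts C ρ′ → Acts (B +ᴹ C) (λ t → ρ t +ᴹ ρ′ t)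
    Acts-+ {B} {C} B∼ρ C∼ρ′ k j y = trans (+ᴹ-· B C (vec k j) y)
      (trans (+-cong (B∼ρ k j y) (C∼ρ′ k j y)) (sym (combination-+ _ _ (vec k) y)))

    Acts-* : ∀ c {B ρ} → Acts B ρ → Acts (c *ₗ B) (λ t → c *ₗ ρ t)
    Acts-* c {B} B∼ρ k j y = trans (*ₗ-· c B (vec k j) y)
      (trans (*-congˡ (B∼ρ k j y)) (sym (combination-* c _ (vec k) y)))

    Acts-⊗ : ∀ {B C ρ ρ′} → Acts B ρ → Acts C ρ′ → Acts (B ⊗ C) (λ t → ρ t ⊗ ρ′ t)
    Acts-⊗ {B} {C} {ρ} {ρ′} B∼ρ C∼ρ′ k j y = trans (⊗-· B C (vec k j) y)
      (trans (·-cong B (C∼ρ′ k j) y) (action-combination {B} {ρ ∘ type} B∼ρ k (λ i → ρ′ (type k) (i , j)) y))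

    Acts-combination : ∀ {m} (a : Vector ℂ m) (B : Vector (Matrix n) m) (ρ : Fin m → Rep) →
                       (∀ p → Acts (B p) (ρ p)) → Acts (combination a B) (λ t → combination a (λ p → ρ p t))
    Acts-combination {zero}  a B ρ acts = Acts-0
    Acts-combination {suc m} a B ρ acts = Acts-+ {ρ = λ t → a zero *ₗ ρ zero t}
      {λ t → combination (a ∘ suc) (λ p → ρ (suc p) t)} (Acts-* (a zero) {ρ = ρ zero} (acts zero)) (Acts-combination (a ∘ suc) (B ∘ suc) (ρ ∘ suc) (acts ∘ suc))

    -- The frame spans, so the action on it determines the operator; the entry at `(y , z)` is then
    -- read off from the indicator vector of `z`.
    Acts-unique : ∀ {B C ρ} → Acts B ρ → Acts C ρ → B ≈ᴹ C
    Acts-unique {B} {C} B∼ρ C∼ρ (y , z) = begin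
      B (y , z)      ≈⟨ column B y z ⟨
      (B · δ) y      ≈⟨ agree δ y ⟩
      (C · δ) y      ≈⟨ column C y z ⟩
      C (y , z)      ∎
      where
      δ : V
      δ w = indicator (w Fin.≟ z)

      column : ∀ M y z → sum (λ w → M (y , w) * indicator (w Fin.≟ z)) ≈ M (y , z)
      column M y z = trans (sum-cong λ w → *-comm (M (y , w)) _)
        (sum-indicator (Fin._≟ z) (λ w → M (y , w)) z ≡.refl λ _ eq → eq)

      agree : ∀ v → B · v ≈ᴹ C · v
      agree v y = begin
        (B · v) y                                        ≈⟨ ·-cong B (expand v) y ⟩
        (B · sumᴹ (λ k → component k v)) y               ≈⟨ ·-sumᴹ B (λ k → component k v) y ⟩
        sumᴹ (λ k → B · component k v) y                 ≡⟨ sumᴹ-at (λ k → B · component k v) y ⟩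
        sum (λ k → (B · component k v) y)                ≈⟨ sum-cong (λ k → trans (·-combination B (coord k v) (vec k) y)
          (trans (combination-congʳ (coord k v) (λ j y → trans (B∼ρ k j y) (sym (C∼ρ k j y))) y)
            (sym (·-combination C (coord k v) (vec k) y)))) ⟩
        sum (λ k → (C · component k v) y)                ≡⟨ sumᴹ-at (λ k → C · component k v) y ⟨
        sumᴹ (λ k → C · component k v) y                 ≈⟨ ·-sumᴹ C (λ k → component k v) y ⟨
        (C · sumᴹ (λ k → component k v)) y               ≈⟨ ·-cong C (expand v) y ⟨
        (C · v) y                                        ∎

    Acts-coefficients : ∀ {B C ρ ρ′} → B ≈ᴹ C → Acts B ρ → Acts C ρ′ → ∀ k p → ρ (type k) p ≈ ρ′ (type k) p
    Acts-coefficients {ρ = ρ} {ρ′} B≈C B∼ρ C∼ρ′ k (i , j) = begin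
      ρ (type k) (i , j)                                                 ≈⟨ coord-same k (λ i → ρ (type k) (i , j)) i ⟨
      coord k (combination (λ i → ρ (type k) (i , j)) (vec k)) i         ≈⟨ dot-cong (dual k i) (λ y →
        trans (sym (B∼ρ k j y)) (trans (≈ᴹ-· B≈C (vec k j) y) (C∼ρ′ k j y))) ⟩
      coord k (combination (λ i → ρ′ (type k) (i , j)) (vec k)) i        ≈⟨ coord-same k (λ i → ρ′ (type k) (i , j)) i ⟩
      ρ′ (type k) (i , j)                                                ∎

    coefficients-unique : ∀ k a b → combination a (vec k) ≈ᴹ combination b (vec k) → ∀ j → a j ≈ b j
    coefficients-unique k a b eq j = trans (sym (coord-same k a j)) (trans (dot-cong (dual k j) eq) (coord-same k b j))

    module _ (C : Certificate) where

      open Certificate C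

      E*-combination : ∀ i k a → E* i · combination a (vec k) ≈ᴹ
                       combination (λ j → indicator (lev (type k) j ℕ.≟ i) * a j) (vec k)
      E*-combination i k a y = begin
        (E* i · combination a (vec k)) y
          ≈⟨ ·-combination (E* i) a (vec k) y ⟩
        combination a (λ j → E* i · vec k j) y
          ≡⟨ combination-at a (λ j → E* i · vec k j) y ⟩
        sum (λ j → a j * (E* i · vec k j) y)
          ≈⟨ sum-cong (λ j → trans (*-congˡ (E*-acts i k j y)) (trans (sym (*-assoc (a j) _ _)) (*-congʳ (*-comm (a j) _)))) ⟩
        sum (λ j → indicator (lev (type k) j ℕ.≟ i) * a j * vec k j y)
          ≡⟨ combination-at (λ j → indicator (lev (type k) j ℕ.≟ i) * a j) (vec k) y ⟨
        combination (λ j → indicator (lev (type k) j ℕ.≟ i) * a j) (vec k) y ∎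

      -- Induction over the generation of `T`: the generators act by matrices that depend only on
      -- the type, and every closure operation preserves this. It bounds `dim T` from above.
      T-acts : ∀ {B} → B ∈ T → ∃[ ρ ] Acts B ρ
      T-acts T.A∈T               = adjacency , A-acts
      T-acts (T.E*∈T {i} _)      = (λ t (a , b) → indicator (lev t b ℕ.≟ i) * indicator (a Fin.≟ b)) , λ k j y →
        trans (E*-acts i k j y) (trans (*-congˡ (sym (combination-unit (vec k) j y)))
          (sym (combination-* (indicator (lev (type k) j ℕ.≟ i)) (λ a → indicator (a Fin.≟ j)) (vec k) y)))
      T-acts T.1-closed          = (λ t → identity) , Acts-identity
      T-acts T.0-closed          = (λ t → 0ᴹ) , Acts-0
      T-acts (T.+-closed p q)    = let ρ , B∼ρ = T-acts p ; ρ′ , C∼ρ′ = T-acts q in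
        (λ t → ρ t +ᴹ ρ′ t) , Acts-+ {ρ = ρ} {ρ′} B∼ρ C∼ρ′
      T-acts (T.*-closed c p)    = let ρ , B∼ρ = T-acts p in (λ t → c *ₗ ρ t) , Acts-* c {ρ = ρ} B∼ρ
      T-acts (T.⊗-closed p q)    = let ρ , B∼ρ = T-acts p ; ρ′ , C∼ρ′ = T-acts q in
        (λ t → ρ t ⊗ ρ′ t) , Acts-⊗ {ρ = ρ} {ρ′} B∼ρ C∼ρ′
      T-acts (T.resp-≈ B≈C p)    = let ρ , B∼ρ = T-acts p in ρ , Acts-resp {ρ = ρ} B≈C B∼ρ

      span-isModule : ∀ k → IsModule (Span (vec k))
      span-isModule k = record
        { isSubspace = span-isSubspace (vec k)
        ; closed     = λ {B} B∈T (a , w≈) → let ρ , B∼ρ = T-acts B∈T in ρ (type k) · a , λ y →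
            trans (·-cong B w≈ y) (action-combination {B} {ρ ∘ type} B∼ρ k a y)
        }

      -- A nonzero vector of `W′` has an invertible coefficient `a j`. The unit `(i , j)` sends the
      -- vector to `a j` times the `i`-th basis vector, so `W′` contains every basis vector.
      span-isIrreducible : ∀ k → Fin (size (type k)) → IsIrreducible (Span (vec k))
      span-isIrreducible k i₀ = record
        { isModule = span-isModule k
        ; nonzero  = vec k i₀ , IsBasis.inside (span-basis k) i₀ , vec-nonzero k i₀
        ; minimal  = minimal
        }
        where
        minimal : ∀ W′ → IsModule W′ → Nonzero W′ → W′ ⊆ Span (vec k) → Span (vec k) ⊆ W′
        minimal W′ M (w , w∈ , y , wy#0) W′⊆ =
          let a , w≈  = W′⊆ w∈
              j , ajy = sum-#0 (#0-resp (trans (w≈ y) (reflexive (combination-at a (vec k) y))) wy#0)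
              c , aj  = inverse (*#0ˡ (a j) _ ajy)
          in span-⊆ (vec k) isSubspace λ i → let B , B∈T , ρ , B∼ρ , ρ≈ , _ = unit (type k) i j in
             resp-≈ (λ y → begin
               c * (B · w) y                                          ≈⟨ *-congˡ (trans (·-cong B w≈ y)
                 (action-combination {B} {ρ ∘ type} B∼ρ k a y)) ⟩
               c * combination (ρ (type k) · a) (vec k) y             ≈⟨ combination-* c (ρ (type k) · a) (vec k) y ⟨
               combination (λ i′ → c * (ρ (type k) · a) i′) (vec k) y
                 ≈⟨ combination-cong (vec k) (λ i′ → trans (*-congˡ (row a ρ≈ i′)) (trans (*-congˡ (*-comm _ (a j)))
                      (trans (sym (*-assoc c (a j) _)) (trans (*-congʳ (trans (*-comm c (a j)) aj)) (*-identityˡ _))))) y ⟩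
               combination (λ i′ → indicator (i′ Fin.≟ i)) (vec k) y  ≈⟨ combination-unit (vec k) i y ⟩
               vec k i y                                              ∎)
               (*-closed c (closed B∈T w∈))
          where
          open IsModule M
          open IsSubspace isSubspace
          row : ∀ (a : Vector ℂ (size (type k))) {i j : Fin (size (type k))} {M : Matrix (size (type k))} →
                (∀ i′ j′ → M (i′ , j′) ≈ indicator ((i′ Fin.≟ i) ×-dec (j′ Fin.≟ j))) →
                ∀ i′ → (M · a) i′ ≈ indicator (i′ Fin.≟ i) * a j
          row a {i} {j} {M} M≈ i′ = begin
            sum (λ j′ → M (i′ , j′) * a j′)
              ≈⟨ sum-cong (λ j′ → *-congʳ (trans (M≈ i′ j′) (indicator-× (i′ Fin.≟ i) (j′ Fin.≟ j)))) ⟩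
            sum (λ j′ → indicator (i′ Fin.≟ i) * indicator (j′ Fin.≟ j) * a j′)
              ≈⟨ sum-cong (λ j′ → *-assoc (indicator (i′ Fin.≟ i)) (indicator (j′ Fin.≟ j)) (a j′)) ⟩
            sum (λ j′ → indicator (i′ Fin.≟ i) * (indicator (j′ Fin.≟ j) * a j′))
              ≈⟨ *-distribˡ-sum (indicator (i′ Fin.≟ i)) (λ j′ → indicator (j′ Fin.≟ j) * a j′) ⟨
            indicator (i′ Fin.≟ i) * sum (λ j′ → indicator (j′ Fin.≟ j) * a j′)
              ≈⟨ *-congˡ (sum-indicator (Fin._≟ j) a j ≡.refl λ _ eq → eq) ⟩
            indicator (i′ Fin.≟ i) * a j ∎

      span-≅-same-type : ∀ k l → type k ≡ type l → Span (vec k) ≅ Span (vec l)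
      span-≅-same-type k l eq = transport eq (vec k) (vec l) (coefficients-unique k) (coefficients-unique l)
        (λ {B} {ρ} B∼ρ → action-combination {B} {ρ ∘ type} B∼ρ k) (λ {B} {ρ} B∼ρ → action-combination {B} {ρ ∘ type} B∼ρ l)
        where
        -- The equation between `type k` and `type l` can be matched only after both are replaced by
        -- variables.
        transport : ∀ {t t′} → t ≡ t′ → (u : Vector V (size t)) (w : Vector V (size t′)) →
          (∀ a b → combination a u ≈ᴹ combination b u → ∀ j → a j ≈ b j) →
          (∀ a b → combination a w ≈ᴹ combination b w → ∀ j → a j ≈ b j) →
          (∀ {B ρ} → Acts B ρ → ∀ a → B · combination a u ≈ᴹ combination (ρ t · a) u) →
          (∀ {B ρ} → Acts B ρ → ∀ a → B · combination a w ≈ᴹ combination (ρ t′ · a) w) →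
          Span u ≅ Span w
        transport {t} ≡.refl u w u-unique w-unique on-u on-w = span-≅ u w u-unique w-unique λ B∈T →
          let ρ , B∼ρ = T-acts B∈T in ρ t , on-u {_} {ρ} B∼ρ , on-w {_} {ρ} B∼ρ

      E*-basis : ∀ k i {m} (e : Enumeration (λ j → lev (type k) j ≡ i) m) →
                 IsBasis (E*⟨ i ⟩ (Span (vec k))) (vec k ∘ Enumeration.at e)
      E*-basis k i e = record
        { inside      = λ p → vec k (at p) , IsBasis.inside (span-basis k) (at p) , λ y → sym (trans
            (E*-acts i k (at p) y) (trans (*-congʳ (indicator-yes (_ ℕ.≟ i) (sound p))) (*-identityˡ _)))
        ; spanning    = λ { v (w , (a , w≈) , v≈) → a ∘ at , λ y → begin
            v y                                                                      ≈⟨ v≈ y ⟩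
            (E* i · w) y                                                             ≈⟨ ·-cong (E* i) w≈ y ⟩
            (E* i · combination a (vec k)) y                                         ≈⟨ E*-combination i k a y ⟩
            combination (λ j → indicator (lev (type k) j ℕ.≟ i) * a j) (vec k) y     ≡⟨ combination-at _ (vec k) y ⟩
            sum (λ j → indicator (lev (type k) j ℕ.≟ i) * a j * vec k j y)           ≈⟨ sum-cong (λ j → *-assoc _ (a j) (vec k j y)) ⟩
            sum (λ j → indicator (lev (type k) j ℕ.≟ i) * (a j * vec k j y))
              ≈⟨ sum-enumeration (λ j → lev (type k) j ℕ.≟ i) e (λ j → a j * vec k j y) ⟩
            sum (λ p → a (at p) * vec k (at p) y)                                    ≡⟨ combination-at (a ∘ at) (vec k ∘ at) y ⟨
            combination (a ∘ at) (vec k ∘ at) y                                      ∎ }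
        ; independent = λ b eq p → begin
            b p                                                             ≈⟨ sum-indicator (Fin._≟ p) b p ≡.refl (λ _ eq → eq) ⟨
            sum (λ q → indicator (q Fin.≟ p) * b q)                         ≈⟨ sum-cong (λ q → trans (*-comm _ (b q)) (*-congˡ
              (trans (indicator-⇔ (q Fin.≟ p) (at q Fin.≟ at p) (≡.cong at) injective) (sym (dual-same k (at p) (at q)))))) ⟩
            sum (λ q → b q * dot (dual k (at p)) (vec k (at q)))            ≈⟨ dot-combination (dual k (at p)) b (vec k ∘ at) ⟨
            dot (dual k (at p)) (combination b (vec k ∘ at))                ≈⟨ dot-cong (dual k (at p)) eq ⟩
            dot (dual k (at p)) 0ᴹ                                          ≈⟨ dot-0ᴹ (dual k (at p)) ⟩
            0#                                                              ∎
        }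
        where open Enumeration e

      E*-vec : ∀ k {i} j → lev (type k) j ≡ i → vec k j ≈ᴹ E* i · vec k j
      E*-vec k {i} j eq y = sym (trans (E*-acts i k j y) (trans (*-congʳ (indicator-yes (_ ℕ.≟ i) eq)) (*-identityˡ _)))

      E*-nonzero : ∀ k i → (∃[ j ] lev (type k) j ≡ i) → Nonzero (E*⟨ i ⟩ (Span (vec k)))
      E*-nonzero k i (j , eq) = vec k j , (vec k j , IsBasis.inside (span-basis k) j , E*-vec k j eq) , vec-nonzero k j

      E*-zero : ∀ k i → (∀ j → lev (type k) j ≢ i) → ∀ w → w ∈ Span (vec k) → E* i · w ≈ᴹ 0ᴹ
      E*-zero k i none w (a , w≈) y = trans (·-cong (E* i) w≈ y) (trans (E*-combination i k a y)
        (combination-zero (vec k) (λ j → trans (*-congʳ (indicator-no (_ ℕ.≟ i) (none j))) (zeroˡ (a j))) y))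

      E*-support : ∀ k i → Nonzero (E*⟨ i ⟩ (Span (vec k))) → ∃[ j ] lev (type k) j ≡ i
      E*-support k i (v , (w , w∈ , v≈) , y , vy#0) with Fin.any? (λ j → lev (type k) j ℕ.≟ i)
      ... | yes p = p
      ... | no ¬p = contradiction vy#0 (≈0⇒¬#0 (trans (v≈ y) (E*-zero k i (λ j eq → ¬p (j , eq)) w w∈ y)))

      hasEndpoint : ∀ k j → lev (type k) j ℕ.≤ D → (∀ j′ → lev (type k) j ℕ.≤ lev (type k) j′) →
                    HasEndpoint (Span (vec k)) (lev (type k) j)
      hasEndpoint k j ≤D least = ≤D , E*-nonzero k _ (j , ≡.refl) , λ i i< nz →
        let j′ , eq = E*-support k i nz in ℕ.<⇒≱ i< (ℕ.≤-trans (least j′) (ℕ.≤-reflexive eq))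

      support : ∀ t → Subset (suc D)
      support t = subset (λ i → Fin.any? (λ j → lev t j ℕ.≟ toℕ i))

      hasDiameter : ∀ k δ → ∣ support (type k) ∣ ≡ suc δ → HasDiameter (Span (vec k)) δ
      hasDiameter k δ size≡ = support (type k) , (λ i → let S = ∈-subset (λ i → Fin.any? (λ j → lev (type k) j ℕ.≟ toℕ i)) i in
        mk⇔ (E*-nonzero k (toℕ i) ∘ Equivalence.to S) (Equivalence.from S ∘ E*-support k (toℕ i))) , size≡

      isPureBasis : ∀ k → (∀ j → lev (type k) j ℕ.≤ D) → (∀ i j → i Fin.≤ j → lev (type k) i ℕ.≤ lev (type k) j) →
                    IsPureBasis (Span (vec k)) (vec k)
      isPureBasis k ≤D mono = record
        { isBasis    = span-basis k
        ; support    = lev (type k)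
        ; pure       = λ j → ≤D j , vec-nonzero k j , vec k j , tt , E*-vec k j ≡.refl
        ; increasing = mono _ _
        }

      ≇-of-support : ∀ k l j → lev (type k) j ℕ.≤ D → (∀ j′ → lev (type l) j′ ≢ lev (type k) j) →
                     ¬ Span (vec k) ≅ Span (vec l)
      ≇-of-support k l j ≤D none iso = ≅-transfers-support (span-isModule k) iso ≤D
        (E*-nonzero k _ (j , ≡.refl)) (E*-zero l _ none)

      ≇-of-support′ : ∀ k l j → lev (type l) j ℕ.≤ D → (∀ j′ → lev (type k) j′ ≢ lev (type l) j) →
                      ¬ Span (vec k) ≅ Span (vec l)
      ≇-of-support′ k l j ≤D none iso = let y , vy#0 = vec-nonzero l j in
        ≈0⇒¬#0 (trans (E*-vec l j ≡.refl y)
          (≅-reflects-zero (span-isModule k) iso ≤D (E*-zero k _ none) (vec l j) (IsBasis.inside (span-basis l) j) y)) vy#0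

      isOrthogonalDirectSum : IsOrthogonalDirectSum (λ k → Span (vec k))
      isOrthogonalDirectSum = record
        { decompose  = λ v → (λ k → component k v) , (λ k → coord k v , λ _ → refl) , expand v
        ; unique     = λ w w∈ eq k y → trans (proj₂ (w∈ k) y) (combination-zero (vec k) (λ i → begin
            proj₁ (w∈ k) i                                    ≈⟨ coord-same k (proj₁ (w∈ k)) i ⟨
            coord k (combination (proj₁ (w∈ k)) (vec k)) i    ≈⟨ dot-cong (dual k i) (proj₂ (w∈ k)) ⟨
            coord k (w k) i                                   ≈⟨ coord-sumᴹ w w∈ k i ⟨
            coord k (sumᴹ w) i                                ≈⟨ dot-cong (dual k i) eq ⟩
            dot (dual k i) 0ᴹ                                 ≈⟨ dot-0ᴹ (dual k i) ⟩
            0#                                                ∎) y)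
        ; orthogonal = λ {k} {l} k≢l u v (a , u≈) (b , v≈) → begin
            sum (λ y → u y * conj (v y))
              ≈⟨ sum-cong (λ y → trans (*-cong (u≈ y) (conj-combination l b v≈ y)) (*-comm _ _)) ⟩
            dot (combination (conj ∘ b) (λ j y → conj (vec l j y))) (combination a (vec k))
              ≈⟨ dot-combination _ a (vec k) ⟩
            sum (λ i → a i * dot (combination (conj ∘ b) (λ j y → conj (vec l j y))) (vec k i))
              ≈⟨ sum-zero (λ i → trans (*-congˡ (trans (dot-comm _ (vec k i)) (trans
                   (dot-combination (vec k i) (conj ∘ b) (λ j y → conj (vec l j y)))
                   (sum-zero λ j → trans (*-congˡ (orthogonal k≢l i j)) (zeroʳ _))))) (zeroʳ (a i))) ⟩
            0# ∎
        }
        where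
        dot-comm : ∀ (u v : V) → dot u v ≈ dot v u
        dot-comm u v = sum-cong λ y → *-comm (u y) (v y)

        conj-sum : ∀ {m} (f : Vector ℂ m) → conj (sum f) ≈ sum (conj ∘ f)
        conj-sum {zero}  f = conj-ofℝ _
        conj-sum {suc m} f = trans (conj-homo-+ (f zero) _) (+-congˡ (conj-sum (f ∘ suc)))

        conj-combination : ∀ {v} l b → v ≈ᴹ combination b (vec l) → ∀ y →
                           conj (v y) ≈ combination (conj ∘ b) (λ j y → conj (vec l j y)) y
        conj-combination {v} l b v≈ y = begin
          conj (v y)                                         ≈⟨ conj-cong (trans (v≈ y) (reflexive (combination-at b (vec l) y))) ⟩
          conj (sum (λ j → b j * vec l j y))                 ≈⟨ conj-sum (λ j → b j * vec l j y) ⟩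
          sum (λ j → conj (b j * vec l j y))                 ≈⟨ sum-cong (λ j → conj-homo-* (b j) (vec l j y)) ⟩
          sum (λ j → conj (b j) * conj (vec l j y))          ≡⟨ combination-at (conj ∘ b) _ y ⟨
          combination (conj ∘ b) (λ j y → conj (vec l j y)) y ∎

      module _ {N} (decode : Fin N → Σ[ t ∈ τ ] Fin (size t) × Fin (size t))
               (encode : Σ[ t ∈ τ ] Fin (size t) × Fin (size t) → Fin N)
               (decode-encode : ∀ q → decode (encode q) ≡ q)
               (encode-decode : ∀ p → encode (decode p) ≡ p) where

        private
          U : Vector (Matrix n) N
          U p = let t , i , j = decode p in proj₁ (unit t i j)

          ρU : Fin N → Rep
          ρU p = let t , i , j = decode p in proj₁ (proj₂ (proj₂ (unit t i j)))

          U-acts : ∀ p → Acts (U p) (ρU p)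
          U-acts p = let t , i , j = decode p in proj₁ (proj₂ (proj₂ (proj₂ (unit t i j))))

          U-unit : ∀ p → let t , i , j = decode p in IsUnit t i j (ρU p)
          U-unit p = let t , i , j = decode p in proj₂ (proj₂ (proj₂ (proj₂ (unit t i j))))

          entry : ∀ t i j t′ i′ j′ {ρ} → IsUnit t′ i′ j′ ρ → (t′ , i′ , j′) ≢ (t , i , j) → ρ t (i , j) ≈ 0#
          entry t i j t′ i′ j′ (same , diff) ≢ with t ≟ t′
          ... | no  t≢t′   = diff t t≢t′ (i , j)
          ... | yes ≡.refl = trans (same i j)
            (indicator-no ((i Fin.≟ i′) ×-dec (j Fin.≟ j′)) λ { (≡.refl , ≡.refl) → ≢ ≡.refl })

          -- Every matrix entry of a combination comes from exactly one unit, so entries and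
          -- coefficients are the same data. This gives both spanning and independence of the units.
          entries : ∀ a t i j → combination a (λ p → ρU p t) (i , j) ≈ a (encode (t , i , j))
          entries a t i j = begin
            combination a (λ p → ρU p t) (i , j)
              ≡⟨ combination-at a (λ p → ρU p t) (i , j) ⟩
            sum (λ p → a p * ρU p t (i , j))
              ≈⟨ sum-only (encode (t , i , j)) (λ p p≢ → trans (*-congˡ (entry t i j _ _ _ {ρU p} (U-unit p) λ eq →
                   p≢ (≡.trans (≡.sym (encode-decode p)) (≡.cong encode eq)))) (zeroʳ (a p))) ⟩
            a (encode (t , i , j)) * ρU (encode (t , i , j)) t (i , j)
              ≈⟨ *-congˡ (diagonal (decode-encode (t , i , j)) (U-unit (encode (t , i , j)))) ⟩
            a (encode (t , i , j)) * 1#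
              ≈⟨ trans (*-comm _ 1#) (*-identityˡ _) ⟩
            a (encode (t , i , j)) ∎
            where
            diagonal : ∀ {d ρ} → d ≡ (t , i , j) → IsUnit (proj₁ d) (proj₁ (proj₂ d)) (proj₂ (proj₂ d)) ρ →
                       ρ t (i , j) ≈ 1#
            diagonal ≡.refl (same , _) = trans (same i j) (indicator-yes ((i Fin.≟ i) ×-dec (j Fin.≟ j)) (≡.refl , ≡.refl))

        T-hasDim : HasDim T N
        T-hasDim = U , record
          { inside      = λ p → let t , i , j = decode p in proj₁ (proj₂ (unit t i j))
          ; spanning    = λ B B∈T → let ρ , B∼ρ = T-acts B∈T
                                        a = λ p → let t , i , j = decode p in ρ t (i , j)
                                    in a , Acts-unique {ρ = ρ} B∼ρ
            (Acts-cong {ρ = λ t → combination a (λ p → ρU p t)} (λ t (i , j) → trans (entries a t i j)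
              (reflexive (≡.cong (λ (t , i , j) → ρ t (i , j)) (decode-encode (t , i , j)))))
              (Acts-combination a U ρU U-acts))
          ; independent = λ a eq p → let t , i , j = decode p in begin
              a p                                      ≡⟨ ≡.cong a (encode-decode p) ⟨
              a (encode (t , i , j))                   ≈⟨ entries a t i j ⟨
              combination a (λ p → ρU p t) (i , j)     ≈⟨ vanish a eq t (i , j) ⟩
              0#                                       ∎
          }
          where
          vanish : ∀ a → combination a U ≈ᴹ 0ᴹ → ∀ t q → combination a (λ p → ρU p t) q ≈ 0#
          -- Every type occurs among the summands, so the matrix of type `t` is determined by the
          -- operator.
          vanish a eq t with summand t
          ... | k , ≡.refl = Acts-coefficients {ρ = λ t → combination a (λ p → ρU p t)} {λ t → 0ᴹ} eq
            (Acts-combination a U ρU U-acts) Acts-0 k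

-- Exact computations

total : ∀ {s} → (Fin s → ℕ) → ℕ
total {zero}  m = 0
total {suc s} m = m zero ℕ.+ total (m ∘ suc)

-- `row` and `unrow` identify the disjoint union of the blocks with a single index set, so that
-- duality of families is checked on one pair of tables.
row : ∀ {s} (m : Fin s → ℕ) k → Fin (m k) → Fin (total m)
row m zero    i = i ↑ˡ total (m ∘ suc)
row m (suc k) i = m zero ↑ʳ row (m ∘ suc) k i

unrow : ∀ {s} (m : Fin s → ℕ) → Fin (total m) → Σ[ k ∈ Fin s ] Fin (m k)
unrow {suc s} m r = [ (zero ,_) , (λ r′ → let k , i = unrow (m ∘ suc) r′ in suc k , i) ]′ (splitAt (m zero) r)

unrow-row : ∀ {s} (m : Fin s → ℕ) k i → unrow m (row m k i) ≡ (k , i)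
unrow-row m zero    i rewrite Fin.splitAt-↑ˡ (m zero) i (total (m ∘ suc)) = ≡.refl
unrow-row m (suc k) i rewrite Fin.splitAt-↑ʳ (m zero) (total (m ∘ suc)) (row (m ∘ suc) k i)
  | unrow-row (m ∘ suc) k i = ≡.refl

module Exact (R : RawRing 0ℓ 0ℓ) (_≟_ : DecidableEquality (RawRing.Carrier R)) where

  open RawRing R using (Carrier; _+_; _*_; 0#; +-rawMonoid)
  open RawMonoidDefs +-rawMonoid public using () renaming (sum to ∑)

  Table : ℕ → ℕ → Set
  Table m n = Vec (Vec Carrier n) m

  entry : ∀ {m n} → Table m n → Fin m → Fin n → Carrier
  entry P r = lookup (lookup P r)

  table : ∀ {m n} → (Fin m → Fin n → Carrier) → Table m n
  table f = tabulate (λ r → tabulate (f r))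

  entry-table : ∀ {m n} (f : Fin m → Fin n → Carrier) r u → entry (table f) r u ≡ f r u
  entry-table f r u = ≡.trans (≡.cong (λ v → lookup v u) (Vec.lookup∘tabulate (λ r → tabulate (f r)) r))
    (Vec.lookup∘tabulate (f r) u)

  kronecker : ∀ {n} → Fin n → Fin n → Carrier → Carrier
  kronecker u v d = if does (u Fin.≟ v) then d else 0#

  -- In matrix form `Q Pᵗ = d` and `Pᵗ Q = d`. The factor `d` clears the denominators of the
  -- inverse; checking both products avoids deriving one from the other.
  DualTables : ∀ {m n} → Table m n → Table m n → Carrier → Set
  DualTables P Q d =
    (∀ r c → ∑ (λ u → entry Q r u * entry P c u) ≡ kronecker c r d) ×
    (∀ u v → ∑ (λ r → entry P r u * entry Q r v) ≡ kronecker u v d)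

  dualTables? : ∀ {m n} (P Q : Table m n) d → Dec (DualTables P Q d)
  dualTables? P Q d =
    (Fin.all? λ r → Fin.all? λ c → ∑ (λ u → entry Q r u * entry P c u) ≟ kronecker c r d) ×-dec
    (Fin.all? λ u → Fin.all? λ v → ∑ (λ r → entry P r u * entry Q r v) ≟ kronecker u v d)

  module _ {s n : ℕ} {m : Fin s → ℕ} where

    Family : Set
    Family = ∀ k → Fin (m k) → Fin n → Carrier

    rows : Family → Fin (total m) → Fin n → Carrier
    rows p r = let k , i = unrow m r in p k i

    DualFamilies : Family → Family → Carrier → Set
    DualFamilies p q d = DualTables (table (rows p)) (table (rows q)) d

ℤ[√5] : Set
ℤ[√5] = ℤ × ℤ

ℤ[√5]-rawRing : RawRing 0ℓ 0ℓ
ℤ[√5]-rawRing = record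
  { Carrier = ℤ[√5]
  ; _≈_ = _≡_
  ; _+_ = λ (a , b) (c , d) → a ℤ.+ c , b ℤ.+ d
  ; _*_ = λ (a , b) (c , d) → a ℤ.* c ℤ.+ + 5 ℤ.* (b ℤ.* d) , a ℤ.* d ℤ.+ b ℤ.* c
  ; -_  = λ (a , b) → ℤ.- a , ℤ.- b
  ; 0#  = + 0 , + 0
  ; 1#  = + 1 , + 0
  }

module Zℤ = Exact ℤ.+-*-rawRing ℤ._≟_
module Z√5 = Exact ℤ[√5]-rawRing (Product.≡-dec ℤ._≟_ ℤ._≟_)

types : Vec ModuleType 4
types = I ∷ II ∷ II ∷ III ∷ []

size : ModuleType → ℕ
size I   = 6
size II  = 6
size III = 2

levels : ∀ t → Fin (size t) → ℕ
levels I   = toℕ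
levels II  = lookup (1 ∷ 2 ∷ 2 ∷ 3 ∷ 3 ∷ 4 ∷ [])
levels III = lookup (2 ∷ 3 ∷ [])

matrices : ∀ t → Vec (Vec ℤ (size t)) (size t)
matrices I   = matrix-I
matrices II  = matrix-II
matrices III = matrix-III

adjℤ : (Fin 20 → ℤ) → Fin 20 → ℤ
adjℤ v u = ∑ℤ (λ j → v (nb u j))

restrict : ℕ → (Fin 20 → ℤ) → Fin 20 → ℤ
restrict i v u = if does (level u ℕ.≟ i) then v u else + 0

bases-II : (Fin 20 → ℤ) → Fin 6 → Fin 20 → ℤ
bases-II ν 0F = ν
bases-II ν 1F = adjℤ ν
bases-II ν 2F = restrict 2 (adjℤ (adjℤ ν))
bases-II ν 3F = restrict 3 (adjℤ (adjℤ ν))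
bases-II ν 4F = restrict 3 (adjℤ (adjℤ (adjℤ ν)))
bases-II ν 5F = restrict 4 (adjℤ (adjℤ (adjℤ ν)))

bases-III : (Fin 20 → ℤ) → Fin 2 → Fin 20 → ℤ
bases-III ν 0F = ν
bases-III ν 1F = restrict 3 (adjℤ ν)

-- An admissible ordering fixes ν₂ only up to sign, so the computations are made for both signs.
bases : Sign → ∀ k → Fin (size (lookup types k)) → Fin 20 → ℤ
bases s 0F i   = restrict (toℕ i) (λ _ → + 1)
bases s 1F i   = bases-II (essential seed-IIa inner) i
bases s 2F i   = bases-II (essential seed-IIb inner) i
bases s 3F i   = bases-III (signed s ∘ essential seed-III middle) i

-- 18 times the inverse Gram matrix of each basis.
inverse-grams : ∀ k → Vec (Vec ℤ (size (lookup types k))) (size (lookup types k))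
inverse-grams 0F =
  (+ 18 ∷ + 0 ∷ + 0 ∷ + 0 ∷ + 0 ∷ + 0 ∷ []) ∷
  (+ 0 ∷ + 6 ∷ + 0 ∷ + 0 ∷ + 0 ∷ + 0 ∷ []) ∷
  (+ 0 ∷ + 0 ∷ + 3 ∷ + 0 ∷ + 0 ∷ + 0 ∷ []) ∷
  (+ 0 ∷ + 0 ∷ + 0 ∷ + 3 ∷ + 0 ∷ + 0 ∷ []) ∷
  (+ 0 ∷ + 0 ∷ + 0 ∷ + 0 ∷ + 6 ∷ + 0 ∷ []) ∷
  (+ 0 ∷ + 0 ∷ + 0 ∷ + 0 ∷ + 0 ∷ + 18 ∷ []) ∷ []
inverse-grams 1F = Vec.map (Vec.map (+ 3 ℤ.*_)) (inverse-grams 2F)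
inverse-grams 2F =
  (+ 3 ∷ + 0 ∷ + 0 ∷ + 0 ∷ + 0 ∷ + 0 ∷ []) ∷
  (+ 0 ∷ + 2 ∷ + 1 ∷ + 0 ∷ + 0 ∷ + 0 ∷ []) ∷
  (+ 0 ∷ + 1 ∷ + 2 ∷ + 0 ∷ + 0 ∷ + 0 ∷ []) ∷
  (+ 0 ∷ + 0 ∷ + 0 ∷ + 2 ∷ -[1+ 0 ] ∷ + 0 ∷ []) ∷
  (+ 0 ∷ + 0 ∷ + 0 ∷ -[1+ 0 ] ∷ + 2 ∷ + 0 ∷ []) ∷
  (+ 0 ∷ + 0 ∷ + 0 ∷ + 0 ∷ + 0 ∷ + 3 ∷ []) ∷ []
inverse-grams 3F =
  (+ 3 ∷ + 0 ∷ []) ∷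
  (+ 0 ∷ + 3 ∷ []) ∷ []

-- The summands are orthogonal and the bases real, so the dual of a block is its inverse Gram matrix
-- applied to the block itself. The seeds of the two summands of type II have squared lengths 2 and
-- 6, which makes their Gram matrices differ by the factor 3; 18 is a common denominator of all the
-- inverses.
duals : Sign → ∀ k → Fin (size (lookup types k)) → Fin 20 → ℤ
duals s k i u = ∑ℤ (λ j → lookup (lookup (inverse-grams k) i) j ℤ.* bases s k j u)

all-signs? : {P : Sign → Set} → (∀ s → Dec (P s)) → Dec (∀ s → P s)
all-signs? P? = map′ (λ { (p , q) ⊕ → p ; (p , q) ⊖ → q }) (λ f → f ⊕ , f ⊖) (P? ⊕ ×-dec P? ⊖)

abstract
  bases-duals : ∀ s → Zℤ.DualFamilies (bases s) (duals s) (+ 18)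
  bases-duals ⊕ = decided (Zℤ.dualTables? (Zℤ.table (Zℤ.rows (bases ⊕))) (Zℤ.table (Zℤ.rows (duals ⊕))) (+ 18)) ≡.refl
  bases-duals ⊖ = decided (Zℤ.dualTables? (Zℤ.table (Zℤ.rows (bases ⊖))) (Zℤ.table (Zℤ.rows (duals ⊖))) (+ 18)) ≡.refl

  bases-orthogonal : ∀ s k l → k ≢ l → ∀ i j → ∑ℤ (λ u → bases s k i u ℤ.* bases s l j u) ≡ + 0
  bases-orthogonal = decided (all-signs? λ s → Fin.all? λ k → Fin.all? λ l → ¬? (k Fin.≟ l) →-dec
    (Fin.all? λ i → Fin.all? λ j → ∑ℤ (λ u → bases s k i u ℤ.* bases s l j u) ℤ.≟ + 0)) ≡.refl

  bases-adjacency : ∀ s k j u → adjℤ (bases s k j) u ≡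
    ∑ℤ (λ i → lookup (lookup (matrices (lookup types k)) i) j ℤ.* bases s k i u)
  bases-adjacency = decided (all-signs? λ s → Fin.all? λ k → Fin.all? λ j → Fin.all? λ u →
    adjℤ (bases s k j) u ℤ.≟ ∑ℤ (λ i → lookup (lookup (matrices (lookup types k)) i) j ℤ.* bases s k i u)) ≡.refl

  bases-levels : ∀ s k j u → level u ≢ levels (lookup types k) j → bases s k j u ≡ + 0
  bases-levels = decided (all-signs? λ s → Fin.all? λ k → Fin.all? λ j → Fin.all? λ u →
    ¬? (level u ℕ.≟ levels (lookup types k) j) →-dec (bases s k j u ℤ.≟ + 0)) ≡.refl

_≟ᵗ_ : DecidableEquality ModuleType
I   ≟ᵗ I   = yes ≡.refl
I   ≟ᵗ II  = no λ ()
I   ≟ᵗ III = no λ ()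
II  ≟ᵗ I   = no λ ()
II  ≟ᵗ II  = yes ≡.refl
II  ≟ᵗ III = no λ ()
III ≟ᵗ I   = no λ ()
III ≟ᵗ II  = no λ ()
III ≟ᵗ III = yes ≡.refl

all-types? : {P : ModuleType → Set} → (∀ t → Dec (P t)) → Dec (∀ t → P t)
all-types? P? = map′ (λ { (p , q , r) I → p ; (p , q , r) II → q ; (p , q , r) III → r })
  (λ f → f I , f II , f III) (P? I ×-dec P? II ×-dec P? III)

-- Words for the matrix units, and eigenvector tables

infixl 7 _⊙_
infixl 6 _⊞_
infixr 8 _⊡_

-- Formal elements of `T`, whose matrices on the three types can be computed over ℤ before any
-- complex numbers are involved.
data Word : Set where
  Aʷ      : Word
  Eʷ      : Fin 6 → Word
  _⊙_ _⊞_ : Word → Word → Word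
  _⊡_     : ℤ → Word → Word

_⊗ᵗ_ _+ᵗ_ : ∀ {m} → Zℤ.Table m m → Zℤ.Table m m → Zℤ.Table m m
M ⊗ᵗ N = Zℤ.table λ a b → ∑ℤ (λ c → Zℤ.entry M a c ℤ.* Zℤ.entry N c b)
M +ᵗ N = Zℤ.table λ a b → Zℤ.entry M a b ℤ.+ Zℤ.entry N a b

_*ᵗ_ : ∀ {m} → ℤ → Zℤ.Table m m → Zℤ.Table m m
z *ᵗ M = Zℤ.table λ a b → z ℤ.* Zℤ.entry M a b

action : Word → ∀ t → Zℤ.Table (size t) (size t)
action Aʷ      t = matrices t
action (Eʷ i)  t = Zℤ.table λ a b → if does (levels t b ℕ.≟ toℕ i) then Zℤ.kronecker a b (+ 1) else + 0
action (v ⊙ w) t = action v t ⊗ᵗ action w t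
action (v ⊞ w) t = action v t +ᵗ action w t
action (z ⊡ w) t = z *ᵗ action w t

power : ℕ → Word → Word
power zero    w = w
power (suc k) w = Aʷ ⊙ power k w

powerʳ : ℕ → Word → Word
powerʳ zero    w = w
powerʳ (suc k) w = powerʳ k w ⊙ Aʷ

module _ where
  open import Agda.Builtin.FromNat using (Number; fromNat)
  open import Agda.Builtin.FromNeg using (Negative; fromNeg)
  import Data.Integer.Literals as ℤ-literals
  import Data.Nat.Literals as ℕ-literals

  private instance
    ℕ-number : Number ℕ
    ℕ-number = ℕ-literals.number

    ℤ-number : Number ℤ
    ℤ-number = ℤ-literals.number

    ℤ-negative : Negative ℤ
    ℤ-negative = ℤ-literals.negative

    ℤ[√5]-number : Number ℤ[√5]
    ℤ[√5]-number = record { Constraint = λ _ → ⊤ ; fromNat = λ n → + n , + 0 }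

    ℤ[√5]-negative : Negative ℤ[√5]
    ℤ[√5]-negative = record { Constraint = λ _ → ⊤ ; fromNeg = λ n → ℤ.- (+ n) , + 0 }

  eigenvalues : Vec ℤ[√5] 6
  eigenvalues = 3 ∷ (0 , 1) ∷ 1 ∷ 0 ∷ -2 ∷ (0 , -1) ∷ []

  -- One eigenvector per row, in the order of the eigenvalues in the spectra.
  eigenvectors : ∀ t → Z√5.Table (size t) (size t)
  eigenvectors I =
    ( 1 ∷        1 ∷  1 ∷  1 ∷        1 ∷ 1 ∷ []) ∷
    (-3 ∷ (0 , -1) ∷ -1 ∷  1 ∷  (0 , 1) ∷ 3 ∷ []) ∷
    ( 3 ∷        1 ∷ -1 ∷ -1 ∷        1 ∷ 3 ∷ []) ∷
    (-2 ∷        0 ∷  1 ∷ -1 ∷        0 ∷ 2 ∷ []) ∷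
    ( 6 ∷       -4 ∷  1 ∷  1 ∷       -4 ∷ 6 ∷ []) ∷
    (-3 ∷  (0 , 1) ∷ -1 ∷  1 ∷ (0 , -1) ∷ 3 ∷ []) ∷ []
  eigenvectors II =
    ( 2 ∷  (1 , 1) ∷  2 ∷  2 ∷  (-1 , 1) ∷ 2 ∷ []) ∷
    ( 0 ∷        1 ∷  2 ∷ -2 ∷         1 ∷ 0 ∷ []) ∷
    (-1 ∷       -1 ∷ -1 ∷  1 ∷         0 ∷ 1 ∷ []) ∷
    ( 3 ∷       -1 ∷ -2 ∷ -2 ∷         1 ∷ 3 ∷ []) ∷
    (-1 ∷        1 ∷  0 ∷  0 ∷        -1 ∷ 1 ∷ []) ∷
    ( 2 ∷ (1 , -1) ∷  2 ∷  2 ∷ (-1 , -1) ∷ 2 ∷ []) ∷ []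
  eigenvectors III =
    ( 1 ∷ 1 ∷ []) ∷
    (-1 ∷ 1 ∷ []) ∷ []

  -- 120 times the dual basis of the eigenvectors.
  dual-eigenvectors : ∀ t → Z√5.Table (size t) (size t)
  dual-eigenvectors I =
    (  6 ∷       18 ∷  36 ∷  36 ∷       18 ∷  6 ∷ []) ∷
    ( -6 ∷ (0 , -6) ∷ -12 ∷  12 ∷  (0 , 6) ∷  6 ∷ []) ∷
    ( 10 ∷       10 ∷ -20 ∷ -20 ∷       10 ∷ 10 ∷ []) ∷
    (-12 ∷        0 ∷  36 ∷ -36 ∷        0 ∷ 12 ∷ []) ∷
    (  4 ∷       -8 ∷   4 ∷   4 ∷       -8 ∷  4 ∷ []) ∷
    ( -6 ∷  (0 , 6) ∷ -12 ∷  12 ∷ (0 , -6) ∷  6 ∷ []) ∷ []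
  dual-eigenvectors II =
    (  6 ∷  (0 , 6) ∷ (9 , -3) ∷  (9 , 3) ∷  (0 , 6) ∷  6 ∷ []) ∷
    (-20 ∷      -20 ∷       40 ∷      -20 ∷       20 ∷ 20 ∷ []) ∷
    (-40 ∷      -40 ∷       20 ∷       20 ∷       40 ∷ 40 ∷ []) ∷
    ( 12 ∷        0 ∷      -12 ∷      -12 ∷        0 ∷ 12 ∷ []) ∷
    (-20 ∷       40 ∷      -20 ∷      -20 ∷      -40 ∷ 20 ∷ []) ∷
    (  6 ∷ (0 , -6) ∷  (9 , 3) ∷ (9 , -3) ∷ (0 , -6) ∷  6 ∷ []) ∷ []
  dual-eigenvectors III =
    ( 60 ∷ 60 ∷ []) ∷
    (-60 ∷ 60 ∷ []) ∷ []

  -- These act as 3 and -6 times the matrix unit (0 , 0) of type II and III.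
  core-II core-III : Word
  core-II  = 3 ⊡ Eʷ 1F ⊞ -1 ⊡ (Eʷ 1F ⊙ Aʷ ⊙ Eʷ 0F ⊙ Aʷ ⊙ Eʷ 1F)
  core-III = Z ⊙ Aʷ ⊙ Z ⊞ Z
    where
    Z : Word
    Z = Eʷ 2F ⊙ Aʷ ⊙ Eʷ 1F ⊙ Aʷ ⊙ Eʷ 2F ⊞ -2 ⊡ Eʷ 2F

  -- Up to a factor, each basis vector arises from the first by a power of `A` followed by some
  -- `E*`. The same words, applied after a multiple of the unit `(0 , 0)`, give multiples of the
  -- units `(i , 0)`; for type I that starting word is `Eʷ 0F`.
  column : ∀ t → Fin (size t) → Word
  column I   i  = Eʷ i ⊙ power (toℕ i) (Eʷ 0F)
  column II  0F = core-II
  column II  1F = Eʷ 2F ⊙ power 1 core-II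
  column II  2F = Eʷ 2F ⊙ power 2 core-II
  column II  3F = Eʷ 3F ⊙ power 2 core-II
  column II  4F = Eʷ 3F ⊙ power 3 core-II
  column II  5F = Eʷ 4F ⊙ power 3 core-II
  column III 0F = core-III
  column III 1F = Eʷ 3F ⊙ Aʷ ⊙ core-III

  -- For type II, these combinations isolate one entry of the first row of
  -- matrix-II or of its powers.
  row-word : ∀ t → Fin (size t) → Word
  row-word I   j  = powerʳ (toℕ j) (Eʷ 0F) ⊙ Eʷ j
  row-word II  0F = core-II
  row-word II  1F = (2 ⊡ powerʳ 1 core-II ⊞ powerʳ 2 core-II) ⊙ Eʷ 2F
  row-word II  2F = (powerʳ 1 core-II ⊞ 2 ⊡ powerʳ 2 core-II) ⊙ Eʷ 2F
  row-word II  3F = (2 ⊡ powerʳ 2 core-II ⊞ -1 ⊡ powerʳ 3 core-II) ⊙ Eʷ 3F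
  row-word II  4F = (-1 ⊡ powerʳ 2 core-II ⊞ 2 ⊡ powerʳ 3 core-II) ⊙ Eʷ 3F
  row-word II  5F = powerʳ 3 core-II ⊙ Eʷ 4F
  row-word III 0F = core-III
  row-word III 1F = core-III ⊙ Aʷ ⊙ Eʷ 3F

-- A multiple of the unit `(i , 0)` times one of `(0 , j)`.
unit-word : ∀ t → Fin (size t) → Fin (size t) → Word
unit-word t i j = column t i ⊙ row-word t j

UnitAt : ∀ {m} → Fin m → Fin m → Zℤ.Table m m → Set
UnitAt i j M = Σ[ z ∈ ℤ ] z ≢ + 0 ×
  (∀ a b → Zℤ.entry M a b ≡ (if does ((a Fin.≟ i) ×-dec (b Fin.≟ j)) then z else + 0))

Vanishes : ∀ {m} → Zℤ.Table m m → Set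
Vanishes M = ∀ a b → Zℤ.entry M a b ≡ + 0

vanishes? : ∀ {m} (M : Zℤ.Table m m) → Dec (Vanishes M)
vanishes? M = Fin.all? λ a → Fin.all? λ b → Zℤ.entry M a b ℤ.≟ + 0

-- The factor `z` can only be the entry at `(i , j)`, which turns the existential over ℤ into a
-- finite check.
unitAt? : ∀ {m} (i j : Fin m) (M : Zℤ.Table m m) → Dec (UnitAt i j M)
unitAt? i j M = map′ (Zℤ.entry M i j ,_) forget
  (¬? (Zℤ.entry M i j ℤ.≟ + 0) ×-dec
   (Fin.all? λ a → Fin.all? λ b → Zℤ.entry M a b ℤ.≟
     (if does ((a Fin.≟ i) ×-dec (b Fin.≟ j)) then Zℤ.entry M i j else + 0)))
  where
  yes-if : ∀ {P : Set} (P? : Dec P) {z} → P → (if does P? then z else + 0) ≡ z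
  yes-if (yes _) _ = ≡.refl
  yes-if (no ¬p) p = contradiction p ¬p

  forget : UnitAt i j M → _
  forget (z , z≢0 , same) with ≡.trans (same i j) (yes-if ((i Fin.≟ i) ×-dec (j Fin.≟ j)) (≡.refl , ≡.refl))
  ... | ≡.refl = z≢0 , same

abstract
  unit-words : ∀ t i j → UnitAt i j (action (unit-word t i j) t) ×
               (∀ t′ → t′ ≢ t → Vanishes (action (unit-word t i j) t′))
  unit-words = decided (all-types? λ t → Fin.all? λ i → Fin.all? λ j →
    unitAt? i j (action (unit-word t i j) t) ×-dec
    (all-types? λ t′ → ¬? (t′ ≟ᵗ t) →-dec vanishes? (action (unit-word t i j) t′))) ≡.refl

-- Spectra over ℤ[√5]

integral : ℤ → ℤ[√5]
integral i = i , + 0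

open RawRing ℤ[√5]-rawRing using () renaming (_+_ to _+√_; _*_ to _*√_; -_ to -√_)

norm : ℤ[√5] → ℤ
norm (a , b) = a ℤ.* a ℤ.+ ℤ.- (+ 5 ℤ.* (b ℤ.* b))

values : (t : ModuleType) → ∃ (Vec ℤ[√5])
values I   = _ , eigenvalues
values II  = _ , Vec.tail eigenvalues
values III = _ , lookup eigenvalues 3F ∷ lookup eigenvalues 4F ∷ []

multiplicities : ∀ t → Fin (proj₁ (values t)) → ℕ
multiplicities I   = λ _ → 1
multiplicities II  = lookup (1 ∷ 2 ∷ 1 ∷ 1 ∷ 1 ∷ [])
multiplicities III = λ _ → 1

graph-multiplicities : Fin 6 → ℕ
graph-multiplicities = lookup (1 ∷ 3 ∷ 5 ∷ 4 ∷ 4 ∷ 3 ∷ [])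

-- The pair (k , c) stands for the c-th eigenvector of type k, expanded in the
-- basis of the summand k.
graph-eigenvectors : Vec (Σ[ k ∈ Fin 4 ] Fin (size (lookup types k))) 20
graph-eigenvectors =
  (0F , 0F) ∷
  (0F , 1F) ∷ (1F , 0F) ∷ (2F , 0F) ∷
  (0F , 2F) ∷ (1F , 1F) ∷ (1F , 2F) ∷ (2F , 1F) ∷ (2F , 2F) ∷
  (0F , 3F) ∷ (1F , 3F) ∷ (2F , 3F) ∷ (3F , 0F) ∷
  (0F , 4F) ∷ (1F , 4F) ∷ (2F , 4F) ∷ (3F , 1F) ∷
  (0F , 5F) ∷ (1F , 5F) ∷ (2F , 5F) ∷ []

expand√ : (∀ t → Z√5.Table (size t) (size t)) → (∀ k → Fin (size (lookup types k)) → Fin 20 → ℤ) → Z√5.Table 20 20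
expand√ S p = Z√5.table λ r u → let k , c = lookup graph-eigenvectors r in
  Z√5.∑ (λ j → Z√5.entry (S (lookup types k)) c j *√ integral (p k j u))

-- `A` acts on each summand through the matrix of its type, so eigenvectors of the small matrices
-- expand to eigenvectors of `A`. Expanding the dual tables in the dual bases multiplies the
-- factors: 120 · 18 = 2160.
graph-basis graph-dual : Z√5.Table 20 20
graph-basis = expand√ eigenvectors (bases ⊕)
graph-dual  = expand√ dual-eigenvectors (duals ⊕)

EigenRows : ∀ {s} (m : Fin s → ℕ) {n} → Vec ℤ[√5] s → ((Fin n → ℤ[√5]) → Fin n → ℤ[√5]) → Z√5.Table (total m) n → Set
EigenRows m z f P = ∀ k i u → f (Z√5.entry P (row m k i)) u ≡ lookup z k *√ Z√5.entry P (row m k i) u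

eigenRows? : ∀ {s} (m : Fin s → ℕ) {n} (z : Vec ℤ[√5] s) f (P : Z√5.Table (total m) n) → Dec (EigenRows m z f P)
eigenRows? m z f P = Fin.all? λ k → Fin.all? λ i → Fin.all? λ u → Product.≡-dec ℤ._≟_ ℤ._≟_
  (f (Z√5.entry P (row m k i)) u) (lookup z k *√ Z√5.entry P (row m k i) u)

apply√ : ∀ {n} → Vec (Vec ℤ n) n → (Fin n → ℤ[√5]) → Fin n → ℤ[√5]
apply√ M v u = Z√5.∑ (λ w → integral (lookup (lookup M u) w) *√ v w)

adj√ : (Fin 20 → ℤ[√5]) → Fin 20 → ℤ[√5]
adj√ v u = Z√5.∑ (λ j → v (nb u j))

-- Stated through the norm because a nonzero integer becomes apart from 0 in ℂ, and this passes to
-- the factors of the norm.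
Distinct : ∀ {s} → Vec ℤ[√5] s → Set
Distinct z = ∀ k l → k ≢ l → norm (lookup z k +√ -√ lookup z l) ≢ + 0

distinct? : ∀ {s} (z : Vec ℤ[√5] s) → Dec (Distinct z)
distinct? z = Fin.all? λ k → Fin.all? λ l → ¬? (k Fin.≟ l) →-dec
  ¬? (norm (lookup z k +√ -√ lookup z l) ℤ.≟ + 0)

-- `total (multiplicities t)` computes to `size t` only for closed t.
record SmallSpectrum (t : ModuleType) : Set where
  field
    basis dual : Z√5.Table (total (multiplicities t)) (size t)
    dual-basis : Z√5.DualTables basis dual (integral (+ 120))
    distinct   : Distinct (proj₂ (values t))
    eigen      : EigenRows (multiplicities t) (proj₂ (values t)) (apply√ (matrices t)) basis

abstract
  small-spectrum : ∀ t → SmallSpectrum t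
  small-spectrum I   = record
    { basis = eigenvectors I ; dual = dual-eigenvectors I
    ; dual-basis = decided (Z√5.dualTables? (eigenvectors I) (dual-eigenvectors I) (integral (+ 120))) ≡.refl
    ; distinct = decided (distinct? (proj₂ (values I))) ≡.refl
    ; eigen = decided (eigenRows? (multiplicities I) eigenvalues (apply√ matrix-I) (eigenvectors I)) ≡.refl }
  small-spectrum II  = record
    { basis = eigenvectors II ; dual = dual-eigenvectors II
    ; dual-basis = decided (Z√5.dualTables? (eigenvectors II) (dual-eigenvectors II) (integral (+ 120))) ≡.refl
    ; distinct = decided (distinct? (proj₂ (values II))) ≡.refl
    ; eigen = decided (eigenRows? (multiplicities II) (Vec.tail eigenvalues) (apply√ matrix-II) (eigenvectors II)) ≡.refl }
  small-spectrum III = record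
    { basis = eigenvectors III ; dual = dual-eigenvectors III
    ; dual-basis = decided (Z√5.dualTables? (eigenvectors III) (dual-eigenvectors III) (integral (+ 120))) ≡.refl
    ; distinct = decided (distinct? (proj₂ (values III))) ≡.refl
    ; eigen = decided (eigenRows? (multiplicities III) (proj₂ (values III)) (apply√ matrix-III) (eigenvectors III)) ≡.refl }

  graph-dual-basis : Z√5.DualTables graph-basis graph-dual (integral (+ 2160))
  graph-dual-basis = decided (Z√5.dualTables? graph-basis graph-dual (integral (+ 2160))) ≡.refl

  graph-eigen : EigenRows graph-multiplicities eigenvalues adj√ graph-basis
  graph-eigen = decided (eigenRows? graph-multiplicities eigenvalues adj√ graph-basis) ≡.refl

  eigenvalues-distinct : Distinct eigenvalues
  eigenvalues-distinct = decided (distinct? eigenvalues) ≡.refl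

-- From exact computations to ℂ

row-injective : ∀ {s} (m : Fin s → ℕ) {k l i j} → row m k i ≡ row m l j → _≡_ {A = Σ[ k ∈ Fin s ] Fin (m k)} (k , i) (l , j)
row-injective m {k} {l} {i} {j} eq = ≡.trans (≡.sym (unrow-row m k i)) (≡.trans (≡.cong (unrow m) eq) (unrow-row m l j))

module Lifting (ℜ : RealNumbers) where

  open Sums ℜ
  open Spectra ℜ
  open Algebra.Properties.Semiring.Sum semiring using (∑-permute)

  sum-↑ : ∀ m {n} (f : Vector ℂ (m ℕ.+ n)) → sum f ≈ sum (λ i → f (i ↑ˡ n)) + sum (λ i → f (m ↑ʳ i))
  sum-↑ zero    f = sym (+-identityˡ (sum f))
  sum-↑ (suc m) f = trans (+-congˡ (sum-↑ m (f ∘ suc))) (sym (+-assoc (f zero) _ _))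

  sum-rows : ∀ {s} (m : Fin s → ℕ) (f : Vector ℂ (total m)) → sum (λ k → sum (λ i → f (row m k i))) ≈ sum f
  sum-rows {zero}  m f = refl
  sum-rows {suc s} m f = trans (+-congˡ (sum-rows (m ∘ suc) (f ∘ (m zero ↑ʳ_)))) (sym (sum-↑ (m zero) f))

  module Lift (R : RawRing 0ℓ 0ℓ) (_≟_ : DecidableEquality (RawRing.Carrier R))
    (h : RawRing.Carrier R → ℂ)
    (h-0 : h (RawRing.0# R) ≈ 0#)
    (h-+ : ∀ x y → h (RawRing._+_ R x y) ≈ h x + h y)
    (h-* : ∀ x y → h (RawRing._*_ R x y) ≈ h x * h y)
    where

    open Exact R _≟_
    open RawRing R using (Carrier) renaming (_+_ to _+′_; _*_ to _*′_; 0# to 0′)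

    h-∑ : ∀ {k} (f : Vector Carrier k) → h (∑ f) ≈ sum (h ∘ f)
    h-∑ {zero}  f = h-0
    h-∑ {suc k} f = trans (h-+ (f zero) _) (+-congˡ (h-∑ (f ∘ suc)))

    h-∑-* : ∀ {k} (f g : Vector Carrier k) → h (∑ λ j → f j *′ g j) ≈ sum (λ j → h (f j) * h (g j))
    h-∑-* f g = trans (h-∑ (λ j → f j *′ g j)) (sum-cong λ j → h-* (f j) (g j))

    h-kronecker : ∀ {n} {P : Set} (P? : Dec P) {d w} (u v : Fin n) → (u ≡ v → P) → (P → u ≡ v) → h d * w ≈ 1# →
                  w * h (kronecker u v d) ≈ indicator P?
    h-kronecker P? {d} {w} u v to from dw≈1 with u Fin.≟ v
    ... | yes u≡v = trans (*-comm w (h d)) (trans dw≈1 (sym (indicator-yes P? (to u≡v))))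
    ... | no  u≢v = trans (*-congˡ h-0) (trans (zeroʳ w) (sym (indicator-no P? (u≢v ∘ from))))

    module _ {N n} (φ : Fin N → Fin n) (ψ : Fin n → Fin N)
             (φψ : ∀ y → φ (ψ y) ≡ y) (ψφ : ∀ u → ψ (φ u) ≡ u) where

      -- Read in the labels, `v` is the image of the exact vector `p`.
      Lifts : Vector ℂ n → (Fin N → Carrier) → Set
      Lifts v p = ∀ u → v (φ u) ≈ h (p u)

      sum-φ : (f : Vector ℂ n) → sum f ≈ sum (f ∘ φ)
      sum-φ f = ∑-permute f (Permutation.permutation φ ψ
        φψ ψφ)

      lifts-≈ : ∀ {v w p} → Lifts v p → Lifts w p → v ≈ᴹ w
      lifts-≈ {v} {w} v↑ w↑ y = ≡.subst (λ y → v y ≈ w y) (φψ y) (trans (v↑ (ψ y)) (sym (w↑ (ψ y))))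

      dot-lift : ∀ {v w p q} → Lifts v p → Lifts w q → dot v w ≈ h (∑ λ u → p u *′ q u)
      dot-lift {v} {w} {p} {q} v↑ w↑ = trans (sum-φ (λ y → v y * w y))
        (trans (sum-cong λ u → *-cong (v↑ u) (w↑ u)) (sym (h-∑-* p q)))

      combination-lift : ∀ {k} (a : Vector Carrier k) {v : Fin k → Vector ℂ n} {p : Fin k → Fin N → Carrier} → (∀ j → Lifts (v j) (p j)) →
                         Lifts (combination (h ∘ a) v) (λ u → ∑ λ j → a j *′ p j u)
      combination-lift a {v} {p} v↑ u = trans (reflexive (combination-at (h ∘ a) v (φ u)))
        (trans (sum-cong λ j → *-congˡ (v↑ j u)) (sym (h-∑-* a (λ j → p j u))))

      module _ {s} (m : Fin s → ℕ) (P Q : Table (total m) N) {d} (PQ : DualTables P Q d) (hd#0 : h d # 0#)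
               (vec : ∀ k → Fin (m k) → Vector ℂ n)
               (vec↑ : ∀ k i → Lifts (vec k i) (entry P (row m k i))) where

        private
          w : ℂ
          w = proj₁ (inverse hd#0)

          dw : h d * w ≈ 1#
          dw = proj₂ (inverse hd#0)

          dual : ∀ k → Fin (m k) → Vector ℂ n
          dual k i y = w * h (entry Q (row m k i) (ψ y))

          dual-dot : ∀ k i l j → dot (dual k i) (vec l j) ≈ w * h (kronecker (row m l j) (row m k i) d)
          dual-dot k i l j = begin
            sum (λ y → w * h (q (ψ y)) * vec l j y)        ≈⟨ sum-cong (λ y → *-assoc w (h (q (ψ y))) (vec l j y)) ⟩
            sum (λ y → w * (h (q (ψ y)) * vec l j y))      ≈⟨ *-distribˡ-sum w (λ y → h (q (ψ y)) * vec l j y) ⟨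
            w * dot (λ y → h (q (ψ y))) (vec l j)          ≈⟨ *-congˡ (dot-lift {p = q}
              (λ u → reflexive (≡.cong (h ∘ q) (ψφ u))) (vec↑ l j)) ⟩
            w * h (∑ λ u → q u *′ entry P (row m l j) u)   ≡⟨ ≡.cong (λ x → w * h x) (proj₁ PQ (row m k i) (row m l j)) ⟩
            w * h (kronecker (row m l j) (row m k i) d)    ∎
            where
            q : Fin N → Carrier
            q = entry Q (row m k i)

        -- The rows of `Q` are divided by `d`, which is invertible only after passing to ℂ.
        lift-frame : Frame n m
        lift-frame = record
          { vec        = vec
          ; dual       = dual
          ; dual-same  = λ k i j → trans (dual-dot k i k j)
              (h-kronecker (j Fin.≟ i) (row m k j) (row m k i) (same k) (≡.cong (row m k)) dw)
          ; dual-diff  = λ {k} {l} k≢l i j → trans (dual-dot k i l j)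
              (trans (*-congˡ (trans (reflexive (≡.cong h (off (row m l j) (row m k i) (k≢l ∘ ≡.sym ∘ ≡.cong proj₁ ∘ row-injective m {l} {k} {j} {i})))) h-0))
                (zeroʳ w))
          ; resolution = λ y z → begin
              sum (λ k → sum (λ i → vec k i y * dual k i z))
                ≈⟨ sum-cong (λ k → sum-cong λ i → trans (*-congʳ (at-y k i y)) (swap _ w _)) ⟩
              sum (λ k → sum (λ i → w * (h (entry P (row m k i) (ψ y)) * h (entry Q (row m k i) (ψ z)))))
                ≈⟨ sum-rows m (λ r → w * (h (entry P r (ψ y)) * h (entry Q r (ψ z)))) ⟩
              sum (λ r → w * (h (entry P r (ψ y)) * h (entry Q r (ψ z))))
                ≈⟨ *-distribˡ-sum w (λ r → h (entry P r (ψ y)) * h (entry Q r (ψ z))) ⟨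
              w * sum (λ r → h (entry P r (ψ y)) * h (entry Q r (ψ z)))
                ≈⟨ *-congˡ (h-∑-* (λ r → entry P r (ψ y)) (λ r → entry Q r (ψ z))) ⟨
              w * h (∑ λ r → entry P r (ψ y) *′ entry Q r (ψ z))
                ≡⟨ ≡.cong (λ x → w * h x) (proj₂ PQ (ψ y) (ψ z)) ⟩
              w * h (kronecker (ψ y) (ψ z) d)
                ≈⟨ h-kronecker (y Fin.≟ z) (ψ y) (ψ z) (λ eq → ≡.trans (≡.sym (φψ y)) (≡.trans (≡.cong φ eq) (φψ z)))
                     (≡.cong ψ) dw ⟩
              indicator (y Fin.≟ z) ∎
          }
          where
          same : ∀ k {i j} → row m k j ≡ row m k i → j ≡ i
          same k {i} {j} eq = injectiveʳ (row-injective m {k} {k} {j} {i} eq)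
            where
            injectiveʳ : _≡_ {A = Σ[ k ∈ Fin s ] Fin (m k)} (k , j) (k , i) → j ≡ i
            injectiveʳ ≡.refl = ≡.refl

          off : ∀ {k} (u v : Fin k) → u ≢ v → kronecker u v d ≡ 0′
          off u v u≢v with u Fin.≟ v
          ... | yes u≡v = contradiction u≡v u≢v
          ... | no _    = ≡.refl

          at-y : ∀ k i y → vec k i y ≈ h (entry P (row m k i) (ψ y))
          at-y k i y = ≡.subst (λ z → vec k i z ≈ h (entry P (row m k i) (ψ y))) (φψ y) (vec↑ k i (ψ y))

          swap : ∀ x y z → x * (y * z) ≈ y * (x * z)
          swap x y z = trans (sym (*-assoc x y z)) (trans (*-congʳ (*-comm x y)) (*-assoc y x z))

  module Lℤ = Lift ℤ.+-*-rawRing ℤ._≟_ ofℤ refl ofℤ-homo-+ ofℤ-homo-*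

  module Root (√5 : ℝ) (√5-sqrt : RealNumbers.IsSqrt ℜ (RealNumbers.fromℕ ℜ 5) √5) where

    open Integers.Solver commutativeRing using (solve; _:+_; _:*_; :-_; _:=_)

    ev : ℤ[√5] → ℂ
    ev (a , b) = ofℤ a + ofℤ b * ofℝ √5

    ofℤ-5 : ofℝ √5 * ofℝ √5 ≈ ofℤ (+ 5)
    ofℤ-5 = trans (sym (ofℝ-homo-* √5 √5)) (ofℝ-cong (proj₂ √5-sqrt))

    ev-integral : ∀ i → ev (integral i) ≈ ofℤ i
    ev-integral i = trans (+-congˡ (zeroˡ (ofℝ √5))) (+-identityʳ (ofℤ i))

    ev-+ : ∀ x y → ev (x +√ y) ≈ ev x + ev y
    ev-+ (a , b) (c , d) = trans (+-cong (ofℤ-homo-+ a c) (*-congʳ (ofℤ-homo-+ b d)))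
      (solve 5 (λ a b c d r → (a :+ c) :+ (b :+ d) :* r := (a :+ b :* r) :+ (c :+ d :* r)) refl
        (ofℤ a) (ofℤ b) (ofℤ c) (ofℤ d) (ofℝ √5))

    ev-* : ∀ x y → ev (x *√ y) ≈ ev x * ev y
    ev-* (a , b) (c , d) = begin
      ofℤ (a ℤ.* c ℤ.+ + 5 ℤ.* (b ℤ.* d)) + ofℤ (a ℤ.* d ℤ.+ b ℤ.* c) * r
        ≈⟨ +-cong (trans (ofℤ-homo-+ (a ℤ.* c) (+ 5 ℤ.* (b ℤ.* d))) (+-cong (ofℤ-homo-* a c) (trans (ofℤ-homo-* (+ 5) (b ℤ.* d))
             (*-cong (sym ofℤ-5) (ofℤ-homo-* b d))))) (*-congʳ (trans (ofℤ-homo-+ (a ℤ.* d) (b ℤ.* c)) (+-cong (ofℤ-homo-* a d) (ofℤ-homo-* b c)))) ⟩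
      ofℤ a * ofℤ c + r * r * (ofℤ b * ofℤ d) + (ofℤ a * ofℤ d + ofℤ b * ofℤ c) * r
        ≈⟨ solve 5 (λ a b c d r → a :* c :+ r :* r :* (b :* d) :+ (a :* d :+ b :* c) :* r := (a :+ b :* r) :* (c :+ d :* r))
             refl (ofℤ a) (ofℤ b) (ofℤ c) (ofℤ d) r ⟩
      (ofℤ a + ofℤ b * r) * (ofℤ c + ofℤ d * r) ∎
      where r = ofℝ √5

    ofℤ-neg : ∀ i → ofℤ (ℤ.- i) ≈ - ofℤ i
    ofℤ-neg i = -≈0⇒≈ (ofℤ (ℤ.- i)) (- ofℤ i) (begin
      ofℤ (ℤ.- i) - (- ofℤ i)    ≈⟨ solve 2 (λ a b → a :+ :- (:- b) := a :+ b) refl (ofℤ (ℤ.- i)) (ofℤ i) ⟩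
      ofℤ (ℤ.- i) + ofℤ i        ≈⟨ ofℤ-homo-+ (ℤ.- i) i ⟨
      ofℤ (ℤ.- i ℤ.+ i)          ≡⟨ ≡.cong ofℤ (ℤ.+-inverseˡ i) ⟩
      0#                         ∎)

    ev-neg : ∀ x → ev (-√ x) ≈ - ev x
    ev-neg (a , b) = trans (+-cong (ofℤ-neg a) (*-congʳ (ofℤ-neg b)))
      (solve 3 (λ a b r → :- a :+ :- b :* r := :- (a :+ b :* r)) refl (ofℤ a) (ofℤ b) (ofℝ √5))

    -- (a + b√5) (a − b√5) is the norm.
    ev-#0 : ∀ x → norm x ≢ + 0 → ev x # 0#
    ev-#0 x@(a , b) norm≢0 = *#0ˡ (ev x) (ev (a , ℤ.- b)) (#0-resp (sym (begin
      ev x * ev (a , ℤ.- b)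
        ≈⟨ *-congˡ (+-congˡ (*-congʳ (ofℤ-neg b))) ⟩
      (ofℤ a + ofℤ b * r) * (ofℤ a + - ofℤ b * r)
        ≈⟨ solve 3 (λ a b r → (a :+ b :* r) :* (a :+ :- b :* r) := a :* a :+ :- (r :* r :* (b :* b))) refl (ofℤ a) (ofℤ b) r ⟩
      ofℤ a * ofℤ a + - (r * r * (ofℤ b * ofℤ b))
        ≈⟨ +-cong (ofℤ-homo-* a a) (trans (ofℤ-neg (+ 5 ℤ.* (b ℤ.* b))) (-‿cong (trans (ofℤ-homo-* (+ 5) (b ℤ.* b))
             (*-cong (sym ofℤ-5) (ofℤ-homo-* b b))))) ⟨
      ofℤ (a ℤ.* a) + ofℤ (ℤ.- (+ 5 ℤ.* (b ℤ.* b)))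
        ≈⟨ ofℤ-homo-+ (a ℤ.* a) (ℤ.- (+ 5 ℤ.* (b ℤ.* b))) ⟨
      ofℤ (norm x) ∎)) (ofℤ#0 norm≢0))
      where r = ofℝ √5

    module L√ = Lift ℤ[√5]-rawRing (Product.≡-dec ℤ._≟_ ℤ._≟_) ev (ev-integral (+ 0)) ev-+ ev-*

    -- The eigenvalues as the spectra list them; they agree with `ev` of the exact ones only up to
    -- `≈`.
    θs : Vec ℂ 6
    θs = ofℤ (+ 3) ∷ ofℝ √5 ∷ ofℤ (+ 1) ∷ ofℤ (+ 0) ∷ ofℤ -[1+ 1 ] ∷ - ofℝ √5 ∷ []

    θs-ev : ∀ k → lookup θs k ≈ ev (lookup eigenvalues k)
    θs-ev 0F = sym (ev-integral (+ 3))
    θs-ev 1F = sym (trans (+-identityˡ _) (trans (*-congʳ ofℤ-1) (*-identityˡ (ofℝ √5))))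
    θs-ev 2F = sym (ev-integral (+ 1))
    θs-ev 3F = sym (ev-integral (+ 0))
    θs-ev 4F = sym (ev-integral -[1+ 1 ])
    θs-ev 5F = trans (-‿cong (θs-ev 1F)) (sym (ev-neg (+ 0 , + 1)))

    θs-of : ∀ t → Vec ℂ (proj₁ (values t))
    θs-of I   = θs
    θs-of II  = Vec.tail θs
    θs-of III = lookup θs 3F ∷ lookup θs 4F ∷ []

    θs-of-ev : ∀ t k → lookup (θs-of t) k ≈ ev (lookup (proj₂ (values t)) k)
    θs-of-ev I   k  = θs-ev k
    θs-of-ev II  k  = θs-ev (suc k)
    θs-of-ev III 0F = θs-ev 3F
    θs-of-ev III 1F = θs-ev 4F

    apart : ∀ {s} (z : Vec ℤ[√5] s) (θ : Vec ℂ s) → (∀ k → lookup θ k ≈ ev (lookup z k)) → Distinct z →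
            ∀ k l → k ≢ l → lookup θ k - lookup θ l # 0#
    apart z θ θ≈ distinct k l k≢l = #0-resp
      (trans (ev-+ (lookup z k) (-√ lookup z l)) (sym (+-cong (θ≈ k) (trans (-‿cong (θ≈ l)) (sym (ev-neg (lookup z l)))))))
      (ev-#0 (lookup z k +√ -√ lookup z l) (distinct k l k≢l))

    small-hasSpectrum : ∀ t → sum-ℕ (List.map proj₂ (List.tabulate λ k → lookup (θs-of t) k , multiplicities t k)) ≡ size t →
      HasSpectrum (ofℤ-matrix (matrices t)) (List.tabulate λ k → lookup (θs-of t) k , multiplicities t k)
    small-hasSpectrum t = hasSpectrum (ofℤ-matrix (matrices t)) (lookup (θs-of t)) (multiplicities t) frame
      eigenframe (apart (proj₂ (values t)) (θs-of t) (θs-of-ev t) distinct)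
      where
      open SmallSpectrum (small-spectrum t)
      vec : ∀ k → Fin (multiplicities t k) → Vector ℂ (size t)
      vec k i u = ev (Z√5.entry basis (row (multiplicities t) k i) u)

      frame : Frame (size t) (multiplicities t)
      frame = L√.lift-frame id id (λ _ → ≡.refl) (λ _ → ≡.refl) (multiplicities t) basis dual dual-basis
        (ev-#0 (integral (+ 120)) λ ()) vec (λ k i u → refl)

      eigenframe : ∀ k i → ofℤ-matrix (matrices t) · vec k i ≈ᴹ lookup (θs-of t) k *ₗ vec k i
      eigenframe k i u = begin
        sum (λ w → ofℤ (lookup (lookup (matrices t) u) w) * vec k i w)
          ≈⟨ sum-cong (λ w → *-congʳ (ev-integral (lookup (lookup (matrices t) u) w))) ⟨
        sum (λ w → ev (integral (lookup (lookup (matrices t) u) w)) * vec k i w)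
          ≈⟨ L√.h-∑-* (λ w → integral (lookup (lookup (matrices t) u) w)) (Z√5.entry basis (row (multiplicities t) k i)) ⟨
        ev (apply√ (matrices t) (Z√5.entry basis (row (multiplicities t) k i)) u)
          ≡⟨ ≡.cong ev (eigen k i u) ⟩
        ev (lookup (proj₂ (values t)) k *√ Z√5.entry basis (row (multiplicities t) k i) u)
          ≈⟨ ev-* (lookup (proj₂ (values t)) k) (Z√5.entry basis (row (multiplicities t) k i) u) ⟩
        ev (lookup (proj₂ (values t)) k) * vec k i u
          ≈⟨ *-congʳ (θs-of-ev t k) ⟨
        lookup (θs-of t) k * vec k i u ∎

-- The action of the generators of T in the labels

nb-injective : ∀ u i j → nb u i ≡ nb u j → i ≡ j
nb-injective = decided (Fin.all? λ u → Fin.all? λ i → Fin.all? λ j → (nb u i Fin.≟ nb u j) →-dec (i Fin.≟ j)) ≡.refl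

module Model (ℜ : RealNumbers) {n} {Γ : Graph n} {φ : Fin 20 → Fin n} (L : Labelling Γ φ) where

  open Sums ℜ
  open Lifting ℜ
  open Graph Γ using (Adj; adj?)
  open Labelling L
  open Labelled L
  open Terwilliger ℜ Γ 5 (φ 0F) using (A; E*; e*; T; V; fromEssential; basis-I; basis-II; basis-III) public
  open IsotypicDecomposition ℜ Γ 5 (φ 0F) public

  open Lℤ using () renaming (h-∑-* to ofℤ-∑-*)

  Lifts : V → (Fin 20 → ℤ) → Set
  Lifts = Lℤ.Lifts φ ψ φψ ψφ

  ofℤ-if : ∀ {P : Set} (P? : Dec P) z → ofℤ (if does P? then z else + 0) ≈ indicator P? * ofℤ z
  ofℤ-if (yes _) z = sym (*-identityˡ (ofℤ z))
  ofℤ-if (no _)  z = sym (zeroˡ (ofℤ z))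

  -- `nb` enumerates the neighbours of a vertex without repetition, so a row of the adjacency matrix
  -- collapses to three terms.
  A-at : ∀ v u → (A · v) (φ u) ≈ sum (λ j → v (φ (nb u j)))
  A-at v u = sum-enumeration (adj? (φ u)) record
    { at        = λ j → φ (nb u j)
    ; injective = λ eq → nb-injective u _ _ (φ-injective eq)
    ; sound     = adj-nb u
    ; index     = nb-all u
    } v

  E*-at : ∀ i v u → (E* i · v) (φ u) ≈ indicator (level u ℕ.≟ i) * v (φ u)
  E*-at i v u = begin
    (E* i · v) (φ u)
      ≈⟨ sum-only (φ u) (λ z z≢ → trans (*-congʳ (indicator-no ((φ u Fin.≟ z) ×-dec distance? Γ (φ 0F) (φ u) i)
           (z≢ ∘ ≡.sym ∘ proj₁))) (zeroˡ (v z))) ⟩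
    indicator ((φ u Fin.≟ φ u) ×-dec distance? Γ (φ 0F) (φ u) i) * v (φ u)
      ≈⟨ *-congʳ (indicator-⇔ ((φ u Fin.≟ φ u) ×-dec distance? Γ (φ 0F) (φ u) i) (level u ℕ.≟ i)
           (level-distance ∘ proj₂) (λ { ≡.refl → ≡.refl , distance-level u })) ⟩
    indicator (level u ℕ.≟ i) * v (φ u) ∎

  A-lift : ∀ {v} p → Lifts v p → Lifts (A · v) (adjℤ p)
  A-lift {v} p v↑ u = trans (A-at v u) (trans (sum-cong λ j → v↑ (nb u j)) (sym (Lℤ.h-∑ (λ j → p (nb u j)))))

  E*-lift : ∀ i {v} p → Lifts v p → Lifts (E* i · v) (restrict i p)
  E*-lift i {v} p v↑ u = trans (E*-at i v u) (trans (*-congˡ (v↑ u)) (sym (ofℤ-if (level u ℕ.≟ i) (p u))))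

  e*-lift : ∀ i → Lifts (e* i) (restrict i (λ _ → + 1))
  e*-lift i u = begin
    indicator (distance? Γ (φ 0F) (φ u) i)      ≈⟨ indicator-⇔ (distance? Γ (φ 0F) (φ u) i) (level u ℕ.≟ i)
                                                     level-distance (λ { ≡.refl → distance-level u }) ⟩
    indicator (level u ℕ.≟ i)                   ≈⟨ trans (*-comm _ 1#) (*-identityˡ _) ⟨
    indicator (level u ℕ.≟ i) * 1#              ≈⟨ *-congˡ ofℤ-1 ⟨
    indicator (level u ℕ.≟ i) * ofℤ (+ 1)       ≈⟨ ofℤ-if (level u ℕ.≟ i) (+ 1) ⟨
    ofℤ (restrict i (λ _ → + 1) u)              ∎

  essential-lift : ∀ {k} (ys : Fin k → Fin n) (t : Fin k → Fin 20) → (∀ j → ys j ≡ φ (t j)) →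
                   ∀ c → Lifts (fromEssential ys c) (essential c t)
  essential-lift ys t ys≡ c u = begin
    sum (λ j → ofℤ (lookup c j) * indicator (ys j Fin.≟ φ u))
      ≈⟨ sum-cong (λ j → *-congˡ (here j)) ⟩
    sum (λ j → ofℤ (lookup c j) * ofℤ (if does (t j Fin.≟ u) then + 1 else + 0))
      ≈⟨ ofℤ-∑-* (lookup c) (λ j → if does (t j Fin.≟ u) then + 1 else + 0) ⟨
    ofℤ (essential c t u) ∎
    where
    here : ∀ j → indicator (ys j Fin.≟ φ u) ≈ ofℤ (if does (t j Fin.≟ u) then + 1 else + 0)
    here j = trans
      (indicator-⇔ (ys j Fin.≟ φ u) (t j Fin.≟ u) (λ eq → φ-injective (≡.trans (≡.sym (ys≡ j)) eq))
        (λ eq → ≡.trans (ys≡ j) (≡.cong φ eq)))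
      (sym (trans (ofℤ-if (t j Fin.≟ u) (+ 1)) (trans (*-comm _ _) (trans (*-congʳ ofℤ-1) (*-identityˡ _)))))

  basis-II-lift : ∀ {ν} p → Lifts ν p → ∀ i → Lifts (basis-II ν i) (bases-II p i)
  basis-II-lift {ν} p ν↑ = λ
    { 0F → ν↑ ; 1F → A¹ ; 2F → E*-lift 2 p² A² ; 3F → E*-lift 3 p² A² ; 4F → E*-lift 3 p³ A³ ; 5F → E*-lift 4 p³ A³ }
    where
    p¹ p² p³ : Fin 20 → ℤ
    p¹ = adjℤ p
    p² = adjℤ p¹
    p³ = adjℤ p²
    A¹ : Lifts (A · ν) p¹
    A¹ = A-lift p ν↑
    A² : Lifts (A · A · ν) p²
    A² = A-lift p¹ A¹
    A³ : Lifts (A · A · A · ν) p³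
    A³ = A-lift p² A²

  basis-III-lift : ∀ {ν} p → Lifts ν p → ∀ i → Lifts (basis-III ν i) (bases-III p i)
  basis-III-lift p ν↑ 0F = ν↑
  basis-III-lift p ν↑ 1F = E*-lift 3 (adjℤ p) (A-lift p ν↑)

  -- The number of vertices stays a variable here and below: for a literal 20
  -- sums over the vertices would be unrolled whenever types are compared.
  graph-hasSpectrum : ∀ √5 (√5-sqrt : RealNumbers.IsSqrt ℜ (RealNumbers.fromℕ ℜ 5) √5) →
    let open Root √5 √5-sqrt in
    20 ≡ n → HasSpectrum A (List.tabulate λ k → lookup θs k , graph-multiplicities k)
  graph-hasSpectrum √5 √5-sqrt 20≡n = Spectra.hasSpectrum ℜ A (lookup θs) graph-multiplicities frame eigenframe
    (apart eigenvalues θs θs-ev eigenvalues-distinct) 20≡n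
    where
    open Root √5 √5-sqrt
    vec : ∀ k → Fin (graph-multiplicities k) → V
    vec k i y = ev (Z√5.entry graph-basis (row graph-multiplicities k i) (ψ y))

    at-φ : ∀ k i u → vec k i (φ u) ≈ ev (Z√5.entry graph-basis (row graph-multiplicities k i) u)
    at-φ k i u = reflexive (≡.cong (λ u → ev (Z√5.entry graph-basis (row graph-multiplicities k i) u)) (ψφ u))

    frame : Frame n graph-multiplicities
    frame = L√.lift-frame φ ψ φψ ψφ graph-multiplicities graph-basis graph-dual graph-dual-basis
      (ev-#0 (integral (+ 2160)) λ ()) vec at-φ

    eigenframe : ∀ k i → A · vec k i ≈ᴹ lookup θs k *ₗ vec k i
    eigenframe k i = L√.lifts-≈ φ ψ φψ ψφ {p = λ u → lookup eigenvalues k *√ b u}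
      (λ u → begin
        (A · vec k i) (φ u)                    ≈⟨ A-at (vec k i) u ⟩
        sum (λ j → vec k i (φ (nb u j)))       ≈⟨ sum-cong (λ j → at-φ k i (nb u j)) ⟩
        sum (λ j → ev (b (nb u j)))            ≈⟨ L√.h-∑ (λ j → b (nb u j)) ⟨
        ev (adj√ b u)                          ≡⟨ ≡.cong ev (graph-eigen k i u) ⟩
        ev (lookup eigenvalues k *√ b u)       ∎)
      (λ u → trans (*-cong (θs-ev k) (at-φ k i u)) (sym (ev-* (lookup eigenvalues k) (b u))))
      where
      b : Fin 20 → ℤ[√5]
      b = Z√5.entry graph-basis (row graph-multiplicities k i)

  module Decomposed (νa νb ν₂ : V) (νa↑ : Lifts νa (essential seed-IIa inner)) (νb↑ : Lifts νb (essential seed-IIb inner))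
             (s : Sign) (ν₂↑ : Lifts ν₂ (signed s ∘ essential seed-III middle)) where

    vecs : ∀ k → Fin (size (lookup types k)) → V
    vecs 0F = basis-I
    vecs 1F = basis-II νa
    vecs 2F = basis-II νb
    vecs 3F = basis-III ν₂

    vecs-lift : ∀ k i → Lifts (vecs k i) (bases s k i)
    vecs-lift 0F i = e*-lift (toℕ i)
    vecs-lift 1F   = basis-II-lift (essential seed-IIa inner) νa↑
    vecs-lift 2F   = basis-II-lift (essential seed-IIb inner) νb↑
    vecs-lift 3F   = basis-III-lift (signed s ∘ essential seed-III middle) ν₂↑

    private
      dims : Fin 4 → ℕ
      dims = size ∘ lookup types

      entry-row : ∀ k i u → Zℤ.entry (Zℤ.table (Zℤ.rows (bases s))) (row dims k i) u ≡ bases s k i u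
      entry-row k i u = ≡.trans (Zℤ.entry-table (Zℤ.rows (bases s)) (row dims k i) u)
        (≡.cong (λ (k , i) → bases s k i u) (unrow-row dims k i))

    frame : Frame n dims
    frame = Lℤ.lift-frame φ ψ φψ ψφ dims (Zℤ.table (Zℤ.rows (bases s))) (Zℤ.table (Zℤ.rows (duals s)))
      (bases-duals s) (ofℤ#0 {+ 18} λ ()) vecs
      (λ k i u → trans (vecs-lift k i u) (reflexive (≡.cong ofℤ (≡.sym (entry-row k i u)))))

    adjacency : Rep _≟ᵗ_ (lookup types) size frame
    adjacency t = ofℤ-matrix (matrices t)

    A-acts : Acts _≟ᵗ_ (lookup types) size frame A adjacency
    A-acts k j = Lℤ.lifts-≈ φ ψ φψ ψφ {p = λ u → ∑ℤ (λ i → M i ℤ.* bases s k i u)}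
      (λ u → trans (A-lift (bases s k j) (vecs-lift k j) u) (reflexive (≡.cong ofℤ (bases-adjacency s k j u))))
      (Lℤ.combination-lift φ ψ φψ ψφ M {v = vecs k} {p = bases s k} (vecs-lift k))
      where
      M : Fin (dims k) → ℤ
      M i = lookup (lookup (matrices (lookup types k)) i) j

    E*-acts : ∀ i k j → E* i · vecs k j ≈ᴹ indicator (levels (lookup types k) j ℕ.≟ i) *ₗ vecs k j
    E*-acts i k j y = ≡.subst (λ y → (E* i · vecs k j) y ≈ indicator (levels (lookup types k) j ℕ.≟ i) * vecs k j y)
      (φψ y) (at (ψ y))
      where
      at : ∀ u → (E* i · vecs k j) (φ u) ≈ indicator (levels (lookup types k) j ℕ.≟ i) * vecs k j (φ u)
      at u with level u ℕ.≟ levels (lookup types k) j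
      ... | yes eq = trans (E*-at i (vecs k j) u) (*-congʳ
        (indicator-⇔ (level u ℕ.≟ i) (levels (lookup types k) j ℕ.≟ i) (≡.trans (≡.sym eq)) (≡.trans eq)))
      ... | no  ≢  = trans (E*-at i (vecs k j) u) (trans (*-congˡ zero-at) (trans (zeroʳ _)
        (sym (trans (*-congˡ zero-at) (zeroʳ _)))))
        where
        zero-at : vecs k j (φ u) ≈ 0#
        zero-at = trans (vecs-lift k j u) (reflexive (≡.cong ofℤ (bases-levels s k j u ≢)))

    orthogonal : ∀ {k l} → k ≢ l → ∀ i j → ⟨ vecs k i , vecs l j ⟩ ≈ 0#
    orthogonal {k} {l} k≢l i j = trans
      (Lℤ.dot-lift φ ψ φψ ψφ {p = bases s k i} {bases s l j} (vecs-lift k i)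
        (λ u → trans (conj-cong (vecs-lift l j u)) (conj-ofℤ (bases s l j u))))
      (reflexive (≡.cong ofℤ (bases-orthogonal s k l k≢l i j)))

    ⟦_⟧ʷ : Word → Matrix n
    ⟦ Aʷ ⟧ʷ    = A
    ⟦ Eʷ i ⟧ʷ  = E* (toℕ i)
    ⟦ v ⊙ w ⟧ʷ = ⟦ v ⟧ʷ ⊗ ⟦ w ⟧ʷ
    ⟦ v ⊞ w ⟧ʷ = ⟦ v ⟧ʷ +ᴹ ⟦ w ⟧ʷ
    ⟦ z ⊡ w ⟧ʷ = ofℤ z *ₗ ⟦ w ⟧ʷ

    word∈T : ∀ w → ⟦ w ⟧ʷ ∈ T
    word∈T Aʷ      = T.A∈T
    word∈T (Eʷ i)  = T.E*∈T (ℕ.≤-pred (Fin.toℕ<n i))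
    word∈T (v ⊙ w) = T.⊗-closed (word∈T v) (word∈T w)
    word∈T (v ⊞ w) = T.+-closed (word∈T v) (word∈T w)
    word∈T (z ⊡ w) = T.*-closed (ofℤ z) (word∈T w)

    ofℤ-table : ∀ {m} → Zℤ.Table m m → Matrix m
    ofℤ-table M (a , b) = ofℤ (Zℤ.entry M a b)

    word-acts : ∀ w → Acts _≟ᵗ_ (lookup types) size frame ⟦ w ⟧ʷ (λ t → ofℤ-table (action w t))
    word-acts Aʷ      = A-acts
    word-acts (Eʷ i)  = Acts-cong _≟ᵗ_ (lookup types) size frame
      {ρ = λ t (a , b) → indicator (levels t b ℕ.≟ toℕ i) * indicator (a Fin.≟ b)}
      (λ t (a , b) → sym (begin
        ofℤ (Zℤ.entry (action (Eʷ i) t) a b)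
          ≡⟨ ≡.cong ofℤ (Zℤ.entry-table (λ a b → if does (levels t b ℕ.≟ toℕ i) then Zℤ.kronecker a b (+ 1) else + 0) a b) ⟩
        ofℤ (if does (levels t b ℕ.≟ toℕ i) then Zℤ.kronecker a b (+ 1) else + 0)
          ≈⟨ ofℤ-if (levels t b ℕ.≟ toℕ i) (Zℤ.kronecker a b (+ 1)) ⟩
        indicator (levels t b ℕ.≟ toℕ i) * ofℤ (Zℤ.kronecker a b (+ 1))
          ≈⟨ *-congˡ (trans (ofℤ-if (a Fin.≟ b) (+ 1)) (trans (*-comm _ _) (trans (*-congʳ ofℤ-1) (*-identityˡ _)))) ⟩
        indicator (levels t b ℕ.≟ toℕ i) * indicator (a Fin.≟ b) ∎))
      (λ k j y → trans (E*-acts (toℕ i) k j y) (trans (*-congˡ (sym (combination-unit (vecs k) j y)))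
          (sym (combination-* (indicator (levels (lookup types k) j ℕ.≟ toℕ i)) (λ a → indicator (a Fin.≟ j)) (vecs k) y))))
    word-acts (v ⊙ w) = Acts-cong _≟ᵗ_ (lookup types) size frame
      {ρ = λ t → ofℤ-table (action v t) ⊗ ofℤ-table (action w t)}
      (λ t (a , b) → sym (trans (reflexive (≡.cong ofℤ (Zℤ.entry-table
          (λ a b → ∑ℤ (λ c → Zℤ.entry (action v t) a c ℤ.* Zℤ.entry (action w t) c b)) a b)))
        (ofℤ-∑-* (Zℤ.entry (action v t) a) (λ c → Zℤ.entry (action w t) c b))))
      (Acts-⊗ _≟ᵗ_ (lookup types) size frame {ρ = λ t → ofℤ-table (action v t)} {λ t → ofℤ-table (action w t)}
        (word-acts v) (word-acts w))
    word-acts (v ⊞ w) = Acts-cong _≟ᵗ_ (lookup types) size frame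
      {ρ = λ t → ofℤ-table (action v t) +ᴹ ofℤ-table (action w t)}
      (λ t (a , b) → sym (trans (reflexive (≡.cong ofℤ (Zℤ.entry-table
          (λ a b → Zℤ.entry (action v t) a b ℤ.+ Zℤ.entry (action w t) a b) a b)))
        (ofℤ-homo-+ (Zℤ.entry (action v t) a b) (Zℤ.entry (action w t) a b))))
      (Acts-+ _≟ᵗ_ (lookup types) size frame {ρ = λ t → ofℤ-table (action v t)} {λ t → ofℤ-table (action w t)}
        (word-acts v) (word-acts w))
    word-acts (z ⊡ w) = Acts-cong _≟ᵗ_ (lookup types) size frame
      {ρ = λ t → ofℤ z *ₗ ofℤ-table (action w t)}
      (λ t (a , b) → sym (trans (reflexive (≡.cong ofℤ (Zℤ.entry-table
          (λ a b → z ℤ.* Zℤ.entry (action w t) a b) a b)))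
        (ofℤ-homo-* z (Zℤ.entry (action w t) a b))))
      (Acts-* _≟ᵗ_ (lookup types) size frame (ofℤ z) {ρ = λ t → ofℤ-table (action w t)} (word-acts w))

    certificate : Certificate _≟ᵗ_ (lookup types) size frame
    certificate = record
      { summand    = λ { I → 0F , ≡.refl ; II → 1F , ≡.refl ; III → 3F , ≡.refl }
      ; adjacency  = adjacency
      ; A-acts     = A-acts
      ; lev        = levels
      ; E*-acts    = E*-acts
      ; unit       = unit
      ; orthogonal = orthogonal
      }
      where
      unit : ∀ t i j → ∃[ B ] B ∈ T × ∃[ ρ ] Acts _≟ᵗ_ (lookup types) size frame B ρ ×
             IsUnit _≟ᵗ_ (lookup types) size frame t i j ρ
      unit t i j =
        let (z , z≢0 , same) , diff = unit-words t i j
            w , zw≈1 = inverse (ofℤ#0 z≢0)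
            u = unit-word t i j
        -- The word acts as `z` times the unit, and `w` is the inverse of `z` in ℂ.
        in w *ₗ ⟦ u ⟧ʷ , T.*-closed w (word∈T u) , (λ t → w *ₗ ofℤ-table (action u t)) ,
           Acts-* _≟ᵗ_ (lookup types) size frame w {ρ = λ t → ofℤ-table (action u t)} (word-acts u) ,
           (λ a b → begin
             w * ofℤ (Zℤ.entry (action u t) a b)
               ≡⟨ ≡.cong (λ z → w * ofℤ z) (same a b) ⟩
             w * ofℤ (if does ((a Fin.≟ i) ×-dec (b Fin.≟ j)) then z else + 0)
               ≈⟨ *-congˡ (trans (ofℤ-if ((a Fin.≟ i) ×-dec (b Fin.≟ j)) z) (*-comm _ (ofℤ z))) ⟩
             w * (ofℤ z * indicator ((a Fin.≟ i) ×-dec (b Fin.≟ j)))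
               ≈⟨ trans (sym (*-assoc w (ofℤ z) _)) (*-congʳ (trans (*-comm w (ofℤ z)) zw≈1)) ⟩
             1# * indicator ((a Fin.≟ i) ×-dec (b Fin.≟ j))
               ≈⟨ *-identityˡ _ ⟩
             indicator ((a Fin.≟ i) ×-dec (b Fin.≟ j)) ∎) ,
           λ t′ t′≢t (a , b) → trans (*-congˡ (reflexive (≡.cong ofℤ (diff t′ t′≢t a b)))) (zeroʳ w)

-- The four summands and their data

levels-≤5 : ∀ t j → levels t j ℕ.≤ 5
levels-≤5 = decided (all-types? λ t → Fin.all? λ j → levels t j ℕ.≤? 5) ≡.refl

levels-increasing : ∀ t i j → i Fin.≤ j → levels t i ℕ.≤ levels t j
levels-increasing = decided (all-types? λ t → Fin.all? λ i → Fin.all? λ j →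
  (i Fin.≤? j) →-dec (levels t i ℕ.≤? levels t j)) ≡.refl

-- The sets of levels are nested: 2 to 3 for type III, 1 to 4 for type II, 0 to 5 for type I. Which
-- of the two types has a level that the other lacks depends on their order, hence the two
-- alternatives.
levels-separate : ∀ t t′ → t ≢ t′ → (∃[ j ] ∀ j′ → levels t′ j′ ≢ levels t j) ⊎ (∃[ j ] ∀ j′ → levels t j′ ≢ levels t′ j)
levels-separate = decided (all-types? λ t → all-types? λ t′ → ¬? (t ≟ᵗ t′) →-dec
  ((Fin.any? λ j → Fin.all? λ j′ → ¬? (levels t′ j′ ℕ.≟ levels t j)) ⊎-dec
   (Fin.any? λ j → Fin.all? λ j′ → ¬? (levels t j′ ℕ.≟ levels t′ j)))) ≡.refl

-- The units are numbered type by type, following 76 = 36 + 36 + 4.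
decode : Fin 76 → Σ[ t ∈ ModuleType ] Fin (size t) × Fin (size t)
decode p = [ (λ q → I , remQuot 6 q) , (λ r → [ (λ q → II , remQuot 6 q) , (λ q → III , remQuot 2 q) ]′ (splitAt 36 r)) ]′
  (splitAt 36 p)

encode : Σ[ t ∈ ModuleType ] Fin (size t) × Fin (size t) → Fin 76
encode (I   , i , j) = combine i j ↑ˡ 40
encode (II  , i , j) = 36 ↑ʳ (combine i j ↑ˡ 4)
encode (III , i , j) = 36 ↑ʳ (36 ↑ʳ combine i j)

decode-encode : ∀ q → decode (encode q) ≡ q
decode-encode (t , i , j) = decided (all-types? λ t → Fin.all? λ i → Fin.all? λ j →
  Product.≡-dec _≟ᵗ_ (Product.≡-dec Fin._≟_ Fin._≟_) (decode (encode (t , i , j))) (t , i , j)) ≡.refl t i j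

encode-decode : ∀ p → encode (decode p) ≡ p
encode-decode = decided (Fin.all? λ p → encode (decode p) Fin.≟ p) ≡.refl

module Assembly (ℜ : RealNumbers) {n} {Γ : Graph n} {φ : Fin 20 → Fin n} (L : Labelling Γ φ)
  (νa νb ν₂ : Terwilliger.V ℜ Γ 5 (φ 0F))
  (νa↑ : Model.Lifts ℜ L νa (essential seed-IIa inner))
  (νb↑ : Model.Lifts ℜ L νb (essential seed-IIb inner))
  (s : Sign) (ν₂↑ : Model.Lifts ℜ L ν₂ (signed s ∘ essential seed-III middle)) where

  open Sums ℜ
  open Model ℜ L hiding (A; E*; e*; T; V; fromEssential; basis-I; basis-II; basis-III)
  open Decomposed νa νb ν₂ νa↑ νb↑ s ν₂↑
  open Terwilliger ℜ Γ 5 (φ 0F)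

  private
    type : Fin 4 → ModuleType
    type = lookup types

  dim-T : HasDim T 76
  dim-T = T-hasDim _≟ᵗ_ type size frame certificate decode encode decode-encode encode-decode

  W : Fin 4 → V → Set
  W k = Span (vecs k)

  W-directSum : IsOrthogonalDirectSum W
  W-directSum = isOrthogonalDirectSum _≟ᵗ_ type size frame certificate

  W-≅ : ∀ k l → (W k ≅ W l) ⇔ (type k ≡ type l)
  W-≅ k l = mk⇔ same (span-≅-same-type _≟ᵗ_ type size frame certificate k l)
    where
    same : W k ≅ W l → type k ≡ type l
    same iso with type k ≟ᵗ type l
    ... | yes eq = eq
    ... | no  ≢ with levels-separate (type k) (type l) ≢
    ...   | inj₁ (j , none) = contradiction iso
      (≇-of-support _≟ᵗ_ type size frame certificate k l j (levels-≤5 (type k) j) none)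
    ...   | inj₂ (j , none) = contradiction iso
      (≇-of-support′ _≟ᵗ_ type size frame certificate k l j (levels-≤5 (type l) j) none)

  W-multiplicity : ∀ k m → ∣ subset (λ l → type l ≟ᵗ type k) ∣ ≡ m → HasMultiplicity W k m
  W-multiplicity k m size≡ = subset same? , (λ l → mk⇔
    (Equivalence.from (W-≅ l k) ∘ Equivalence.to (∈-subset same? l))
    (Equivalence.from (∈-subset same? l) ∘ Equivalence.to (W-≅ l k))) , size≡
    where
    same? : ∀ l → Dec (type l ≡ type k)
    same? l = type l ≟ᵗ type k

  level-2 : ∀ k j → levels (type k) j ≡ 2 → vecs k j ≈ᴹ E* 2 · vecs k j
  level-2 k j = E*-vec _≟ᵗ_ type size frame certificate k j

  module _ (k : Fin 4) (j₀ : Fin (size (type k))) (least : ∀ j → levels (type k) j₀ ℕ.≤ levels (type k) j) where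

    private
      r : ℕ
      r = levels (type k) j₀

    W-endpoint : HasEndpoint (W k) r
    W-endpoint = hasEndpoint _≟ᵗ_ type size frame certificate k j₀ (levels-≤5 (type k) j₀) least

    W-seed : (∀ j → levels (type k) j ≡ r → j₀ ≡ j) → IsSeed (W k) r (vecs k j₀)
    W-seed only = W-endpoint , E*-basis _≟ᵗ_ type size frame certificate k r record
      { at        = λ _ → j₀
      ; injective = λ { {zero} {zero} _ → ≡.refl ; {suc ()} ; {zero} {suc ()} }
      ; sound     = λ _ → ≡.refl
      ; index     = λ {j} eq → zero , only j eq
      }

    W-data : ∀ δ (shape : Vec ℕ (suc δ)) σ →
             ∣ support _≟ᵗ_ type size frame certificate (type k) ∣ ≡ suc δ →
             (∀ i → List.length (List.filter (λ j → levels (type k) j ℕ.≟ r ℕ.+ toℕ i) (List.allFin _)) ≡ lookup shape i) →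
             HasSpectrum (ofℤ-matrix (matrices (type k))) σ →
             HasData (W k) r (size (type k)) δ shape (vecs k) (matrices (type k)) σ
    W-data δ shape σ size≡ shape≡ spectrum = record
      { isIrreducible = span-isIrreducible _≟ᵗ_ type size frame certificate k j₀
      ; endpoint      = W-endpoint
      ; dimension     = vecs k , Frame.span-basis frame k
      ; diameter      = W-diameter
      ; hasShape      = r , W-endpoint , W-diameter , λ i → _ ,
          E*-basis _≟ᵗ_ type size frame certificate k (r ℕ.+ toℕ i)
            (enumerate (λ j → levels (type k) j ℕ.≟ r ℕ.+ toℕ i) (shape≡ i))
      ; isPureBasis   = isPureBasis _≟ᵗ_ type size frame certificate k (levels-≤5 (type k)) (levels-increasing (type k))
      ; represents    = A-acts k
      ; spectrum      = spectrum
      }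
      where
      W-diameter : HasDiameter (W k) δ
      W-diameter = hasDiameter _≟ᵗ_ type size frame certificate k δ size≡

-- The decomposition of the standard module

open import Data.Nat.Base using (_+_; _^_)

module _ (ℜ : RealNumbers) where

  open LinearAlgebra ℜ

  -- The theorem lists its summands in a vector, and `lookup` in this vector equals the family of
  -- spans only index by index.
  directSum-resp : ∀ {n k} {W W′ : Vector (Pred (Vector ℂ n) 0ℓ) k} → (∀ i → W i ≡ W′ i) →
                   IsOrthogonalDirectSum W → IsOrthogonalDirectSum W′
  directSum-resp {n} {W = W} {W′} W≡W′ S = record
    { decompose  = λ v → let w , w∈ , v≈ = decompose v in w , (λ i → to i (w∈ i)) , v≈
    ; unique     = λ w w∈ → unique w (λ i → from i (w∈ i))
    ; orthogonal = λ i≢j u v u∈ v∈ → orthogonal i≢j u v (from _ u∈) (from _ v∈)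
    }
    where
    open IsOrthogonalDirectSum S
    to : ∀ i {v} → v ∈ W i → v ∈ W′ i
    to i {v} = ≡.subst (v ∈_) (W≡W′ i)
    from : ∀ i {v} → v ∈ W′ i → v ∈ W i
    from i {v} = ≡.subst (v ∈_) (≡.sym (W≡W′ i))

-- The conclusion for a variable number of vertices. The first summand is a parameter, so that this
-- can serve as the family of a Σ-type over it.
Decomposition : ∀ (ℜ : RealNumbers) (√5 : RealNumbers.ℝ ℜ) {n} (Γ : Graph n) (x : Fin n)
                (νa νb ν₂ : Terwilliger.V ℜ Γ 5 x) (W₀ : Terwilliger.V ℜ Γ 5 x → Set) → Set₁
Decomposition ℜ √5 Γ x νa νb ν₂ W₀ =
  let open LinearAlgebra ℜ hiding (_+_)
      open AdjacencyMatrix ℜ Γ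
      open Eigenvalues ℜ √5
      open Terwilliger ℜ Γ 5 x hiding (A)
  in
  ∃[ W₁ₐ ] ∃[ W₁b ] ∃[ W₂ ]
  let W    = lookup (W₀ ∷ W₁ₐ ∷ W₁b ∷ W₂ ∷ [])
      type = lookup (I ∷ II ∷ II ∷ III ∷ [])
  in
  IsOrthogonalDirectSum W ×
  (∀ i j → (W i ≅ W j) ⇔ (type i ≡ type j)) ×
  HasData W₀  0 6 5 (1 ∷ 1 ∷ 1 ∷ 1 ∷ 1 ∷ 1 ∷ []) basis-I        matrix-I   spectrum-I   ×
  HasData W₁ₐ 1 6 3 (1 ∷ 2 ∷ 2 ∷ 1 ∷ [])         (basis-II νa)  matrix-II  spectrum-II  ×
  HasData W₁b 1 6 3 (1 ∷ 2 ∷ 2 ∷ 1 ∷ [])         (basis-II νb)  matrix-II  spectrum-II  ×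
  HasData W₂  2 2 1 (1 ∷ 1 ∷ [])                 (basis-III ν₂) matrix-III spectrum-III ×
  HasMultiplicity W (# 0) 1 ×
  HasMultiplicity W (# 1) 2 ×
  HasMultiplicity W (# 2) 2 ×
  HasMultiplicity W (# 3) 1 ×
  IsSeed W₁ₐ 1 νa ×
  IsSeed W₁b 1 νb ×
  IsSeed W₂  2 ν₂ ×
  (A · νa ≈ᴹ E* 2 · A · νa) ×
  (A · νb ≈ᴹ E* 2 · A · νb)

module Summary (ℜ : RealNumbers) (√5 : RealNumbers.ℝ ℜ) (√5-sqrt : RealNumbers.IsSqrt ℜ (RealNumbers.fromℕ ℜ 5) √5)
  {n} {Γ : Graph n} {φ : Fin 20 → Fin n} (L : Labelling Γ φ) where

  open Labelling L
  open Labelled L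
  open LinearAlgebra ℜ hiding (_+_)
  open Eigenvalues ℜ √5
  open Terwilliger ℜ Γ 5 (φ 0F)
  private
    module M = Model ℜ L
    module R = Lifting.Root ℜ √5 √5-sqrt

  graph-spectrum : 20 ≡ n → HasSpectrum A spectrum-Γ
  graph-spectrum = M.graph-hasSpectrum √5 √5-sqrt

  seed-lift : ∀ {k} (t : Fin k → Fin 20) c → M.Lifts (fromEssential (φ ∘ t) c) (essential c t)
  seed-lift t = M.essential-lift (φ ∘ t) t (λ _ → ≡.refl)

  T-dimension : HasDim T 76
  T-dimension = Assembly.dim-T ℜ L (fromEssential (φ ∘ inner) seed-IIa) (fromEssential (φ ∘ inner) seed-IIb)
    (fromEssential (φ ∘ middle) seed-III) (seed-lift inner seed-IIa) (seed-lift inner seed-IIb) ⊕ (seed-lift middle seed-III)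

  module _ (v : Vector (Fin n) 3) (v≡ : ∀ j → v j ≡ φ (inner j)) (y : Vector (Fin n) 6) (Y : IsAdmissible Γ (φ 0F) y)
    {νa νb ν₂ : V} (νa≡ : νa ≡ fromEssential v seed-IIa) (νb≡ : νb ≡ fromEssential v seed-IIb)
    (ν₂≡ : ν₂ ≡ fromEssential y seed-III) where

    private
      sign : Sign
      sign = proj₁ (seed-signed Y)

      ν₂↑ : M.Lifts (fromEssential y seed-III) (signed sign ∘ essential seed-III middle)
      ν₂↑ u = Complexes.trans ℜ (M.essential-lift y (ψ ∘ y) (λ j → ≡.sym (φψ (y j))) seed-III u)
        (Complexes.reflexive ℜ (≡.cong ofℤ (proj₂ (seed-signed Y) u)))

      module Asm = Assembly ℜ L νa νb ν₂
        (≡.subst (λ ν → M.Lifts ν (essential seed-IIa inner)) (≡.sym νa≡) (M.essential-lift v inner v≡ seed-IIa))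
        (≡.subst (λ ν → M.Lifts ν (essential seed-IIb inner)) (≡.sym νb≡) (M.essential-lift v inner v≡ seed-IIb))
        sign (≡.subst (λ ν → M.Lifts ν (signed sign ∘ essential seed-III middle)) (≡.sym ν₂≡) ν₂↑)

    modules : ∃[ W₀ ] Decomposition ℜ √5 Γ (φ 0F) νa νb ν₂ W₀
    modules = Asm.W 0F , Asm.W 1F , Asm.W 2F , Asm.W 3F ,
      directSum-resp ℜ W≡ Asm.W-directSum ,
      (λ i j → ≡.subst₂ (λ U U′ → (U ≅ U′) ⇔ (lookup types i ≡ lookup types j)) (W≡ i) (W≡ j) (Asm.W-≅ i j)) ,
      data-I , data-IIa , data-IIb , data-III ,
      multiplicity 0F (Asm.W-multiplicity 0F 1 ≡.refl) , multiplicity 1F (Asm.W-multiplicity 1F 2 ≡.refl) ,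
      multiplicity 2F (Asm.W-multiplicity 2F 2 ≡.refl) , multiplicity 3F (Asm.W-multiplicity 3F 1 ≡.refl) ,
      Asm.W-seed 1F 0F least-II only-II , Asm.W-seed 2F 0F least-II only-II , Asm.W-seed 3F 0F least-III only-III ,
      Asm.level-2 1F 1F ≡.refl , Asm.level-2 2F 1F ≡.refl
      where
      W≡ : ∀ i → Asm.W i ≡ lookup (Asm.W 0F ∷ Asm.W 1F ∷ Asm.W 2F ∷ Asm.W 3F ∷ []) i
      W≡ 0F = ≡.refl
      W≡ 1F = ≡.refl
      W≡ 2F = ≡.refl
      W≡ 3F = ≡.refl

      Ws : Fin 4 → V → Set
      Ws = lookup (Asm.W 0F ∷ Asm.W 1F ∷ Asm.W 2F ∷ Asm.W 3F ∷ [])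

      multiplicity : ∀ i {m} → HasMultiplicity Asm.W i m → HasMultiplicity Ws i m
      multiplicity i (S , ∈S , size≡) = S ,
        (λ j → ≡.subst₂ (λ U U′ → (j Subset.∈ S) ⇔ (U ≅ U′)) (W≡ j) (W≡ i) (∈S j)) , size≡

      least-II : ∀ j → 1 ℕ.≤ levels II j
      least-II = decided (Fin.all? λ j → 1 ℕ.≤? levels II j) ≡.refl

      only-II : ∀ j → levels II j ≡ 1 → 0F ≡ j
      only-II = decided (Fin.all? λ j → (levels II j ℕ.≟ 1) →-dec (0F Fin.≟ j)) ≡.refl

      least-III : ∀ j → 2 ℕ.≤ levels III j
      least-III = decided (Fin.all? λ j → 2 ℕ.≤? levels III j) ≡.refl

      only-III : ∀ j → levels III j ≡ 2 → 0F ≡ j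
      only-III = decided (Fin.all? λ j → (levels III j ℕ.≟ 2) →-dec (0F Fin.≟ j)) ≡.refl

      data-I : HasData (Asm.W 0F) 0 6 5 (1 ∷ 1 ∷ 1 ∷ 1 ∷ 1 ∷ 1 ∷ []) basis-I matrix-I spectrum-I
      data-I = Asm.W-data 0F 0F (λ _ → z≤n) 5 (1 ∷ 1 ∷ 1 ∷ 1 ∷ 1 ∷ 1 ∷ []) spectrum-I ≡.refl
        (λ { 0F → ≡.refl ; 1F → ≡.refl ; 2F → ≡.refl ; 3F → ≡.refl ; 4F → ≡.refl ; 5F → ≡.refl }) (R.small-hasSpectrum I ≡.refl)

      data-IIa : HasData (Asm.W 1F) 1 6 3 (1 ∷ 2 ∷ 2 ∷ 1 ∷ []) (basis-II νa) matrix-II spectrum-II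
      data-IIa = Asm.W-data 1F 0F least-II 3 (1 ∷ 2 ∷ 2 ∷ 1 ∷ []) spectrum-II ≡.refl
        (λ { 0F → ≡.refl ; 1F → ≡.refl ; 2F → ≡.refl ; 3F → ≡.refl }) (R.small-hasSpectrum II ≡.refl)

      data-IIb : HasData (Asm.W 2F) 1 6 3 (1 ∷ 2 ∷ 2 ∷ 1 ∷ []) (basis-II νb) matrix-II spectrum-II
      data-IIb = Asm.W-data 2F 0F least-II 3 (1 ∷ 2 ∷ 2 ∷ 1 ∷ []) spectrum-II ≡.refl
        (λ { 0F → ≡.refl ; 1F → ≡.refl ; 2F → ≡.refl ; 3F → ≡.refl }) (R.small-hasSpectrum II ≡.refl)

      data-III : HasData (Asm.W 3F) 2 2 1 (1 ∷ 1 ∷ []) (basis-III ν₂) matrix-III spectrum-III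
      data-III = Asm.W-data 3F 0F least-III 1 (1 ∷ 1 ∷ []) spectrum-III ≡.refl
        (λ { 0F → ≡.refl ; 1F → ≡.refl }) (R.small-hasSpectrum III ≡.refl)

module _ (ℜ : RealNumbers) (√5 : RealNumbers.ℝ ℜ) (√5-sqrt : RealNumbers.IsSqrt ℜ (RealNumbers.fromℕ ℜ 5) √5)
  {n} {Γ : Graph n} where

  decomposition : ∀ {x} v →
    (∃[ φ ] Labelling Γ φ × φ 0F ≡ x × φ (# 4) ≡ v 0F × φ (# 1) ≡ v 1F × φ (# 5) ≡ v 2F) →
    (y : Vector (Fin n) 6) → IsAdmissible Γ x y → ∀ {νa νb ν₂} →
    νa ≡ Terwilliger.fromEssential ℜ Γ 5 x v seed-IIa →
    νb ≡ Terwilliger.fromEssential ℜ Γ 5 x v seed-IIb →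
    ν₂ ≡ Terwilliger.fromEssential ℜ Γ 5 x y seed-III →
    ∃[ W₀ ] Decomposition ℜ √5 Γ x νa νb ν₂ W₀
  decomposition v (φ , L , ≡.refl , e₀ , e₁ , e₂) y Y = Summary.modules ℜ √5 √5-sqrt L v v≡ y Y
    where
    v≡ : ∀ j → v j ≡ φ (inner j)
    v≡ 0F = ≡.sym e₀
    v≡ 1F = ≡.sym e₁
    v≡ 2F = ≡.sym e₂

mainTheorem9 :
    (ℜ : RealNumbers) →
    ∀ √5 → RealNumbers.IsSqrt ℜ (RealNumbers.fromℕ ℜ 5) √5 →
    (Γ : Graph 20) → IsDodecahedron Γ →
    let open LinearAlgebra ℜ hiding (_+_)
        open AdjacencyMatrix ℜ Γ
        open Eigenvalues ℜ √5
    in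
    HasSpectrum A spectrum-Γ ×
    ((x : Fin 20) →
      let open Terwilliger ℜ Γ 5 x hiding (A) in
      (∃[ y ] IsAdmissible Γ x y) ×
      ((v : Vector (Fin 20) 3) → IsOrdering Γ x 1 v →
       (y : Vector (Fin 20) 6) → IsAdmissible Γ x y →
       let νa = fromEssential v seed-IIa
           νb = fromEssential v seed-IIb
           ν₂ = fromEssential y seed-III
       in
       ∃[ W₀ ] ∃[ W₁ₐ ] ∃[ W₁b ] ∃[ W₂ ]
       let W    = lookup (W₀ ∷ W₁ₐ ∷ W₁b ∷ W₂ ∷ [])
           type = lookup (I ∷ II ∷ II ∷ III ∷ [])
       in
       IsOrthogonalDirectSum W ×
       (∀ i j → (W i ≅ W j) ⇔ (type i ≡ type j)) ×
       HasData W₀  0 6 5 (1 ∷ 1 ∷ 1 ∷ 1 ∷ 1 ∷ 1 ∷ []) basis-I        matrix-I   spectrum-I   ×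
       HasData W₁ₐ 1 6 3 (1 ∷ 2 ∷ 2 ∷ 1 ∷ [])         (basis-II νa)  matrix-II  spectrum-II  ×
       HasData W₁b 1 6 3 (1 ∷ 2 ∷ 2 ∷ 1 ∷ [])         (basis-II νb)  matrix-II  spectrum-II  ×
       HasData W₂  2 2 1 (1 ∷ 1 ∷ [])                 (basis-III ν₂) matrix-III spectrum-III ×
       HasMultiplicity W (# 0) 1 ×
       HasMultiplicity W (# 1) 2 ×
       HasMultiplicity W (# 2) 2 ×
       HasMultiplicity W (# 3) 1 ×
       IsSeed W₁ₐ 1 νa ×
       IsSeed W₁b 1 νb ×
       IsSeed W₂  2 ν₂ ×
       (A · νa ≈ᴹ E* 2 · A · νa) ×
       (A · νb ≈ᴹ E* 2 · A · νb)) ×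
      HasDim T (6 ^ 2 + 6 ^ 2 + 2 ^ 2))
mainTheorem9 ℜ √5 √5-sqrt Γ Γ-dodecahedron =
  Summary.graph-spectrum ℜ √5 √5-sqrt (proj₁ (proj₂ (some-labelling Γ-dodecahedron 0F))) ≡.refl ,
  λ x → admissible (some-labelling Γ-dodecahedron x) ,
        (λ v V y Y → modules {v = v} (ordered-labelling Γ-dodecahedron v V) Y ≡.refl ≡.refl ≡.refl) ,
        dimension (some-labelling Γ-dodecahedron x)
  where
  open LinearAlgebra ℜ hiding (_+_)
  open Eigenvalues ℜ √5

  admissible : ∀ {x} → (∃[ φ ] Labelling Γ φ × φ (# 0) ≡ x) → ∃[ y ] IsAdmissible Γ x y
  admissible (φ , L , ≡.refl) = φ ∘ middle , Labelled.middle-admissible L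

  dimension : ∀ {x} → (∃[ φ ] Labelling Γ φ × φ (# 0) ≡ x) → HasDim (Terwilliger.T ℜ Γ 5 x) 76
  dimension (φ , L , ≡.refl) = Summary.T-dimension ℜ √5 √5-sqrt L

  -- The ν are variables, and the result is an explicit Σ-type, so that Agda
  -- reads the ν off the goal instead of evaluating the bases for n = 20.
  modules : ∀ {x v y νa νb ν₂} →
    (∃[ φ ] Labelling Γ φ × φ 0F ≡ x × φ (# 4) ≡ v 0F × φ (# 1) ≡ v 1F × φ (# 5) ≡ v 2F) →
    IsAdmissible Γ x y →
    νa ≡ Terwilliger.fromEssential ℜ Γ 5 x v seed-IIa →
    νb ≡ Terwilliger.fromEssential ℜ Γ 5 x v seed-IIb →
    ν₂ ≡ Terwilliger.fromEssential ℜ Γ 5 x y seed-III →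
    Σ (Terwilliger.V ℜ Γ 5 x → Set) (Decomposition ℜ √5 Γ x νa νb ν₂)
  modules {v = v} {y} L Y = decomposition ℜ √5 √5-sqrt v L y Y
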